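{- Let $m\ge3$ be odd, $n,p,q\ge2$ even, and $k\ge3$. Suppose $\mathcal{F}_i$, $\mathcal{G}_i$, $\mathcal{H}_i$, $\mathcal{K}_i$ ($1\le i\le k$) are families of pairwise almost orthogonal symmetric chain decompositions of $Q_m$, $Q_n$, $Q_p$, $Q_q$ respectively, with the families for $Q_n$, $Q_p$ and $Q_q$ good. Then there exist $k$ pairwise almost orthogonal symmetric chain decompositions $\mathcal{D}_1,\dots,\mathcal{D}_k$ of $Q_{m+n+p+q}=Q_m\times Q_n\times Q_p\times Q_q$ such that for each $i$ every chain of $\mathcal{D}_i$ is contained in a cuboid $A\times B\times C\times D$ with $A\in\mathcal{F}_i$, $B\in\mathcal{G}_i$, $C\in\mathcal{H}_i$, $D\in\mathcal{K}_i$.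
   Context: $Q_n$ denotes the Boolean lattice of subsets of $[n]=\{1,\dots,n\}$ under inclusion; products of hypercubes (product order) are identified with the hypercube of the summed dimension. A symmetric chain in $Q_n$ consists of exactly one subset of each size $j,\dots,n-j$ for some $j$; a symmetric chain decomposition (SCD) is a partition into symmetric chains. Two SCDs $\mathcal{F},\mathcal{G}$ of $Q_n$ are almost orthogonal if for all chains $A\in\mathcal{F}$, $B\in\mathcal{G}$, $|A\cap B|\le1$, except when $A$ and $B$ both contain $\varnothing$ and $[n]$, in which case $|A\cap B|=2$. For $n$ even, a collection $\{\mathcal{F}^j\}$ of pairwise almost orthogonal SCDs of $Q_n$ is good if the $1$-element chains occurring in the different $\mathcal{F}^j$ are pairwise distinct. -}

module Defs where

open import Data.Nat using (ℕ; zero; suc; _+_; _*_; _∸_; _≤_; _%_)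
open import Data.Bool using (Bool)
import Data.Bool as B
open import Data.Fin using (Fin; toℕ)
open import Data.Fin.Subset using (Subset; _⊆_; ∣_∣) renaming (⊥ to ∅; ⊤ to full)
open import Data.Vec using (Vec; _++_)
open import Data.Vec.Properties using (≡-dec)
open import Data.List using (List; length; filter; lookup; concat)
open import Data.List.Relation.Unary.Any using (any?)
open import Data.List.Relation.Unary.Linked using (Linked)
open import Data.List.Membership.Propositional using (_∈_)
open import Data.Product using (Σ; ∃; ∃-syntax; _×_)
open import Relation.Nullary using (¬_; Dec)
open import Relation.Binary.PropositionalEquality using (_≡_; _≢_)
open import Relation.Binary using (DecidableEquality)

_≟ₛ_ : ∀ {n} → DecidableEquality (Subset n)
_≟ₛ_ = ≡-dec B._≟_


_∈?_ : ∀ {n} (x : Subset n) (c : List (Subset n)) → Dec (x ∈ c)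
x ∈? c = any? (x ≟ₛ_) c

-- A chain is represented as the list of its elements in increasing order.
Chain : ℕ → Set
Chain n = List (Subset n)

IsSymChain : (n : ℕ) → Chain n → Set
IsSymChain n c =
  ∃[ j ] (2 * j ≤ n
         × length c ≡ suc (n ∸ 2 * j)
         × (∀ (t : Fin (length c)) → ∣ lookup c t ∣ ≡ j + toℕ t)
         × Linked _⊆_ c)

count : ∀ {n} → Subset n → List (Subset n) → ℕ
count x l = length (filter (x ≟ₛ_) l)

IsSCD : (n : ℕ) → List (Chain n) → Set
IsSCD n F = (∀ c → c ∈ F → IsSymChain n c)
          × (∀ (x : Subset n) → count x (concat F) ≡ 1)

inter : ∀ {n} → Chain n → Chain n → ℕ
inter A B = length (filter (_∈? B) A)

FullBoth : ∀ {n} → Chain n → Chain n → Set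
FullBoth A B = (∅ ∈ A × full ∈ A) × (∅ ∈ B × full ∈ B)

AlmostOrthogonal : ∀ {n} → List (Chain n) → List (Chain n) → Set
AlmostOrthogonal F G = ∀ A B → A ∈ F → B ∈ G →
  (FullBoth A B → inter A B ≡ 2) × (¬ FullBoth A B → inter A B ≤ 1)

PairwiseAO : ∀ {n k} → (Fin k → List (Chain n)) → Set
PairwiseAO {k = k} F = ∀ (i j : Fin k) → i ≢ j → AlmostOrthogonal (F i) (F j)

Good : ∀ {n k} → (Fin k → List (Chain n)) → Set
Good {k = k} F = ∀ (i j : Fin k) → i ≢ j → ∀ A B → A ∈ F i → B ∈ F j →
  length A ≡ 1 → length B ≡ 1 → A ≢ B

-- chain contained in the cuboid A × B × C × D, with Q_m×Q_n×Q_p×Q_q ≅ Q_{m+(n+(p+q))}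
-- via concatenation of characteristic vectors
InCuboid : ∀ {m n p q} → Chain (m + (n + (p + q)))
  → Chain m → Chain n → Chain p → Chain q → Set
InCuboid {m} {n} {p} {q} X A B C D = ∀ x → x ∈ X →
  Σ (Subset m) λ a → Σ (Subset n) λ b → Σ (Subset p) λ c → Σ (Subset q) λ d →
    x ≡ a ++ (b ++ (c ++ d)) × a ∈ A × b ∈ B × c ∈ C × d ∈ D

{-# OPTIONS --safe #-}

-- Call a pair z, z′ a jump if every coordinate of z′ either agrees with that of z or passes from ∅ to the
-- full set. By almost orthogonality of the factors, two points common to chains of D i and D j (i ≢ j)
-- form a jump. So it suffices to decompose every cuboid A × B × C × D into symmetric chains whose jumps
-- move every coordinate in which the cuboid has more than one element, except that the coordinate in A
-- may stay fixed if B, C or D is a single point: goodness then forces a jump common to two chains to move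
-- all coordinates.
--
-- In a product of two chains with at least three elements each, the usual hooks achieve this once the
-- first and last elements of the two longest hooks are exchanged. Iterating fails only for chains with
-- one or two elements. One-element chains of B × C × D are avoided by keeping the innermost 3 × 3 squares
-- (and the 3 × 3 × 3 cubes they generate) intact until they are multiplied by A. If A has two elements,
-- only the longest chain of B × C × D is harmful; its product with A is repaired by an exchange with
-- the product of A and a second chain that avoids the corners of the cuboid.
module Submission where

open import Defs
open import Data.Nat using (ℕ; zero; suc; _+_; _*_; _∸_; _≤_; _<_; _≤′_; ≤′-refl; ≤′-step; z≤n; s≤s; _≤?_; _%_; _/_)
import Data.Nat as ℕ
open import Data.Nat.Properties hiding (_≟_; _≤?_)
open import Algebra.Properties.CommutativeSemigroup +-commutativeSemigroup using (interchange; x∙yz≈y∙xz)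
open import Data.Nat.DivMod using (m≡m%n+[m/n]*n)
open import Data.Nat.Tactic.RingSolver using (solve-∀)
open import Data.Fin using (Fin; toℕ; #_)
import Data.Fin as F
import Data.Fin.Properties as F
open import Data.Fin.Subset using (Subset; _⊆_; ∣_∣; inside; outside) renaming (⊥ to ∅; ⊤ to full)
open import Data.Fin.Subset.Properties
  using (∣⊥∣≡0; ∣⊤∣≡n; ⊆-antisym; ⊆⊤; ⊆-refl; ⊆-trans; drop-∷-⊆; out⊆; s⊆s)
open import Data.Bool using (Bool; true; false; T; if_then_else_)
open import Data.Maybe using (Maybe; just; nothing)
open import Data.Vec as Vec using ([]; _∷_)
import Data.Vec.Properties as Vec
open import Data.List using (List; []; _∷_; _++_; map; concat; cartesianProduct; allFin; length; filter; lookup)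
open import Data.List.Properties using (concat-++; concat-map)
open import Data.List.Membership.Propositional using (_∈_)
open import Data.List.Membership.Propositional.Properties using (∈-map⁻; ∈-filter⁺; ∈-filter⁻; ∈-concat⁺′)
open import Data.List.Relation.Unary.Any using (here; there)
open import Data.List.Relation.Unary.All as All using (All; []; _∷_)
import Data.List.Relation.Unary.All.Properties as All
open import Data.List.Relation.Unary.AllPairs using (AllPairs; []; _∷_)
import Data.List.Relation.Unary.AllPairs.Properties as AllPairs
open import Data.List.Relation.Unary.Linked using (Linked; linked?; []; [-]; _∷_)
open import Data.Product using (Σ; ∃-syntax; _×_; _,_; proj₁; proj₂)
open import Data.Product.Properties using (≡-dec)
open import Data.Sum using (_⊎_; inj₁; inj₂)
open import Data.Unit using (⊤; tt)
open import Data.Empty using (⊥; ⊥-elim)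
open import Function using (_∘_; id)
open import Relation.Nullary using (¬_; Dec; yes; no; does)
open import Relation.Nullary.Decidable using (_×-dec_; _⊎-dec_; _→-dec_; True; toWitness)
open import Relation.Binary using (DecidableEquality)
open import Relation.Binary.PropositionalEquality

-- Parity decides which short chains occur. A symmetric chain of the odd cube has an even number of
-- elements, one of an even cube an odd number, so the degenerate factors are single points for B,
-- C, D and pairs for A. As m ≥ 3, a two-element A does not contain both ∅ and the full set, so no
-- jump can move its coordinate; if B, C and D all have at least three elements, such a cuboid has
-- to be split into chains without any jump. If one of B, C, D is a single point, every jump fixes
-- that coordinate, and goodness says that this point is not a one-element chain of another family:
-- no jump is shared at all, so the coordinate in A is of no concern. Two-factor constructions can
-- be iterated because each chain carries a relation `E` that holds for the one jump it may have,
-- from its first to its last element. In a product this relation is taken coordinatewise, so it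
-- records that every factor has gone from end to end. A chain without jumps carries `None`.

private variable X Y : Set

-- Weight sums, and decompositions as identities between them

mass : (X → ℕ) → List X → ℕ
mass F []      = 0
mass F (x ∷ l) = F x + mass F l

mass-++ : (F : X → ℕ) (l l′ : List X) → mass F (l ++ l′) ≡ mass F l + mass F l′
mass-++ F []      l′ = refl
mass-++ F (x ∷ l) l′ = trans (cong (F x +_) (mass-++ F l l′)) (sym (+-assoc (F x) _ _))

mass-map : (F : Y → ℕ) (h : X → Y) (l : List X) → mass F (map h l) ≡ mass (F ∘ h) l
mass-map F h []      = refl
mass-map F h (x ∷ l) = cong (F (h x) +_) (mass-map F h l)

mass-cong : {F G : X → ℕ} → (∀ x → F x ≡ G x) → ∀ l → mass F l ≡ mass G l
mass-cong e []      = refl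
mass-cong e (x ∷ l) = cong₂ _+_ (e x) (mass-cong e l)

mass-+ : (F G : X → ℕ) (l : List X) → mass (λ x → F x + G x) l ≡ mass F l + mass G l
mass-+ F G []      = refl
mass-+ F G (x ∷ l) = trans (cong (F x + G x +_) (mass-+ F G l)) (interchange (F x) (G x) _ _)

mass-0 : (l : List X) → mass (λ _ → 0) l ≡ 0
mass-0 []      = refl
mass-0 (x ∷ l) = mass-0 l

mass-swap : (F : X → Y → ℕ) (l : List X) (l′ : List Y) →
  mass (λ x → mass (F x) l′) l ≡ mass (λ y → mass (λ x → F x y) l) l′
mass-swap F []      l′ = sym (mass-0 l′)
mass-swap F (x ∷ l) l′ =
  trans (cong (mass (F x) l′ +_) (mass-swap F l l′)) (sym (mass-+ (F x) _ l′))

mass-cart : (F : X × Y → ℕ) (l : List X) (l′ : List Y) →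
  mass F (cartesianProduct l l′) ≡ mass (λ x → mass (λ y → F (x , y)) l′) l
mass-cart F []      l′ = refl
mass-cart F (x ∷ l) l′ = trans (mass-++ F (map (x ,_) l′) (cartesianProduct l l′))
  (cong₂ _+_ (mass-map F (x ,_) l′) (mass-cart F l l′))

seg : (ℕ → X) → ℕ → List X
seg x zero    = x 0 ∷ []
seg x (suc a) = x 0 ∷ seg (x ∘ suc) a

mass-seg : (F : Y → ℕ) (h : X → Y) (x : ℕ → X) (a : ℕ) →
  mass F (seg (h ∘ x) a) ≡ mass (F ∘ h) (seg x a)
mass-seg F h x zero    = refl
mass-seg F h x (suc a) = cong (F (h (x 0)) +_) (mass-seg F h (x ∘ suc) a)

mass-seg-last : (f : X → ℕ) (y : ℕ → X) (b : ℕ) →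
  mass f (seg y (suc b)) ≡ mass f (seg y b) + f (y (suc b))
mass-seg-last f y zero    = lemma (f (y 0)) (f (y 1))
  where
  lemma : ∀ p q → p + (q + 0) ≡ p + 0 + q
  lemma = solve-∀
mass-seg-last f y (suc b) =
  trans (cong (f (y 0) +_) (mass-seg-last f (y ∘ suc) b)) (sym (+-assoc (f (y 0)) _ _))

∈-seg⁻ : ∀ (x : ℕ → X) a {p} → p ∈ seg x a → ∃[ i ] i ≤ a × p ≡ x i
∈-seg⁻ x zero    (here refl) = 0 , z≤n , refl
∈-seg⁻ x (suc a) (here refl) = 0 , z≤n , refl
∈-seg⁻ x (suc a) (there p∈) with i , i≤a , refl ← ∈-seg⁻ (x ∘ suc) a p∈ = suc i , s≤s i≤a , refl

∈-seg⁺ : ∀ (x : ℕ → X) a i → i ≤ a → x i ∈ seg x a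
∈-seg⁺ x zero    zero    _         = here refl
∈-seg⁺ x (suc a) zero    _         = here refl
∈-seg⁺ x (suc a) (suc i) (s≤s i≤a) = there (∈-seg⁺ (x ∘ suc) a i i≤a)

All-seg : ∀ {P : X → Set} (x : ℕ → X) a → (∀ i → i ≤ a → P (x i)) → All P (seg x a)
All-seg x zero    h = h 0 z≤n ∷ []
All-seg x (suc a) h = h 0 z≤n ∷ All-seg (x ∘ suc) a (λ i i≤a → h (suc i) (s≤s i≤a))

-- A decomposition only matters through how it splits the sum of an arbitrary weight.
Mass : Set → Set
Mass X = (X → ℕ) → ℕ

grid : ∀ {X Y : Set} → (ℕ → X) → ℕ → (ℕ → Y) → ℕ → Mass (X × Y)
grid x a y b F = mass (λ p → mass (λ q → F (p , q)) (seg y b)) (seg x a)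

-- `P` is the kind of block: single chains, or also squares and cubes that are not yet split. Two
-- ways of summing agree for every weight but need not be equal as functions, hence the constructor
-- `conv`.
data Sum {X : Set} (P : Mass X → Set) : Mass X → Set where
  none : Sum P (λ _ → 0)
  atom : ∀ {M} → P M → Sum P M
  _⊕_  : ∀ {M M′} → Sum P M → Sum P M′ → Sum P (λ F → M F + M′ F)
  conv : ∀ {M M′} → (∀ F → M F ≡ M′ F) → Sum P M → Sum P M′

data One {X : Set} (Q : List X → Set) : Mass X → Set where
  one : ∀ {c} → Q c → One Q (λ F → mass F c)

Chains : {X : Set} → (List X → Set) → Mass X → Set
Chains Q = Sum (One Q)

Sum-map : {P P′ : Mass X → Set} → (∀ {M} → P M → P′ M) → ∀ {M} → Sum P M → Sum P′ M
Sum-map f none       = none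
Sum-map f (atom p)   = atom (f p)
Sum-map f (s ⊕ t)    = Sum-map f s ⊕ Sum-map f t
Sum-map f (conv e s) = conv e (Sum-map f s)

Chains-map : {Q Q′ : List X → Set} → (∀ {c} → Q c → Q′ c) → ∀ {M} → Chains Q M → Chains Q′ M
Chains-map f = Sum-map λ { (one q) → one (f q) }

-- Allows one factor to be decomposed while the other is held as a list: each block is multiplied by
-- the list and may then be split afresh.
Sum-times : (l : List X) {P : Mass Y → Set} {P′ : Mass (X × Y) → Set} →
  (∀ {M} → P M → Sum P′ (λ F → mass (λ x → M (λ y → F (x , y))) l)) →
  ∀ {M} → Sum P M → Sum P′ (λ F → mass (λ x → M (λ y → F (x , y))) l)
Sum-times l f none       = conv (λ F → sym (mass-0 l)) none
Sum-times l f (atom p)   = f p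
Sum-times l f (_⊕_ {M} {M′} s t) =
  conv (λ F → sym (mass-+ (λ x → M (λ y → F (x , y))) (λ x → M′ (λ y → F (x , y))) l))
       (Sum-times l f s ⊕ Sum-times l f t)
Sum-times l f (conv e s) = conv (λ F → mass-cong (λ x → e _) l) (Sum-times l f s)

Sum-timesʳ : (l : List Y) {P : Mass X → Set} {P′ : Mass (X × Y) → Set} →
  (∀ {M} → P M → Sum P′ (λ F → M (λ x → mass (λ y → F (x , y)) l))) →
  ∀ {M} → Sum P M → Sum P′ (λ F → M (λ x → mass (λ y → F (x , y)) l))
Sum-timesʳ l f none       = none
Sum-timesʳ l f (atom p)   = f p
Sum-timesʳ l f (s ⊕ t)    = Sum-timesʳ l f s ⊕ Sum-timesʳ l f t
Sum-timesʳ l f (conv e s) = conv (λ F → e _) (Sum-timesʳ l f s)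

Sum-bind : {P : Mass X → Set} {P′ : Mass Y → Set} (h : X → Y) →
  (∀ {M} → P M → Sum P′ (λ F → M (F ∘ h))) →
  ∀ {M} → Sum P M → Sum P′ (λ F → M (F ∘ h))
Sum-bind h f none       = none
Sum-bind h f (atom p)   = f p
Sum-bind h f (s ⊕ t)    = Sum-bind h f s ⊕ Sum-bind h f t
Sum-bind h f (conv e s) = conv (λ F → e _) (Sum-bind h f s)

Sum-list : {Q : List X → Set} {S : List (List X)} → All Q S → Chains Q (λ F → mass F (concat S))
Sum-list [] = none
Sum-list {S = c ∷ S} (q ∷ qs) = conv (λ F → sym (mass-++ F c (concat S))) (atom (one q) ⊕ Sum-list qs)

Sum-loop : {P : Mass Y → Set} {M : X → Mass Y} (l : List X) →
  (∀ {x} → x ∈ l → Sum P (M x)) → Sum P (λ F → mass (λ x → M x F) l)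
Sum-loop []      f = none
Sum-loop (x ∷ l) f = f (here refl) ⊕ Sum-loop l (f ∘ there)

extract : {Q : List X → Set} → ∀ {M} → Chains Q M →
  Σ (List (List X)) λ S → All Q S × (∀ F → mass F (concat S) ≡ M F)
extract none = [] , [] , λ F → refl
extract (atom (one {c} q)) = c ∷ [] , q ∷ [] , λ F → trans (mass-++ F c []) (+-identityʳ _)
extract (s ⊕ t) with S , g , e ← extract s | T , h , e′ ← extract t =
  S ++ T , All.++⁺ g h ,
  λ F → trans (cong (mass F) (sym (concat-++ S T))) (trans (mass-++ F (concat S) (concat T)) (cong₂ _+_ (e F) (e′ F)))
extract (conv e s) with S , g , e′ ← extract s = S , g , λ F → trans (e′ F) (e F)

-- Ranked orders with a jump relation, and chains with at most one jump

record Space : Set₁ where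
  infix 4 _⊑_ _↝_
  field
    Carrier : Set
    rk      : Carrier → ℕ
    _⊑_     : Carrier → Carrier → Set
    ⊑-refl  : ∀ {p} → p ⊑ p
    ⊑-trans : ∀ {p q r} → p ⊑ q → q ⊑ r → p ⊑ r
    -- in a hypercube: p ≡ q, or p = ∅ and q is full; such pairs are the only ones that two chains
    -- from almost orthogonal decompositions can share
    _↝_     : Carrier → Carrier → Set

  infix 4 _⋖_
  _⋖_ : Carrier → Carrier → Set
  p ⋖ q = p ⊑ q × rk q ≡ suc (rk p)

  data Run : Carrier → List Carrier → Carrier → Set where
    [_]  : ∀ p → Run p (p ∷ []) p
    _∷_  : ∀ {p q r c} → p ⋖ q → Run q c r → Run p (p ∷ c) r

  Run-++ : ∀ {p q p′ q′ c c′} → Run p c q → q ⋖ p′ → Run p′ c′ q′ → Run p (c ++ c′) q′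
  Run-++ [ p ]     s r′ = s ∷ r′
  Run-++ (s′ ∷ r) s r′ = s′ ∷ Run-++ r s r′

  Run-seg : ∀ x a → (∀ i → i < a → x i ⋖ x (suc i)) → Run (x 0) (seg x a) (x a)
  Run-seg x zero    s = [ x 0 ]
  Run-seg x (suc a) s = s 0 (s≤s z≤n) ∷ Run-seg (x ∘ suc) a (λ i i<a → s (suc i) (s≤s i<a))

open Space public using (Carrier)

infixr 6 _⊗_
_⊗_ : Space → Space → Space
S ⊗ T = record
  { Carrier = Carrier S × Carrier T
  ; rk      = λ (p , q) → S.rk p + T.rk q
  ; _⊑_     = λ (p , q) (p′ , q′) → p S.⊑ p′ × q T.⊑ q′
  ; ⊑-refl  = S.⊑-refl , T.⊑-refl
  ; ⊑-trans = λ (a , b) (c , d) → S.⊑-trans a c , T.⊑-trans b d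
  ; _↝_     = λ (p , q) (p′ , q′) → p S.↝ p′ × q T.↝ q′
  }
  where
  module S = Space S
  module T = Space T

module _ (S : Space) where
  open Space S hiding (Carrier)

  -- Symmetry of the chain is expressed by the rank sum `N` of its ends, since a space has no top
  -- rank of its own. The elements `p` and `q` in `jump` range over the whole chain, so a jump that
  -- misses either end is excluded.
  record Tame (N : ℕ) (E : Carrier S → Carrier S → Set) (c : List (Carrier S)) : Set where
    constructor tame
    field
      {first last} : Carrier S
      run      : Run first c last
      balanced : rk first + rk last ≡ N
      jump     : ∀ {p q} → p ∈ c → q ∈ c → p ↝ q → p ≡ q ⊎ ((p ≡ first × q ≡ last) × E first last)

  record Tame₂ (N : ℕ) (E : Carrier S → Carrier S → Set) (c : List (Carrier S)) : Set where
    constructor tame₂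
    field
      isTame : Tame N E c
    open Tame isTame public
    field
      long   : 2 + rk first ≤ rk last

  Steps : (ℕ → Carrier S) → ℕ → Set
  Steps x a = ∀ i → i < a → x i ⋖ x (suc i)

  total : (ℕ → Carrier S) → ℕ → ℕ
  total x a = rk (x 0) + rk (x a)

  -- The same chain by positions instead of elements: dropping the first element is `x ∘ suc`,
  -- dropping the last lowers the bound. Values of `x` beyond `a` are immaterial.
  record Ix (E : Carrier S → Carrier S → Set) (x : ℕ → Carrier S) (a : ℕ) : Set where
    constructor ix
    field
      steps : Steps x a
      jump  : ∀ i j → i ≤ a → j ≤ a → x i ↝ x j → i ≡ j ⊎ ((i ≡ 0 × j ≡ a) × E (x 0) (x a))

  Steps-rk : ∀ {x a} → Steps x a → ∀ i → i ≤ a → rk (x i) ≡ i + rk (x 0)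
  Steps-rk s zero    _   = refl
  Steps-rk s (suc i) i<a = trans (proj₂ (s i i<a)) (cong suc (Steps-rk s i (<⇒≤ i<a)))

  Steps-mono : ∀ {x a} → Steps x a → ∀ i j → i ≤ j → j ≤ a → x i ⊑ x j
  Steps-mono {x} s i j i≤j j≤a = go (≤⇒≤′ i≤j) j≤a
    where
    go : ∀ {j} → i ≤′ j → j ≤ _ → x i ⊑ x j
    go ≤′-refl       _   = ⊑-refl
    go (≤′-step i≤j) j<a = ⊑-trans (go i≤j (<⇒≤ j<a)) (proj₁ (s _ j<a))

  Run-Ix : ∀ {p c q} → Run p c q → ∃[ x ] ∃[ a ] Steps x a × seg x a ≡ c × x 0 ≡ p × x a ≡ q
  Run-Ix [ p ] = (λ _ → p) , 0 , (λ _ ()) , refl , refl , refl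
  Run-Ix (_∷_ {p} st r) with x , a , s , refl , refl , refl ← Run-Ix r =
    x′ , suc a , s′ , refl , refl , refl
    where
    x′ : ℕ → Carrier S
    x′ zero    = p
    x′ (suc i) = x i
    s′ : Steps x′ (suc a)
    s′ zero    _         = st
    s′ (suc i) (s≤s i<a) = s i i<a

  Tame→Ix : ∀ {N E c} (g : Tame N E c) →
    ∃[ x ] ∃[ a ] Ix E x a × total x a ≡ N × seg x a ≡ c × x 0 ≡ Tame.first g × x a ≡ Tame.last g
  Tame→Ix (tame run bal jump) with x , a , s , refl , refl , refl ← Run-Ix run =
    x , a , ix s jump′ , bal , refl , refl , refl
    where
    inj : ∀ {i j} → i ≤ a → j ≤ a → x i ≡ x j → i ≡ j
    inj {i} {j} i≤a j≤a e = +-cancelʳ-≡ (rk (x 0)) i j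
      (trans (sym (Steps-rk s i i≤a)) (trans (cong rk e) (Steps-rk s j j≤a)))
    jump′ : ∀ i j → i ≤ a → j ≤ a → x i ↝ x j → i ≡ j ⊎ ((i ≡ 0 × j ≡ a) × _)
    jump′ i j i≤a j≤a J with jump (∈-seg⁺ x a i i≤a) (∈-seg⁺ x a j j≤a) J
    ... | inj₁ e = inj₁ (inj i≤a j≤a e)
    ... | inj₂ ((e , e′) , E) = inj₂ ((inj i≤a z≤n e , inj j≤a ≤-refl e′) , E)

  Tame₂→Ix : ∀ {N E c} (g : Tame₂ N E c) →
    ∃[ x ] ∃[ a ] Ix E x (2 + a) × total x (2 + a) ≡ N × seg x (2 + a) ≡ c ×
      x 0 ≡ Tame₂.first g × x (2 + a) ≡ Tame₂.last g
  Tame₂→Ix (tame₂ g long) with Tame→Ix g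
  ... | x , a , X , t , refl , refl , refl with +-cancelʳ-≤ (rk (x 0)) 2 a
          (≤-trans long (≤-reflexive (Steps-rk (Ix.steps X) a ≤-refl)))
  ... | s≤s (s≤s {n = a′} _) = x , a′ , X , t , refl , refl , refl

  None : Carrier S → Carrier S → Set
  None _ _ = ⊥

  total-tail : ∀ {x a} → Steps x (suc a) → total (x ∘ suc) a ≡ suc (total x (suc a))
  total-tail {x} {a} s = cong (_+ rk (x (suc a))) (proj₂ (s 0 (s≤s z≤n)))

  total-init : ∀ {x a} → Steps x (suc a) → total x (suc a) ≡ suc (total x a)
  total-init {x} {a} s = trans (cong (rk (x 0) +_) (proj₂ (s a ≤-refl))) (+-suc _ _)

  Steps-tail : ∀ {x a} → Steps x (suc a) → Steps (x ∘ suc) a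
  Steps-tail s i i<a = s (suc i) (s≤s i<a)

  Steps-init : ∀ {x a} → Steps x (suc a) → Steps x a
  Steps-init s i i<a = s i (m<n⇒m<1+n i<a)

  Ix-tail : ∀ {E x a} → Ix E x (suc a) → Ix None (x ∘ suc) a
  Ix-tail {x = x} {a} (ix s j) = ix (Steps-tail s) j′
    where
    j′ : ∀ i j → i ≤ a → j ≤ a → x (suc i) ↝ x (suc j) → i ≡ j ⊎ ((i ≡ 0 × j ≡ a) × ⊥)
    j′ i k i≤a k≤a J with j (suc i) (suc k) (s≤s i≤a) (s≤s k≤a) J
    ... | inj₁ e = inj₁ (suc-injective e)
    ... | inj₂ ((() , _) , _)

  Ix-init : ∀ {E x a} → Ix E x (suc a) → Ix None x a
  Ix-init {x = x} {a} (ix s j) = ix (Steps-init s) j′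
    where
    j′ : ∀ i j → i ≤ a → j ≤ a → x i ↝ x j → i ≡ j ⊎ ((i ≡ 0 × j ≡ a) × ⊥)
    j′ i k i≤a k≤a J with j i k (m≤n⇒m≤1+n i≤a) (m≤n⇒m≤1+n k≤a) J
    ... | inj₁ e = inj₁ e
    ... | inj₂ ((_ , refl) , _) = ⊥-elim (1+n≰n k≤a)

  Ix-free : ∀ {x a} → Ix None x a → ∀ {i j} → i ≤ a → j ≤ a → x i ↝ x j → i ≡ j
  Ix-free X {i} {j} i≤a j≤a J with Ix.jump X i j i≤a j≤a J
  ... | inj₁ e = e
  ... | inj₂ (_ , ())

-- Products of two chains

_⊠_ : (X → X → Set) → (Y → Y → Set) → X × Y → X × Y → Set
(E ⊠ E′) (p , q) (p′ , q′) = E p p′ × E′ q q′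

-- The first row followed by the rest of the last column; peeling these off repeatedly is the
-- classical symmetric chain decomposition of a product of two chains. The case of one row is
-- separate because `seg` is never empty.
hook : (ℕ → X) → ℕ → (ℕ → Y) → ℕ → List (X × Y)
hook x zero    y b = seg (λ j → x 0 , y j) b
hook x (suc a) y b = seg (λ j → x 0 , y j) b ++ seg (λ i → x (suc i) , y b) a

module _ (x : ℕ → X) (y : ℕ → Y) where

  All-hook : ∀ {Q : X × Y → Set} a b → (∀ j → j ≤ b → Q (x 0 , y j)) →
    (∀ i → i ≤ a → Q (x i , y b)) → All Q (hook x a y b)
  All-hook zero    b h k = All-seg _ b h
  All-hook (suc a) b h k = All.++⁺ (All-seg _ b h) (All-seg _ a λ i i≤a → k (suc i) (s≤s i≤a))

  mass-hook-row : ∀ F b → mass F (hook x 0 y b) ≡ grid x 0 y b F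
  mass-hook-row F b = trans (mass-seg F (x 0 ,_) y b) (sym (+-identityʳ _))

  mass-hook-suc : ∀ F a b → mass F (hook x (suc a) y b) ≡
    mass (λ q → F (x 0 , q)) (seg y b) + mass (λ p → F (p , y b)) (seg (x ∘ suc) a)
  mass-hook-suc F a b = trans (mass-++ F (seg (λ j → x 0 , y j) b) _)
    (cong₂ _+_ (mass-seg F (x 0 ,_) y b) (mass-seg F (_, y b) (x ∘ suc) a))

  mass-hook-col : ∀ F a → mass F (hook x (suc a) y 0) ≡ grid x (suc a) y 0 F
  mass-hook-col F a = trans (mass-hook-suc F a 0)
    (cong (mass (λ q → F (x 0 , q)) (seg y 0) +_)
      (mass-cong (λ p → sym (+-identityʳ (F (p , y 0)))) (seg (x ∘ suc) a)))

  mass-hook : ∀ F a b →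
    mass F (hook x (suc a) y (suc b)) + grid (x ∘ suc) a y b F ≡ grid x (suc a) y (suc b) F
  mass-hook F a b = begin
    mass F (hook x (suc a) y (suc b)) + grid (x ∘ suc) a y b F
      ≡⟨ cong (_+ grid (x ∘ suc) a y b F) (mass-hook-suc F a (suc b)) ⟩
    r + s + g
      ≡⟨ trans (+-assoc r s g) (cong (r +_) (+-comm s g)) ⟩
    r + (g + s)
      ≡⟨ cong (r +_) (mass-+ (λ p → mass (λ q → F (p , q)) (seg y b)) (λ p → F (p , y (suc b))) (seg (x ∘ suc) a)) ⟨
    r + mass (λ p → mass (λ q → F (p , q)) (seg y b) + F (p , y (suc b))) (seg (x ∘ suc) a)
      ≡⟨ cong (r +_) (mass-cong (λ p → sym (mass-seg-last (λ q → F (p , q)) y b)) (seg (x ∘ suc) a)) ⟩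
    grid x (suc a) y (suc b) F ∎
    where
    open ≡-Reasoning
    r = mass (λ q → F (x 0 , q)) (seg y (suc b))
    s = mass (λ p → F (p , y (suc b))) (seg (x ∘ suc) a)
    g = grid (x ∘ suc) a y b F

-- Z₁ and Z₂ arise from the first two hooks by exchanging the first and last elements.
Z₁ Z₂ : (ℕ → X) → ℕ → (ℕ → Y) → ℕ → List (X × Y)
Z₁ x a y b = (x 0 , y 0) ∷ (hook (x ∘ suc) (suc a) y (suc b) ++ ((x (2 + a) , y (2 + b)) ∷ []))
Z₂ x a y b = hook x (suc a) (y ∘ suc) (suc b)

mass-Z : ∀ (x : ℕ → X) (y : ℕ → Y) F a b →
  mass F (Z₁ x a y b) + (mass F (Z₂ x a y b) + grid (x ∘ suc ∘ suc) a y b F)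
    ≡ grid x (2 + a) y (2 + b) F
mass-Z x y F a b = begin
  (z + mass F (h ++ ((x (2 + a) , y (2 + b)) ∷ []))) + (mass F (Z₂ x a y b) + g)
    ≡⟨ cong₂ (λ u v → (z + u) + (v + g)) (mass-++ F h _) (mass-hook-suc x (y ∘ suc) F a (suc b)) ⟩
  (z + (mass F h + (w + 0))) + (r + s + g)
    ≡⟨ lemma z (mass F h) w r s g ⟩
  (z + r) + (s + w) + (mass F h + g)
    ≡⟨ cong₂ (λ u v → (z + r) + u + v) (sym (mass-seg-last (λ p → F (p , y (2 + b))) (x ∘ suc) a))
         (mass-hook (x ∘ suc) y F a b) ⟩
  (z + r) + mass (λ p → F (p , y (2 + b))) (seg (x ∘ suc) (suc a)) + grid (x ∘ suc) (suc a) y (suc b) F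
    ≡⟨ cong (_+ grid (x ∘ suc) (suc a) y (suc b) F) (mass-hook-suc x y F (suc a) (2 + b)) ⟨
  mass F (hook x (2 + a) y (2 + b)) + grid (x ∘ suc) (suc a) y (suc b) F
    ≡⟨ mass-hook x y F (suc a) (suc b) ⟩
  grid x (2 + a) y (2 + b) F ∎
  where
  open ≡-Reasoning
  z = F (x 0 , y 0)
  w = F (x (2 + a) , y (2 + b))
  h = hook (x ∘ suc) (suc a) y (suc b)
  g = grid (x ∘ suc ∘ suc) a y b F
  r = mass (λ q → F (x 0 , q)) (seg (y ∘ suc) (suc b))
  s = mass (λ p → F (p , y (2 + b))) (seg (x ∘ suc) a)
  lemma : ∀ z h w r s g → (z + (h + (w + 0))) + (r + s + g) ≡ (z + r) + (s + w) + (h + g)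
  lemma = solve-∀

Tame-relax : ∀ {S N E E′ c} → (∀ {p q} → E p q → E′ p q) → Tame S N E c → Tame S N E′ c
Tame-relax r (tame run bal j) = tame run bal λ p∈ q∈ J → relax (j p∈ q∈ J)
  where
  relax : ∀ {A B : Set} → A ⊎ (B × _) → A ⊎ (B × _)
  relax (inj₁ a)       = inj₁ a
  relax (inj₂ (b , e)) = inj₂ (b , r e)

Tame₂-relax : ∀ {S N E E′ c} → (∀ {p q} → E p q → E′ p q) → Tame₂ S N E c → Tame₂ S N E′ c
Tame₂-relax r (tame₂ t long) = tame₂ (Tame-relax r t) long

record SymAll (S : Space) (N : ℕ) (Q : Carrier S → Set) (c : List (Carrier S)) : Set where
  constructor symAll
  open Space S hiding (Carrier)
  field
    {first last} : Carrier S
    run      : Run first c last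
    balanced : rk first + rk last ≡ N
    all      : All Q c

Anywhere : ℕ → ℕ → Set
Anywhere _ _ = ⊤

module _ {S T : Space} where
  private
    module S = Space S
    module T = Space T
  open Space (S ⊗ T) hiding (Carrier)

  ⋖ˡ : ∀ {p p′ q} → p S.⋖ p′ → (p , q) ⋖ (p′ , q)
  ⋖ˡ {q = q} (l , e) = (l , T.⊑-refl) , cong (_+ T.rk q) e

  ⋖ʳ : ∀ {p q q′} → q T.⋖ q′ → (p , q) ⋖ (p , q′)
  ⋖ʳ {p = p} (l , e) = (S.⊑-refl , l) , trans (cong (S.rk p +_) e) (+-suc _ _)

  Run-hook : ∀ {x y} a b → Steps S x a → Steps T y b → Run (x 0 , y 0) (hook x a y b) (x a , y b)
  Run-hook zero    b s t = Run-seg _ b λ j j<b → ⋖ʳ (t j j<b)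
  Run-hook (suc a) b s t = Run-++ (Run-seg _ b λ j j<b → ⋖ʳ (t j j<b)) (⋖ˡ (s 0 (s≤s z≤n)))
    (Run-seg _ a λ i i<a → ⋖ˡ (s (suc i) (s≤s i<a)))

  total-⊗ : ∀ (x : ℕ → Carrier S) (y : ℕ → Carrier T) a b {N} → total S x a + total T y b ≡ N →
    rk (x 0 , y 0) + rk (x a , y b) ≡ N
  total-⊗ x y a b e = trans (interchange (S.rk (x 0)) (T.rk (y 0)) (S.rk (x a)) (T.rk (y b))) e

  -- Dropping the bottom of one chain raises its rank sum by one, dropping the top of the other
  -- lowers it by one, so all hooks are centred at the same level.
  total-hook : ∀ {x y a b N} → Steps S x (suc a) → Steps T y (suc b) →
    total S x (suc a) + total T y (suc b) ≡ N → total S (x ∘ suc) a + total T y b ≡ N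
  total-hook {x} {y} {a} {b} s t e = trans
    (trans (cong (_+ total T y b) (total-tail S s)) (sym (+-suc _ _)))
    (trans (cong (total S x (suc a) +_) (sym (total-init T t))) e)

  SymAll-hook : ∀ {x y} a b {N Q} → Steps S x a → Steps T y b → total S x a + total T y b ≡ N →
    (∀ i j → i ≤ a → j ≤ b → Q (x i , y j)) → SymAll (S ⊗ T) N Q (hook x a y b)
  SymAll-hook {x} {y} a b s t e q = symAll (Run-hook a b s t) (total-⊗ x y a b e)
    (All-hook x y a b (λ j → q 0 j z≤n) (λ i i≤a → q i b i≤a ≤-refl))

  hooks : ∀ {x y} a b {N Q} → Steps S x a → Steps T y b → total S x a + total T y b ≡ N →
    (∀ i j → i ≤ a → j ≤ b → Q (x i , y j)) → Chains (SymAll (S ⊗ T) N Q) (grid x a y b)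
  hooks {x} {y} zero b s t e q =
    conv (λ F → mass-hook-row x y F b) (atom (one (SymAll-hook 0 b s t e q)))
  hooks {x} {y} (suc a) zero s t e q =
    conv (λ F → mass-hook-col x y F a) (atom (one (SymAll-hook (suc a) 0 s t e q)))
  hooks {x} {y} (suc a) (suc b) s t e q = conv (λ F → mass-hook x y F a b)
    (atom (one (SymAll-hook (suc a) (suc b) s t e q)) ⊕
     hooks a b (Steps-tail S s) (Steps-init T t) (total-hook s t e)
       (λ i j i≤a j≤b → q (suc i) j (s≤s i≤a) (m≤n⇒m≤1+n j≤b)))

  Cell : (ℕ → Carrier S) → ℕ → (ℕ → Carrier T) → ℕ → (ℕ → ℕ → Set) → Carrier S × Carrier T → Set
  Cell x a y b I p = ∃[ i ] ∃[ j ] p ≡ (x i , y j) × i ≤ a × j ≤ b × I i j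

  -- The hypotheses on I forbid a chain to contain both ends of a row or of a column of the grid.
  jump-cells : ∀ {x a y b E E′ I} → Ix S E x a → Ix T E′ y b →
    (∀ j → I 0 j → I a j → a ≡ 0) → (∀ i → I i 0 → I i b → b ≡ 0) →
    ∀ {p q} → Cell x a y b I p → Cell x a y b I q → p ↝ q →
    p ≡ q ⊎ ((p ≡ (x 0 , y 0) × q ≡ (x a , y b)) × (I 0 0 × I a b) × E (x 0) (x a) × E′ (y 0) (y b))
  jump-cells X Y r c (i , j , refl , i≤a , j≤b , u) (k , l , refl , k≤a , l≤b , v) (J , J′)
    with Ix.jump X i k i≤a k≤a J | Ix.jump Y j l j≤b l≤b J′
  ... | inj₁ refl                | inj₁ refl                 = inj₁ refl
  ... | inj₁ refl                | inj₂ ((refl , refl) , _)  with refl ← c i u v = inj₁ refl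
  ... | inj₂ ((refl , refl) , _) | inj₁ refl                 with refl ← r j u v = inj₁ refl
  ... | inj₂ ((refl , refl) , e) | inj₂ ((refl , refl) , e′) = inj₂ ((refl , refl) , (u , v) , e , e′)

  Tame-cells : ∀ {x a y b E E′ I N c} → Ix S E x a → Ix T E′ y b →
    (∀ j → I 0 j → I a j → a ≡ 0) → (∀ i → I i 0 → I i b → b ≡ 0) →
    (s : SymAll (S ⊗ T) N (Cell x a y b I) c) →
    (I 0 0 → I a b → SymAll.first s ≡ (x 0 , y 0) × SymAll.last s ≡ (x a , y b)) →
    Tame (S ⊗ T) N (E ⊠ E′) c
  Tame-cells X Y r k (symAll run bal all) corner = tame run bal jump
    where
    jump : ∀ {p q} → p ∈ _ → q ∈ _ → p ↝ q → _
    jump p∈ q∈ J with jump-cells X Y r k (All.lookup all p∈) (All.lookup all q∈) J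
    ... | inj₁ e = inj₁ e
    ... | inj₂ ((refl , refl) , (u , v) , e) with refl , refl ← corner u v = inj₂ ((refl , refl) , e)

  Tame-free : ∀ {x a y b N c} → Ix S (None S) x a → Ix T (None T) y b →
    SymAll (S ⊗ T) N (Cell x a y b Anywhere) c → Tame (S ⊗ T) N (None (S ⊗ T)) c
  Tame-free {x} {a} {y} {b} X Y (symAll run bal all) =
    tame run bal λ p∈ q∈ J → inj₁ (free (All.lookup all p∈) (All.lookup all q∈) J)
    where
    free : ∀ {p q} → Cell x a y b Anywhere p → Cell x a y b Anywhere q → p ↝ q → p ≡ q
    free (i , j , refl , i≤a , j≤b , _) (k , l , refl , k≤a , l≤b , _) (J , J′) =
      cong₂ _,_ (cong x (Ix-free S X i≤a k≤a J)) (cong y (Ix-free T Y j≤b l≤b J′))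

  cell : ∀ {x a y b} i j → i ≤ a → j ≤ b → Cell x a y b Anywhere (x i , y j)
  cell i j i≤a j≤b = i , j , refl , i≤a , j≤b , tt

  hook-long : ∀ {x y} a b → Steps S x a → Steps T y b → 2 ≤ a + b →
    2 + rk (x 0 , y 0) ≤ rk (x a , y b)
  hook-long {x} {y} a b s t 2≤ = ≤-trans (+-monoˡ-≤ _ 2≤) (≤-reflexive (sym (trans
    (cong₂ _+_ (Steps-rk S s a ≤-refl) (Steps-rk T t b ≤-refl)) (interchange a (S.rk (x 0)) b (T.rk (y 0))))))

  hook-free : ∀ {x y} a b {N} → Ix S (None S) x a → Ix T (None T) y b →
    total S x a + total T y b ≡ N → 2 ≤ a + b → Tame₂ (S ⊗ T) N (None (S ⊗ T)) (hook x a y b)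
  hook-free a b X Y e 2≤ = tame₂
    (Tame-free X Y (SymAll-hook a b (Ix.steps X) (Ix.steps Y) e cell))
    (hook-long a b (Ix.steps X) (Ix.steps Y) 2≤)

  hooks-free : ∀ {x y} a b {N} → Ix S (None S) x a → Ix T (None T) y b →
    total S x a + total T y b ≡ N → Chains (Tame (S ⊗ T) N (None (S ⊗ T))) (grid x a y b)
  hooks-free a b X Y e =
    Chains-map (Tame-free X Y) (hooks a b (Ix.steps X) (Ix.steps Y) e cell)

  -- A one-point factor never jumps from end to end in the sense of `Ix`, so its share of the
  -- product relation has to be supplied from outside.
  Tame-row : ∀ {x y a b E E′ N} → Ix S E x a → Ix T E′ y b → a ≡ 0 → E (x 0) (x a) →
    total S x a + total T y b ≡ N → Tame (S ⊗ T) N (E ⊠ E′) (hook x 0 y b)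
  Tame-row {x} {y} {b = b} X Y refl ends e = tame (Run-hook 0 b (Ix.steps X) (Ix.steps Y)) (total-⊗ x y 0 b e) jump
    where
    jump : ∀ {p q} → p ∈ _ → q ∈ _ → p ↝ q → _
    jump p∈ q∈ (_ , J)
      with i , i≤b , refl ← ∈-seg⁻ (λ j → x 0 , y j) b p∈ | j , j≤b , refl ← ∈-seg⁻ (λ j → x 0 , y j) b q∈
      with Ix.jump Y i j i≤b j≤b J
    ... | inj₁ refl = inj₁ refl
    ... | inj₂ ((refl , refl) , e) = inj₂ ((refl , refl) , ends , e)

  Tame-column : ∀ {x y a b E E′ N} → Ix S E x (suc a) → Ix T E′ y b → b ≡ 0 → E′ (y 0) (y b) →
    total S x (suc a) + total T y b ≡ N → Tame (S ⊗ T) N (E ⊠ E′) (hook x (suc a) y 0)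
  Tame-column {x} {y} {a} X Y refl ends e =
    tame (Run-hook (suc a) 0 (Ix.steps X) (Ix.steps Y)) (total-⊗ x y (suc a) 0 e)
      λ p∈ q∈ J → jump (All.lookup all p∈) (All.lookup all q∈) J
    where
    all : All (Cell x (suc a) y 0 Anywhere) (hook x (suc a) y 0)
    all = All-hook x y (suc a) 0 (λ j → cell 0 j z≤n) (λ i i≤a → cell i 0 i≤a z≤n)
    jump : ∀ {p q} → Cell x (suc a) y 0 Anywhere p → Cell x (suc a) y 0 Anywhere q → p ↝ q → _
    jump (i , .0 , refl , i≤a , z≤n , _) (j , .0 , refl , j≤a , z≤n , _) (J , _) with Ix.jump X i j i≤a j≤a J
    ... | inj₁ refl = inj₁ refl
    ... | inj₂ ((refl , refl) , e) = inj₂ ((refl , refl) , e , ends)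

  module _ {x y a b E E′ N} (X : Ix S E x (2 + a)) (Y : Ix T E′ y (2 + b))
           (e : total S x (2 + a) + total T y (2 + b) ≡ N) where
    private
      s = Ix.steps X
      t = Ix.steps Y

      e′ : total S (x ∘ suc) (1 + a) + total T y (1 + b) ≡ N
      e′ = total-hook s t e

      data I : ℕ → ℕ → Set where
        start  : I 0 0
        end    : I (2 + a) (2 + b)
        first  : ∀ {j} → j ≤ 1 + b → I 1 j
        last   : ∀ {i} → I (suc i) (1 + b)

      run₁ : Run (x 0 , y 0) (Z₁ x a y b) (x (2 + a) , y (2 + b))
      run₁ = ⋖ˡ (s 0 (s≤s z≤n)) ∷ Run-++ (Run-hook (1 + a) (1 + b) (Steps-tail S s) (Steps-init T t))
        (⋖ʳ (t (1 + b) ≤-refl)) [ _ ]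

      all₁ : All (Cell x (2 + a) y (2 + b) I) (Z₁ x a y b)
      all₁ = (0 , 0 , refl , z≤n , z≤n , start) ∷ All.++⁺
        (All-hook (x ∘ suc) y (1 + a) (1 + b)
          (λ j j≤b → 1 , j , refl , s≤s z≤n , m≤n⇒m≤1+n j≤b , first j≤b)
          (λ i i≤a → suc i , 1 + b , refl , s≤s i≤a , n≤1+n _ , last))
        ((2 + a , 2 + b , refl , ≤-refl , ≤-refl , end) ∷ [])

      rows : ∀ j → I 0 j → I (2 + a) j → 2 + a ≡ 0
      rows .0 start ()

      cols : ∀ i → I i 0 → I i (2 + b) → 2 + b ≡ 0
      cols _ (first _) (first p) = ⊥-elim (1+n≰n p)

    -- The first row and the last column are met only in the two corners at the ends of the chain.
    -- Hence no jump can keep a coordinate, and the one from corner to corner remains.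
    Tame-Z₁ : Tame₂ (S ⊗ T) N (E ⊠ E′) (Z₁ x a y b)
    Tame-Z₁ = tame₂
      (Tame-cells X Y rows cols (symAll run₁ (total-⊗ x y (2 + a) (2 + b) e) all₁) λ _ _ → refl , refl)
      (hook-long (2 + a) (2 + b) s t (s≤s (s≤s z≤n)))

    -- This hook lacks the last element of `x` and the first element of `y`, so neither factor has a
    -- jump left. The same holds for the remaining grid, which lacks the first two rows and the last
    -- two columns.
    Tame-Z₂ : Tame₂ (S ⊗ T) N (None (S ⊗ T)) (Z₂ x a y b)
    Tame-Z₂ = hook-free (1 + a) (1 + b) (Ix-init S X) (Ix-tail T Y) e″ (s≤s (m≤n⇒m≤o+n a (s≤s z≤n)))
      where
      e″ : total S x (1 + a) + total T (y ∘ suc) (1 + b) ≡ N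
      e″ = trans (trans (cong (total S x (1 + a) +_) (total-tail T t)) (+-suc _ _))
        (trans (cong (_+ total T y (2 + b)) (sym (total-init S s))) e)

    rest-Ixˡ : Ix S (None S) (x ∘ suc ∘ suc) a
    rest-Ixˡ = Ix-tail S (Ix-tail S X)

    rest-Ixʳ : Ix T (None T) y b
    rest-Ixʳ = Ix-init T (Ix-init T Y)

    rest-total : total S (x ∘ suc ∘ suc) a + total T y b ≡ N
    rest-total = total-hook (Steps-tail S s) (Steps-init T t) e′

  swapped : ∀ {x y a b E E′ N} → Ix S E x (2 + a) → Ix T E′ y (2 + b) →
    total S x (2 + a) + total T y (2 + b) ≡ N → Chains (Tame (S ⊗ T) N (E ⊠ E′)) (grid x (2 + a) y (2 + b))
  swapped {x} {y} {a} {b} X Y e = conv (λ F → mass-Z x y F a b)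
    (atom (one (Tame₂.isTame (Tame-Z₁ X Y e))) ⊕ (atom (one (Tame-relax ⊥-elim (Tame₂.isTame (Tame-Z₂ X Y e)))) ⊕
      Chains-map (Tame-relax ⊥-elim) (hooks-free a b (rest-Ixˡ X Y e) (rest-Ixʳ X Y e) (rest-total X Y e))))

  -- Exactly three chains arise, the third being the column that `Z₁` and `Z₂` leave, with two
  -- elements fewer than `x`. Five elements in `x` are what it takes to keep three in that column.
  times₃ : ∀ {x y a E E′ N} → Ix S E x (4 + a) → Ix T E′ y 2 →
    total S x (4 + a) + total T y 2 ≡ N → Chains (Tame₂ (S ⊗ T) N (E ⊠ E′)) (grid x (4 + a) y 2)
  times₃ {x} {y} {a} X Y e = conv (λ F → mass-Z x y F (2 + a) 0)
    (atom (one (Tame-Z₁ X Y e)) ⊕ (atom (one (Tame₂-relax ⊥-elim (Tame-Z₂ X Y e))) ⊕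
      conv (λ F → mass-hook-col (x ∘ suc ∘ suc) y F (1 + a)) (atom (one (Tame₂-relax ⊥-elim
        (hook-free {x = x ∘ suc ∘ suc} (2 + a) 0 (rest-Ixˡ X Y e) (rest-Ixʳ X Y e) (rest-total X Y e) (s≤s (s≤s z≤n))))))))

-- Maps between spaces and pieces of products

-- Jumps need only be reflected: an image chain may have fewer jumps but no new ones. The premise
-- `h p T.↝ h q` in `ends` is what produces `E` in `Ix→Morph`, where `E` is known only for genuine
-- jumps.
record Morph (S T : Space) (N N′ : ℕ) (E : Carrier S → Carrier S → Set)
             (E′ : Carrier T → Carrier T → Set) (h : Carrier S → Carrier T) : Set where
  private
    module S = Space S
    module T = Space T
  field
    shift   : ℕ
    rank    : ∀ p → T.rk (h p) ≡ shift + S.rk p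
    mono    : ∀ {p q} → p S.⊑ q → h p T.⊑ h q
    reflect : ∀ {p q} → h p T.↝ h q → p S.↝ q
    total′  : shift + shift + N ≡ N′
    ends    : ∀ {p q} → E p q → h p T.↝ h q → E′ (h p) (h q)

Run-image : ∀ {S T : Space} {h : Carrier S → Carrier T} r → (∀ p → Space.rk T (h p) ≡ r + Space.rk S p) →
  (∀ {p q} → Space._⊑_ S p q → Space._⊑_ T (h p) (h q)) →
  ∀ {p c q} → Space.Run S p c q → Space.Run T (h p) (map h c) (h q)
Run-image r rk mono Space.[ p ]           = Space.[ _ ]
Run-image r rk mono ((l , e) Space.∷ run) =
  (mono l , trans (rk _) (trans (cong (r +_) e) (trans (+-suc r _) (cong suc (sym (rk _)))))) Space.∷
  Run-image r rk mono run

module _ {S T : Space} {N N′ E E′} {h : Carrier S → Carrier T} (m : Morph S T N N′ E E′ h) where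
  private
    module S = Space S
    module T = Space T
  open Morph m

  Tame-map : ∀ {c} → Tame S N E c → Tame T N′ E′ (map h c)
  Tame-map {c} (tame {f} {l} run bal jump) = tame (Run-image {S} {T} shift rank mono run)
    (trans (cong₂ _+_ (rank f) (rank l)) (trans (interchange shift (S.rk f) shift (S.rk l))
      (trans (cong (shift + shift +_) bal) total′))) jump′
    where
    jump′ : ∀ {p q} → p ∈ map h c → q ∈ map h c → p T.↝ q → _
    jump′ p∈ q∈ J with p′ , p′∈ , refl ← ∈-map⁻ h p∈ | q′ , q′∈ , refl ← ∈-map⁻ h q∈
      with jump p′∈ q′∈ (reflect J)
    ... | inj₁ refl = inj₁ refl
    ... | inj₂ ((refl , refl) , e) = inj₂ ((refl , refl) , ends e J)

  Tame₂-map : ∀ {c} → Tame₂ S N E c → Tame₂ T N′ E′ (map h c)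
  Tame₂-map (tame₂ g@(tame {f} {l} run bal jump) long) = tame₂ (Tame-map g) (begin
    2 + T.rk (h f)         ≡⟨ cong (2 +_) (rank f) ⟩
    2 + (shift + S.rk f)
      ≡⟨ trans (sym (+-assoc 2 shift _)) (trans (cong (_+ S.rk f) (+-comm 2 shift)) (+-assoc shift 2 _)) ⟩
    shift + (2 + S.rk f)   ≤⟨ +-monoʳ-≤ shift long ⟩
    shift + S.rk l         ≡⟨ rank l ⟨
    T.rk (h l)             ∎)
    where open ≤-Reasoning

  One-map : ∀ {Q : List (Carrier S) → Set} {Q′ : List (Carrier T) → Set} →
    (∀ {c} → Q c → Q′ (map h c)) → ∀ {M} → Chains Q M → Chains Q′ (λ F → M (F ∘ h))
  One-map k = Sum-bind h λ { (one {c} q) → conv (λ F → mass-map F h c) (atom (one (k q))) }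

  Chains-Tame-map : ∀ {M} → Chains (Tame S N E) M → Chains (Tame T N′ E′) (λ F → M (F ∘ h))
  Chains-Tame-map = One-map Tame-map

Morph-id : ∀ {S N E} → Morph S S N N E E id
Morph-id = record { shift = 0 ; rank = λ _ → refl ; mono = id ; reflect = id ; total′ = refl ; ends = λ e _ → e }

Morph-relax : ∀ {S N E E′} → (∀ {p q} → E p q → E′ p q) → Morph S S N N E E′ id
Morph-relax r = record
  { shift = 0 ; rank = λ _ → refl ; mono = id ; reflect = id ; total′ = refl ; ends = λ e _ → r e }

Morph-∘ : ∀ {S T U N N′ N″ E E′ E″ h k} → Morph T U N′ N″ E′ E″ k → Morph S T N N′ E E′ h →
  Morph S U N N″ E E″ (k ∘ h)
Morph-∘ {N = N} {h = h} k m = record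
  { shift   = K.shift + M.shift
  ; rank    = λ p → trans (K.rank (h p)) (trans (cong (K.shift +_) (M.rank p)) (sym (+-assoc K.shift _ _)))
  ; mono    = K.mono ∘ M.mono
  ; reflect = M.reflect ∘ K.reflect
  ; total′  = trans (rearrange K.shift M.shift N) (trans (cong (K.shift + K.shift +_) M.total′) K.total′)
  ; ends    = λ e J → K.ends (M.ends e (K.reflect J)) J
  }
  where
  module K = Morph k
  module M = Morph m
  rearrange : ∀ a b n → a + b + (a + b) + n ≡ a + a + (b + b + n)
  rearrange = solve-∀

_⊗ᵐ_ : ∀ {S S′ T T′ N N′ M M′ E E′ D D′ h k} →
  Morph S T N N′ E E′ h → Morph S′ T′ M M′ D D′ k →
  Morph (S ⊗ S′) (T ⊗ T′) (N + M) (N′ + M′) (E ⊠ D) (E′ ⊠ D′) (λ (p , q) → h p , k q)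
_⊗ᵐ_ {S} {S′} {N = N} {M = M} {h = h} {k} m n = record
  { shift   = A.shift + B.shift
  ; rank    = λ (p , q) → trans (cong₂ _+_ (A.rank p) (B.rank q)) (interchange A.shift (Space.rk S p) B.shift (Space.rk S′ q))
  ; mono    = λ (a , b) → A.mono a , B.mono b
  ; reflect = λ (a , b) → A.reflect a , B.reflect b
  ; total′  = trans (rearrange A.shift B.shift N M) (cong₂ _+_ A.total′ B.total′)
  ; ends    = λ (e , d) (J , J′) → A.ends e J , B.ends d J′
  }
  where
  module A = Morph m
  module B = Morph n
  rearrange : ∀ a b n m → a + b + (a + b) + (n + m) ≡ a + a + n + (b + b + m)
  rearrange = solve-∀

Morph-assoc : ∀ {S T U N M L} {E : Carrier S → _} {D : Carrier T → _} {C : Carrier U → _} →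
  Morph ((S ⊗ T) ⊗ U) (S ⊗ (T ⊗ U)) (N + M + L) (N + (M + L)) ((E ⊠ D) ⊠ C) (E ⊠ (D ⊠ C))
    (λ ((p , q) , r) → p , q , r)
Morph-assoc {S} {T} {U} {N} {M} {L} = record
  { shift   = 0
  ; rank    = λ ((p , q) , r) → sym (+-assoc (Space.rk S p) (Space.rk T q) (Space.rk U r))
  ; mono    = λ ((a , b) , c) → a , b , c
  ; reflect = λ (a , b , c) → (a , b) , c
  ; total′  = +-assoc N M L
  ; ends    = λ ((e , d) , c) _ → e , d , c
  }

Index : ℕ → Space
Index n = record
  { Carrier = Fin (suc n)
  ; rk      = toℕ
  ; _⊑_     = λ i j → toℕ i ≤ toℕ j
  ; ⊑-refl  = ≤-refl
  ; ⊑-trans = ≤-trans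
  ; _↝_     = λ i j → i ≡ j ⊎ (toℕ i ≡ 0 × toℕ j ≡ n)
  }

Extremes : ∀ n → Fin (suc n) → Fin (suc n) → Set
Extremes n i j = toℕ i ≡ 0 × toℕ j ≡ n

-- Makes every chain with at least two elements an image of a chain of indices, so that
-- decompositions of small index cuboids transfer to all cuboids of that size. With one element, the
-- first and last positions coincide and a trivial jump would not yield `E`.
Ix→Morph : ∀ {S E x a N} → Ix S E x (suc a) → total S x (suc a) ≡ N →
  Morph (Index (suc a)) S (suc a) N (Extremes (suc a)) E (x ∘ toℕ)
Ix→Morph {S} {E} {x} {a} X e = record
  { shift   = rk (x 0)
  ; rank    = λ p → trans (Steps-rk S (Ix.steps X) (toℕ p) (F.toℕ≤pred[n] p)) (+-comm (toℕ p) _)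
  ; mono    = λ {p} {q} p≤q → Steps-mono S (Ix.steps X) (toℕ p) (toℕ q) p≤q (F.toℕ≤pred[n] q)
  ; reflect = λ {p} {q} J → reflect (Ix.jump X (toℕ p) (toℕ q) (F.toℕ≤pred[n] p) (F.toℕ≤pred[n] q) J)
  ; total′  = trans (+-assoc (rk (x 0)) _ _) (trans (cong (rk (x 0) +_)
      (trans (+-comm (rk (x 0)) (suc a)) (sym (Steps-rk S (Ix.steps X) (suc a) ≤-refl)))) e)
  ; ends    = λ {p} {q} (p₀ , q₁) J →
      ends p₀ q₁ (Ix.jump X (toℕ p) (toℕ q) (F.toℕ≤pred[n] p) (F.toℕ≤pred[n] q) J)
  }
  where
  open Space S using (rk)
  reflect : ∀ {p q : Fin (2 + a)} {C : Set} → toℕ p ≡ toℕ q ⊎ ((toℕ p ≡ 0 × toℕ q ≡ suc a) × C) →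
    p ≡ q ⊎ Extremes (suc a) p q
  reflect (inj₁ e) = inj₁ (F.toℕ-injective e)
  reflect (inj₂ (e , _)) = inj₂ e
  ends : ∀ {i j} → i ≡ 0 → j ≡ suc a → i ≡ j ⊎ ((i ≡ 0 × j ≡ suc a) × E (x 0) (x (suc a))) → E (x i) (x j)
  ends refl refl (inj₂ (_ , e)) = e

I₃ : Space
I₃ = Index 2

E₃ : Fin 3 → Fin 3 → Set
E₃ = Extremes 2

fins : ∀ n → List (Fin n)
fins = allFin

squareCells : List (Fin 3 × Fin 3)
squareCells = cartesianProduct (fins 3) (fins 3)

cubeCells : List (Fin 3 × Fin 3 × Fin 3)
cubeCells = cartesianProduct (fins 3) squareCells

-- K = ⊥ forbids cubes, K = ⊤ allows them.
data Piece (K : Set) (S : Space) (N : ℕ) (E : Carrier S → Carrier S → Set) : Mass (Carrier S) → Set where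
  chain  : ∀ {c} → Tame₂ S N E c → Piece K S N E (λ F → mass F c)
  square : ∀ {φ} → Morph (I₃ ⊗ I₃) S 4 N (E₃ ⊠ E₃) E φ → Piece K S N E (λ F → mass (F ∘ φ) squareCells)
  cube   : K → ∀ {φ} → Morph (I₃ ⊗ (I₃ ⊗ I₃)) S 6 N (E₃ ⊠ (E₃ ⊠ E₃)) E φ →
           Piece K S N E (λ F → mass (F ∘ φ) cubeCells)

Pieces : (K : Set) (S : Space) (N : ℕ) (E : Carrier S → Carrier S → Set) → Mass (Carrier S) → Set
Pieces K S N E = Sum (Piece K S N E)

Pieces-map : ∀ {K S T N N′ E E′ h} → Morph S T N N′ E E′ h →
  ∀ {M} → Pieces K S N E M → Pieces K T N′ E′ (λ F → M (F ∘ h))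
Pieces-map {h = h} m = Sum-bind h λ where
  (chain {c} g) → conv (λ F → mass-map F h c) (atom (chain (Tame₂-map m g)))
  (square φ)    → atom (square (Morph-∘ m φ))
  (cube k φ)    → atom (cube k (Morph-∘ m φ))

-- Parity of sizes, and products of chains of odd size

dbl : ℕ → ℕ
dbl zero    = 0
dbl (suc n) = suc (suc (dbl n))

-- The rank sum is `a` plus twice the lowest rank, so `a` inherits its parity.
even-Ix : ∀ {S x a h} → Steps S x a → total S x a ≡ dbl h → ∃[ i ] a ≡ dbl i
even-Ix {S} {x} {a} {h} s e = go r h (trans (cong (r +_) (trans (+-comm r a) (sym (Steps-rk S s a ≤-refl)))) e)
  where
  r = Space.rk S (x 0)
  go : ∀ r h → r + (r + a) ≡ dbl h → ∃[ i ] a ≡ dbl i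
  go zero    h       e = h , e
  go (suc r) (suc h) e = go r h (suc-injective (trans (sym (+-suc r (r + a))) (suc-injective e)))
  go (suc r) zero    ()

-- The sizes for which peeling off hooks ends with a long row, a long column or a 3 × 3 square.
data Shape : ℕ → ℕ → Set where
  row    : ∀ k → Shape 0 (2 + k)
  column : ∀ k → Shape (2 + k) 0
  square : Shape 2 2
  grow   : ∀ {a b} → Shape a b → Shape (suc a) (suc b)

Shape-2≤ : ∀ {a b} → Shape a b → 2 ≤ a + b
Shape-2≤ (row k)    = s≤s (s≤s z≤n)
Shape-2≤ (column k) = s≤s (s≤s z≤n)
Shape-2≤ square     = s≤s (s≤s z≤n)
Shape-2≤ {suc a} {suc b} (grow s) = ≤-trans (Shape-2≤ s) (+-mono-≤ (n≤1+n a) (n≤1+n b))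

-- Peeling preserves the difference of the two sizes, which is even. If it is zero, a 3 × 3 square
-- is reached; otherwise the last row or column has at least three elements. Only a grid consisting
-- of one point has to be excluded.
even-Shape : ∀ i j → 0 < i + j → Shape (dbl i) (dbl j)
even-Shape zero          (suc j)       _ = row (dbl j)
even-Shape (suc i)       zero          _ = column (dbl i)
even-Shape (suc zero)    (suc zero)    _ = square
even-Shape (suc zero)    (suc (suc j)) _ = grow (grow (even-Shape 0 (suc j) (s≤s z≤n)))
even-Shape (suc (suc i)) (suc j)       _ = grow (grow (even-Shape (suc i) j (s≤s z≤n)))

mass-square : ∀ {U V : Set} (x : ℕ → U) (y : ℕ → V) F →
  mass (F ∘ (λ (p , q) → x (toℕ p) , y (toℕ q))) squareCells ≡ grid x 2 y 2 F
mass-square x y F = mass-cart (F ∘ (λ (p , q) → x (toℕ p) , y (toℕ q))) (fins 3) (fins 3)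

module _ {K : Set} {S T : Space} where

  peel : ∀ {x y a b N} → Shape a b → Ix S (None S) x a → Ix T (None T) y b →
    total S x a + total T y b ≡ N → Pieces K (S ⊗ T) N (None (S ⊗ T)) (grid x a y b)
  peel {x} {y} (row k) X Y e =
    conv (λ F → mass-hook-row x y F (2 + k)) (atom (chain (hook-free 0 (2 + k) X Y e (s≤s (s≤s z≤n)))))
  peel {x} {y} (column k) X Y e =
    conv (λ F → mass-hook-col x y F (1 + k)) (atom (chain (hook-free (2 + k) 0 X Y e (s≤s (s≤s z≤n)))))
  peel {x} {y} square X Y refl =
    conv (mass-square x y) (atom (square (Morph-∘ (Morph-relax proj₁) (Ix→Morph X refl ⊗ᵐ Ix→Morph Y refl))))
  peel {x} {y} (grow {a} {b} s) X Y e = conv (λ F → mass-hook x y F a b)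
    (atom (chain (hook-free (suc a) (suc b) X Y e (Shape-2≤ (grow s)))) ⊕
     peel s (Ix-tail S X) (Ix-init T Y) (total-hook {S} {T} (Ix.steps X) (Ix.steps Y) e))

  swapped-pieces : ∀ {x y a b E E′ N} → Shape a b → Ix S E x (2 + a) → Ix T E′ y (2 + b) →
    total S x (2 + a) + total T y (2 + b) ≡ N → Pieces K (S ⊗ T) N (E ⊠ E′) (grid x (2 + a) y (2 + b))
  swapped-pieces {x} {y} {a} {b} s X Y e = conv (λ F → mass-Z x y F a b)
    (atom (chain (Tame-Z₁ X Y e)) ⊕ Pieces-map (Morph-relax ⊥-elim) (atom (chain (Tame-Z₂ X Y e)) ⊕
      peel s (rest-Ixˡ X Y e) (rest-Ixʳ X Y e) (rest-total X Y e)))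

  pieces₂ : ∀ i j {x y E E′ N} → 0 < i + j → Ix S E x (dbl i) → Ix T E′ y (dbl j) →
    (i ≡ 0 → E (x 0) (x 0)) → (j ≡ 0 → E′ (y 0) (y 0)) →
    total S x (dbl i) + total T y (dbl j) ≡ N → Pieces K (S ⊗ T) N (E ⊠ E′) (grid x (dbl i) y (dbl j))
  pieces₂ zero (suc j) {x} {y} _ X Y p q e = conv (λ F → mass-hook-row x y F (dbl (suc j)))
    (atom (chain (tame₂ (Tame-row X Y refl (p refl) e)
      (hook-long {S} {T} {x} {y} 0 (dbl (suc j)) (Ix.steps X) (Ix.steps Y) (s≤s (s≤s z≤n))))))
  pieces₂ (suc i) zero {x} {y} _ X Y p q e = conv (λ F → mass-hook-col x y F (suc (dbl i)))
    (atom (chain (tame₂ (Tame-column X Y refl (q refl) e)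
      (hook-long {S} {T} {x} {y} (dbl (suc i)) 0 (Ix.steps X) (Ix.steps Y) (s≤s (s≤s z≤n))))))
  -- The exchange of ends would leave the centre as a point here, which has no `Shape`.
  pieces₂ (suc zero) (suc zero) {x} {y} _ X Y p q refl =
    conv (mass-square x y) (atom (square (Ix→Morph X refl ⊗ᵐ Ix→Morph Y refl)))
  pieces₂ (suc zero) (suc (suc j)) _ X Y p q e = swapped-pieces (even-Shape 0 (suc j) (s≤s z≤n)) X Y e
  pieces₂ (suc (suc i)) (suc j) _ X Y p q e = swapped-pieces (even-Shape (suc i) j (s≤s z≤n)) X Y e

ι : ℕ → Fin 3
ι zero          = F.zero
ι (suc zero)    = F.suc F.zero
ι (suc (suc _)) = F.suc (F.suc F.zero)

Ix-ι : Ix I₃ E₃ ι 2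
Ix-ι = ix steps jump
  where
  steps : Steps I₃ ι 2
  steps zero       _ = z≤n , refl
  steps (suc zero) _ = s≤s z≤n , refl
  steps (suc (suc i)) (s≤s (s≤s ()))
  jump : ∀ i j → i ≤ 2 → j ≤ 2 → Space._↝_ I₃ (ι i) (ι j) → i ≡ j ⊎ ((i ≡ 0 × j ≡ 2) × E₃ (ι 0) (ι 2))
  jump i j i≤2 j≤2 (inj₁ e) = inj₁ (trans (sym (toℕ-ι i i≤2)) (trans (cong toℕ e) (toℕ-ι j j≤2)))
    where
    toℕ-ι : ∀ i → i ≤ 2 → toℕ (ι i) ≡ i
    toℕ-ι zero             _ = refl
    toℕ-ι (suc zero)       _ = refl
    toℕ-ι (suc (suc zero)) _ = refl
    toℕ-ι (suc (suc (suc i))) (s≤s (s≤s ()))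
  jump zero (suc (suc zero)) _ _ (inj₂ _) = inj₂ ((refl , refl) , refl , refl)
  jump zero (suc (suc (suc _))) _ (s≤s (s≤s ())) (inj₂ _)
  jump zero zero _ _ (inj₂ (_ , ()))
  jump zero (suc zero) _ _ (inj₂ (_ , ()))
  jump (suc zero) _ _ _ (inj₂ (() , _))
  jump (suc (suc _)) _ _ _ (inj₂ (() , _))

Morph-attach : ∀ {S T E E′ N} (p : Carrier S) → E p p →
  Morph T (S ⊗ T) N (Space.rk S p + Space.rk S p + N) E′ (E ⊠ E′) (p ,_)
Morph-attach {S} {T} p e = record
  { shift   = Space.rk S p
  ; rank    = λ _ → refl
  ; mono    = λ l → Space.⊑-refl S , l
  ; reflect = proj₂
  ; total′  = refl
  ; ends    = λ e′ _ → e , e′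
  }

Morph-square : ∀ {S T N N′ E E′ φ} → Morph (I₃ ⊗ I₃) T 4 N (E₃ ⊠ E₃) E′ φ →
  Morph ((S ⊗ I₃) ⊗ I₃) (S ⊗ T) (N′ + 2 + 2) (N′ + N) ((E ⊠ E₃) ⊠ E₃) (E ⊠ E′)
    (λ ((p , i) , j) → p , φ (i , j))
Morph-square {S} {N′ = N′} φ = Morph-∘ (Morph-id ⊗ᵐ φ) (Morph-assoc {S} {I₃} {I₃} {N′} {2} {2})

dbl-+ : ∀ i j → dbl i + dbl j ≡ dbl (i + j)
dbl-+ zero    j = refl
dbl-+ (suc i) j = cong (suc ∘ suc) (dbl-+ i j)

n+n≡dbl : ∀ n → n + n ≡ dbl n
n+n≡dbl zero    = refl
n+n≡dbl (suc n) = cong suc (trans (+-suc n n) (cong suc (n+n≡dbl n)))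

total-even : ∀ {S x} i → Steps S x (dbl i) → total S x (dbl i) ≡ dbl (i + Space.rk S (x 0))
total-even {S} {x} i s = trans (cong (r +_) (Steps-rk S s (dbl i) ≤-refl))
  (trans (rearrange r (dbl i)) (trans (cong (dbl i +_) (n+n≡dbl r)) (dbl-+ i r)))
  where
  r = Space.rk S (x 0)
  rearrange : ∀ r a → r + (a + r) ≡ a + (r + r)
  rearrange = solve-∀

Tame₂→even-Ix : ∀ {S N E c h} → Tame₂ S N E c → N ≡ dbl h →
  ∃[ x ] ∃[ i ] Ix S E x (dbl (suc i)) × total S x (dbl (suc i)) ≡ N × seg x (dbl (suc i)) ≡ c
Tame₂→even-Ix {S} {h = h} g even with Tame₂→Ix S g
... | x , a , X , t , refl , _ with even-Ix {S} {h = h} (Ix.steps X) (trans t even)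
... | suc i , refl = x , i , X , t , refl

module _ {S T : Space} where

  row-times : Mass (Carrier T) → (ℕ → Carrier S) → ℕ → Mass (Carrier S × Carrier T)
  row-times M x a F = mass (λ p → M (λ q → F (p , q))) (seg x a)

  -- The two sides of the square are multiplied in one after the other: `times₃` with the first side
  -- returns chains of odd size with at least three elements, and these can be fed to `pieces₂` with
  -- the second side.
  times-square : ∀ i {x E E′ N φ} → Ix S E x (dbl (2 + i)) → Morph (I₃ ⊗ I₃) T 4 N (E₃ ⊠ E₃) E′ φ →
    Pieces ⊤ (S ⊗ T) (total S x (dbl (2 + i)) + N) (E ⊠ E′)
      (row-times (λ F → mass (F ∘ φ) squareCells) x (dbl (2 + i)))
  times-square i {x} {φ = φ} X Φ = conv
    (λ F → mass-cong (λ p → sym (mass-cart (λ q → F (p , φ q)) (fins 3) (fins 3))) (seg x (dbl (2 + i))))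
    (Pieces-map (Morph-square {N′ = total S x (dbl (2 + i))} Φ)
      (Sum-timesʳ (seg ι 2) times-I₃ (times₃ X Ix-ι refl)))
    where
    even : total S x (dbl (2 + i)) + 2 ≡ dbl (2 + i + Space.rk S (x 0) + 1)
    even = trans (cong (_+ 2) (total-even {S} (2 + i) (Ix.steps X))) (dbl-+ (2 + i + Space.rk S (x 0)) 1)
    times-I₃ : ∀ {M} → One (Tame₂ (S ⊗ I₃) (total S x (dbl (2 + i)) + 2) _) M →
      Pieces ⊤ ((S ⊗ I₃) ⊗ I₃) (total S x (dbl (2 + i)) + 2 + 2) _ (λ F → M (λ p → mass (λ q → F (p , q)) (seg ι 2)))
    times-I₃ (one g) with y , j , Y , t , refl ← Tame₂→even-Ix g even =
      pieces₂ (suc j) 1 (s≤s z≤n) Y Ix-ι (λ ()) (λ ()) (cong (_+ 2) t)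

  -- New cubes arise only here, from a three-element chain times a square. The incoming pieces come
  -- from two factors and contain no cube, which the parameter ⊥ expresses.
  times-piece : ∀ i h {x E E′ N} → Ix S E x (dbl i) → (i ≡ 0 → E (x 0) (x 0)) → N ≡ dbl h →
    ∀ {M} → Piece ⊥ T N E′ M → Pieces ⊤ (S ⊗ T) (total S x (dbl i) + N) (E ⊠ E′) (row-times M x (dbl i))
  times-piece i h {x} X p even (chain g) with y , j , Y , t , refl ← Tame₂→even-Ix g even =
    pieces₂ i (suc j) (m≤n⇒m≤o+n i (s≤s z≤n)) X Y p (λ ()) (cong (total S x (dbl i) +_) t)
  times-piece zero h {x} X p even (square {φ} Φ) = conv (λ F → sym (+-identityʳ _))
    (Pieces-map (Morph-attach (x 0) (p refl)) (atom (square Φ)))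
  times-piece (suc zero) h {x} X p even (square {φ} Φ) = conv
    (λ F → mass-cart (λ (i , q) → F (x (toℕ i) , φ q)) (fins 3) squareCells)
    (atom (cube tt (Ix→Morph X refl ⊗ᵐ Φ)))
  times-piece (suc (suc i)) h X p even (square Φ) = times-square i X Φ

-- Decompositions checked by computation

record Decidable (S : Space) : Set where
  open Space S hiding (Carrier)
  field
    _≟_  : DecidableEquality (Carrier S)
    _⊑?_ : ∀ p q → Dec (p ⊑ q)
    _↝?_ : ∀ p q → Dec (p ↝ q)

_⊗?_ : ∀ {S T} → Decidable S → Decidable T → Decidable (S ⊗ T)
A ⊗? B = record
  { _≟_  = ≡-dec A._≟_ B._≟_
  ; _⊑?_ = λ (p , q) (p′ , q′) → (p A.⊑? p′) ×-dec (q B.⊑? q′)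
  ; _↝?_ = λ (p , q) (p′ , q′) → (p A.↝? p′) ×-dec (q B.↝? q′)
  }
  where
  module A = Decidable A
  module B = Decidable B

Index? : ∀ n → Decidable (Index n)
Index? n = record
  { _≟_  = F._≟_
  ; _⊑?_ = λ p q → toℕ p ≤? toℕ q
  ; _↝?_ = λ p q → (p F.≟ q) ⊎-dec ((toℕ p ℕ.≟ 0) ×-dec (toℕ q ℕ.≟ n))
  }

Extremes? : ∀ n p q → Dec (Extremes n p q)
Extremes? n p q = (toℕ p ℕ.≟ 0) ×-dec (toℕ q ℕ.≟ n)

_⊠?_ : ∀ {U V : Set} {E : U → U → Set} {E′ : V → V → Set} →
  (∀ p q → Dec (E p q)) → (∀ p q → Dec (E′ p q)) → ∀ p q → Dec ((E ⊠ E′) p q)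
(E? ⊠? E′?) (p , q) (p′ , q′) = E? p p′ ×-dec E′? q q′

module _ {U : Set} (_≟_ : DecidableEquality U) where

  remove : U → List U → Maybe (List U)
  remove x []      = nothing
  remove x (y ∷ l) with x ≟ y | remove x l
  ... | yes _ | _       = just l
  ... | no _  | just l′ = just (y ∷ l′)
  ... | no _  | nothing = nothing

  mass-remove : ∀ F x l {l′} → remove x l ≡ just l′ → mass F l ≡ F x + mass F l′
  mass-remove F x (y ∷ l) e with x ≟ y | remove x l in eq
  mass-remove F x (y ∷ l) refl | yes refl | _       = refl
  mass-remove F x (y ∷ l) refl | no _     | just l′ =
    trans (cong (F y +_) (mass-remove F x l eq)) (x∙yz≈y∙xz (F y) (F x) _)

  permutes : List U → List U → Bool
  permutes []      []      = true
  permutes []      (_ ∷ _) = false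
  permutes (x ∷ l) l′ with remove x l′
  ... | just l″ = permutes l l″
  ... | nothing = false

  mass-permutes : ∀ F l l′ → T (permutes l l′) → mass F l ≡ mass F l′
  mass-permutes F []      []      _ = refl
  mass-permutes F (x ∷ l) l′ p with remove x l′ in eq
  ... | just l″ = trans (cong (F x +_) (mass-permutes F l l″ p)) (sym (mass-remove F x l′ eq))

module Table {S : Space} (S? : Decidable S) (N : ℕ) {E : Carrier S → Carrier S → Set} (E? : ∀ p q → Dec (E p q)) where
  open Space S hiding (Carrier)
  open Decidable S?

  final : Carrier S → List (Carrier S) → Carrier S
  final p []      = p
  final _ (q ∷ c) = final q c

  Jumps : Carrier S → Carrier S → List (Carrier S) → Set
  Jumps f l c = All (λ p → All (λ q → p ↝ q → p ≡ q ⊎ ((p ≡ f × q ≡ l) × E f l)) c) c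

  Valid : List (Carrier S) → Set
  Valid []      = ⊥
  Valid (p ∷ c) = Linked _⋖_ (p ∷ c) × rk p + rk (final p c) ≡ N × Jumps p (final p c) (p ∷ c)

  valid? : ∀ c → Dec (Valid c)
  valid? []      = no id
  valid? (p ∷ c) = linked? (λ q r → (q ⊑? r) ×-dec (rk r ℕ.≟ suc (rk q))) (p ∷ c)
    ×-dec ((rk p + rk (final p c)) ℕ.≟ N)
    ×-dec All.all? (λ q → All.all? (λ r → (q ↝? r) →-dec ((q ≟ r) ⊎-dec
            (((q ≟ p) ×-dec (r ≟ final p c)) ×-dec E? p (final p c)))) (p ∷ c)) (p ∷ c)

  run : ∀ p c → Linked _⋖_ (p ∷ c) → Run p (p ∷ c) (final p c)
  run p []      [-]     = [ p ]
  run p (q ∷ c) (s ∷ r) = s ∷ run q c r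

  Valid⇒Tame : ∀ {c} → Valid c → Tame S N E c
  Valid⇒Tame {p ∷ c} (l , e , j) =
    tame (run p c l) e λ q∈ r∈ → All.lookup (All.lookup j q∈) r∈

  -- Both implicit arguments are settled by evaluation: each listed chain is tame, and together the
  -- chains are a rearrangement of the cells, which preserves every weight sum.
  table : ∀ cs cells → {True (All.all? valid? cs)} → {T (permutes _≟_ (concat cs) cells)} →
    Chains (Tame S N E) (λ F → mass F cells)
  table cs cells {v} {p} = conv (λ F → mass-permutes _≟_ F (concat cs) cells p)
    (Sum-list (All.map Valid⇒Tame (toWitness {a? = All.all? valid? cs} v)))


-- Multiplying a chain with four elements by I₃ leaves a chain with two elements, whose product with
-- I₃ would contain a jump; the following three decompositions were found by computer search.
square-table : Chains (Tame (Index 3 ⊗ (I₃ ⊗ I₃)) 7 (Extremes 3 ⊠ (E₃ ⊠ E₃)))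
  (λ F → mass F (cartesianProduct (fins 4) squareCells))
square-table = Table.table (Index? 3 ⊗? (Index? 2 ⊗? Index? 2)) 7 (Extremes? 3 ⊠? (Extremes? 2 ⊠? Extremes? 2))
    (  ((# 0 , # 0 , # 0) ∷ (# 1 , # 0 , # 0) ∷ (# 1 , # 0 , # 1) ∷ (# 1 , # 1 , # 1)
        ∷ (# 2 , # 1 , # 1) ∷ (# 3 , # 1 , # 1) ∷ (# 3 , # 1 , # 2) ∷ (# 3 , # 2 , # 2) ∷ [])
    ∷ ((# 0 , # 0 , # 1) ∷ (# 0 , # 1 , # 1) ∷ (# 0 , # 1 , # 2) ∷ (# 1 , # 1 , # 2)
        ∷ (# 1 , # 2 , # 2) ∷ (# 2 , # 2 , # 2) ∷ [])
    ∷ ((# 0 , # 1 , # 0) ∷ (# 0 , # 2 , # 0) ∷ (# 1 , # 2 , # 0) ∷ (# 1 , # 2 , # 1)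
        ∷ (# 2 , # 2 , # 1) ∷ (# 3 , # 2 , # 1) ∷ [])
    ∷ ((# 0 , # 0 , # 2) ∷ (# 1 , # 0 , # 2) ∷ (# 2 , # 0 , # 2) ∷ (# 2 , # 1 , # 2) ∷ [])
    ∷ ((# 1 , # 1 , # 0) ∷ (# 2 , # 1 , # 0) ∷ (# 2 , # 2 , # 0) ∷ (# 3 , # 2 , # 0) ∷ [])
    ∷ ((# 2 , # 0 , # 0) ∷ (# 2 , # 0 , # 1) ∷ (# 3 , # 0 , # 1) ∷ (# 3 , # 0 , # 2) ∷ [])
    ∷ ((# 0 , # 2 , # 1) ∷ (# 0 , # 2 , # 2) ∷ [])
    ∷ ((# 3 , # 0 , # 0) ∷ (# 3 , # 1 , # 0) ∷ [])
    ∷ [])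
    (cartesianProduct (fins 4) squareCells)

cube-table : Chains (Tame (Index 3 ⊗ (I₃ ⊗ (I₃ ⊗ I₃))) 9 (Extremes 3 ⊠ (E₃ ⊠ (E₃ ⊠ E₃))))
  (λ F → mass F (cartesianProduct (fins 4) cubeCells))
cube-table = Table.table (Index? 3 ⊗? (Index? 2 ⊗? (Index? 2 ⊗? Index? 2))) 9
    (Extremes? 3 ⊠? (Extremes? 2 ⊠? (Extremes? 2 ⊠? Extremes? 2)))
    (  ((# 0 , # 0 , # 0 , # 0) ∷ (# 0 , # 0 , # 1 , # 0) ∷ (# 0 , # 0 , # 1 , # 1)
        ∷ (# 1 , # 0 , # 1 , # 1) ∷ (# 1 , # 1 , # 1 , # 1) ∷ (# 2 , # 1 , # 1 , # 1)
        ∷ (# 2 , # 1 , # 1 , # 2) ∷ (# 3 , # 1 , # 1 , # 2) ∷ (# 3 , # 1 , # 2 , # 2)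
        ∷ (# 3 , # 2 , # 2 , # 2) ∷ [])
    ∷ ((# 0 , # 0 , # 0 , # 1) ∷ (# 0 , # 1 , # 0 , # 1) ∷ (# 0 , # 1 , # 0 , # 2)
        ∷ (# 0 , # 1 , # 1 , # 2) ∷ (# 0 , # 2 , # 1 , # 2) ∷ (# 0 , # 2 , # 2 , # 2)
        ∷ (# 1 , # 2 , # 2 , # 2) ∷ (# 2 , # 2 , # 2 , # 2) ∷ [])
    ∷ ((# 1 , # 0 , # 0 , # 0) ∷ (# 1 , # 0 , # 0 , # 1) ∷ (# 1 , # 1 , # 0 , # 1)
        ∷ (# 2 , # 1 , # 0 , # 1) ∷ (# 2 , # 1 , # 0 , # 2) ∷ (# 3 , # 1 , # 0 , # 2)
        ∷ (# 3 , # 2 , # 0 , # 2) ∷ (# 3 , # 2 , # 1 , # 2) ∷ [])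
    ∷ ((# 0 , # 1 , # 0 , # 0) ∷ (# 1 , # 1 , # 0 , # 0) ∷ (# 1 , # 1 , # 1 , # 0)
        ∷ (# 2 , # 1 , # 1 , # 0) ∷ (# 2 , # 2 , # 1 , # 0) ∷ (# 3 , # 2 , # 1 , # 0)
        ∷ (# 3 , # 2 , # 1 , # 1) ∷ (# 3 , # 2 , # 2 , # 1) ∷ [])
    ∷ ((# 0 , # 0 , # 0 , # 2) ∷ (# 1 , # 0 , # 0 , # 2) ∷ (# 1 , # 1 , # 0 , # 2)
        ∷ (# 1 , # 1 , # 1 , # 2) ∷ (# 1 , # 2 , # 1 , # 2) ∷ (# 2 , # 2 , # 1 , # 2) ∷ [])
    ∷ ((# 1 , # 0 , # 1 , # 0) ∷ (# 1 , # 0 , # 2 , # 0) ∷ (# 2 , # 0 , # 2 , # 0)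
        ∷ (# 3 , # 0 , # 2 , # 0) ∷ (# 3 , # 1 , # 2 , # 0) ∷ (# 3 , # 1 , # 2 , # 1) ∷ [])
    ∷ ((# 0 , # 0 , # 2 , # 0) ∷ (# 0 , # 0 , # 2 , # 1) ∷ (# 1 , # 0 , # 2 , # 1)
        ∷ (# 2 , # 0 , # 2 , # 1) ∷ (# 2 , # 1 , # 2 , # 1) ∷ (# 2 , # 1 , # 2 , # 2) ∷ [])
    ∷ ((# 0 , # 1 , # 1 , # 0) ∷ (# 0 , # 2 , # 1 , # 0) ∷ (# 1 , # 2 , # 1 , # 0)
        ∷ (# 1 , # 2 , # 2 , # 0) ∷ (# 2 , # 2 , # 2 , # 0) ∷ (# 3 , # 2 , # 2 , # 0) ∷ [])
    ∷ ((# 2 , # 0 , # 0 , # 0) ∷ (# 2 , # 0 , # 1 , # 0) ∷ (# 2 , # 0 , # 1 , # 1)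
        ∷ (# 3 , # 0 , # 1 , # 1) ∷ (# 3 , # 0 , # 2 , # 1) ∷ (# 3 , # 0 , # 2 , # 2) ∷ [])
    ∷ ((# 0 , # 2 , # 0 , # 0) ∷ (# 0 , # 2 , # 0 , # 1) ∷ (# 0 , # 2 , # 1 , # 1)
        ∷ (# 1 , # 2 , # 1 , # 1) ∷ (# 2 , # 2 , # 1 , # 1) ∷ (# 2 , # 2 , # 2 , # 1) ∷ [])
    ∷ ((# 0 , # 1 , # 2 , # 0) ∷ (# 0 , # 2 , # 2 , # 0) ∷ (# 0 , # 2 , # 2 , # 1)
        ∷ (# 1 , # 2 , # 2 , # 1) ∷ [])
    ∷ ((# 2 , # 0 , # 0 , # 1) ∷ (# 3 , # 0 , # 0 , # 1) ∷ (# 3 , # 0 , # 0 , # 2)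
        ∷ (# 3 , # 0 , # 1 , # 2) ∷ [])
    ∷ ((# 2 , # 1 , # 0 , # 0) ∷ (# 2 , # 2 , # 0 , # 0) ∷ (# 3 , # 2 , # 0 , # 0)
        ∷ (# 3 , # 2 , # 0 , # 1) ∷ [])
    ∷ ((# 0 , # 0 , # 1 , # 2) ∷ (# 1 , # 0 , # 1 , # 2) ∷ (# 1 , # 0 , # 2 , # 2)
        ∷ (# 2 , # 0 , # 2 , # 2) ∷ [])
    ∷ ((# 3 , # 0 , # 0 , # 0) ∷ (# 3 , # 1 , # 0 , # 0) ∷ (# 3 , # 1 , # 0 , # 1)
        ∷ (# 3 , # 1 , # 1 , # 1) ∷ [])
    ∷ ((# 0 , # 1 , # 1 , # 1) ∷ (# 0 , # 1 , # 2 , # 1) ∷ (# 1 , # 1 , # 2 , # 1)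
        ∷ (# 1 , # 1 , # 2 , # 2) ∷ [])
    ∷ ((# 1 , # 2 , # 0 , # 0) ∷ (# 1 , # 2 , # 0 , # 1) ∷ (# 2 , # 2 , # 0 , # 1)
        ∷ (# 2 , # 2 , # 0 , # 2) ∷ [])
    ∷ ((# 0 , # 2 , # 0 , # 2) ∷ (# 1 , # 2 , # 0 , # 2) ∷ [])
    ∷ ((# 0 , # 0 , # 2 , # 2) ∷ (# 0 , # 1 , # 2 , # 2) ∷ [])
    ∷ ((# 2 , # 0 , # 0 , # 2) ∷ (# 2 , # 0 , # 1 , # 2) ∷ [])
    ∷ ((# 1 , # 1 , # 2 , # 0) ∷ (# 2 , # 1 , # 2 , # 0) ∷ [])
    ∷ ((# 3 , # 0 , # 1 , # 0) ∷ (# 3 , # 1 , # 1 , # 0) ∷ [])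
    ∷ [])
    (cartesianProduct (fins 4) cubeCells)

-- Models a two-element A: it does not contain both ∅ and the full set, so its jumps are trivial, in
-- contrast to `Index 1`.
D₂ : Space
D₂ = record
  { Carrier = Fin 2
  ; rk      = toℕ
  ; _⊑_     = λ i j → toℕ i ≤ toℕ j
  ; ⊑-refl  = ≤-refl
  ; ⊑-trans = ≤-trans
  ; _↝_     = _≡_
  }

D₂? : Decidable D₂
D₂? = record { _≟_ = F._≟_ ; _⊑?_ = λ p q → toℕ p ≤? toℕ q ; _↝?_ = F._≟_ }

-- The relation is `None` because the coordinate in `D₂` cannot move, so even a jump between
-- opposite corners of the cube is unwanted. The rank sum is 1 + 6.
thin-cube-table : Chains (Tame (D₂ ⊗ (I₃ ⊗ (I₃ ⊗ I₃))) 7 (None (D₂ ⊗ (I₃ ⊗ (I₃ ⊗ I₃)))))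
  (λ F → mass F (cartesianProduct (fins 2) cubeCells))
thin-cube-table = Table.table (D₂? ⊗? (Index? 2 ⊗? (Index? 2 ⊗? Index? 2))) 7 (λ _ _ → no id)
    (  ((# 0 , # 0 , # 0 , # 0) ∷ (# 0 , # 1 , # 0 , # 0) ∷ (# 0 , # 1 , # 0 , # 1)
        ∷ (# 0 , # 2 , # 0 , # 1) ∷ (# 0 , # 2 , # 1 , # 1) ∷ (# 0 , # 2 , # 1 , # 2)
        ∷ (# 1 , # 2 , # 1 , # 2) ∷ (# 1 , # 2 , # 2 , # 2) ∷ [])
    ∷ ((# 1 , # 0 , # 0 , # 0) ∷ (# 1 , # 0 , # 1 , # 0) ∷ (# 1 , # 0 , # 1 , # 1)
        ∷ (# 1 , # 1 , # 1 , # 1) ∷ (# 1 , # 1 , # 2 , # 1) ∷ (# 1 , # 1 , # 2 , # 2) ∷ [])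
    ∷ ((# 0 , # 0 , # 1 , # 0) ∷ (# 0 , # 1 , # 1 , # 0) ∷ (# 0 , # 1 , # 2 , # 0)
        ∷ (# 0 , # 1 , # 2 , # 1) ∷ (# 0 , # 2 , # 2 , # 1) ∷ (# 1 , # 2 , # 2 , # 1) ∷ [])
    ∷ ((# 0 , # 0 , # 0 , # 1) ∷ (# 0 , # 0 , # 1 , # 1) ∷ (# 0 , # 1 , # 1 , # 1)
        ∷ (# 0 , # 1 , # 1 , # 2) ∷ (# 0 , # 1 , # 2 , # 2) ∷ (# 0 , # 2 , # 2 , # 2) ∷ [])
    ∷ ((# 0 , # 2 , # 0 , # 0) ∷ (# 1 , # 2 , # 0 , # 0) ∷ (# 1 , # 2 , # 0 , # 1)
        ∷ (# 1 , # 2 , # 1 , # 1) ∷ [])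
    ∷ ((# 0 , # 0 , # 0 , # 2) ∷ (# 1 , # 0 , # 0 , # 2) ∷ (# 1 , # 0 , # 1 , # 2)
        ∷ (# 1 , # 1 , # 1 , # 2) ∷ [])
    ∷ ((# 1 , # 1 , # 0 , # 0) ∷ (# 1 , # 1 , # 1 , # 0) ∷ (# 1 , # 2 , # 1 , # 0)
        ∷ (# 1 , # 2 , # 2 , # 0) ∷ [])
    ∷ ((# 1 , # 0 , # 0 , # 1) ∷ (# 1 , # 1 , # 0 , # 1) ∷ (# 1 , # 1 , # 0 , # 2)
        ∷ (# 1 , # 2 , # 0 , # 2) ∷ [])
    ∷ ((# 0 , # 0 , # 2 , # 0) ∷ (# 0 , # 0 , # 2 , # 1) ∷ (# 1 , # 0 , # 2 , # 1)
        ∷ (# 1 , # 0 , # 2 , # 2) ∷ [])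
    ∷ ((# 1 , # 0 , # 2 , # 0) ∷ (# 1 , # 1 , # 2 , # 0) ∷ [])
    ∷ ((# 0 , # 0 , # 1 , # 2) ∷ (# 0 , # 0 , # 2 , # 2) ∷ [])
    ∷ ((# 0 , # 2 , # 1 , # 0) ∷ (# 0 , # 2 , # 2 , # 0) ∷ [])
    ∷ ((# 0 , # 1 , # 0 , # 2) ∷ (# 0 , # 2 , # 0 , # 2) ∷ [])
    ∷ [])
    (cartesianProduct (fins 2) cubeCells)

-- Products of pieces with a chain of four or more elements, even in number

odd-Ix : ∀ {S x a h} → Steps S x a → total S x a ≡ suc (dbl h) → ∃[ i ] a ≡ suc (dbl i)
odd-Ix {S} {x} {a} {h} s e = go r h (trans (cong (r +_) (trans (+-comm r a) (sym (Steps-rk S s a ≤-refl)))) e)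
  where
  r = Space.rk S (x 0)
  go : ∀ r h → r + (r + a) ≡ suc (dbl h) → ∃[ i ] a ≡ suc (dbl i)
  go zero    h       e = h , e
  go (suc r) (suc h) e = go r h (suc-injective (trans (sym (+-suc r (r + a))) (suc-injective e)))
  go (suc r) zero    e with () ← trans (sym (+-suc r (r + a))) (suc-injective e)

-- Three elements are guaranteed, and an odd rank sum makes their number even, so there are at least
-- four.
Tame₂→odd-Ix : ∀ {S N E c h} → Tame₂ S N E c → N ≡ suc (dbl h) →
  ∃[ x ] ∃[ i ] Ix S E x (3 + dbl i) × total S x (3 + dbl i) ≡ N × seg x (3 + dbl i) ≡ c
Tame₂→odd-Ix {S} {h = h} g odd with Tame₂→Ix S g
... | x , a , X , t , refl , _ with odd-Ix {S} {h = h} (Ix.steps X) (trans t odd)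
... | suc i , refl = x , i , X , t , refl

total-odd : ∀ {S x} i → Steps S x (suc (dbl i)) → total S x (suc (dbl i)) ≡ suc (dbl (i + Space.rk S (x 0)))
total-odd {S} {x} i s = trans (total-init S s) (cong suc (total-even {S} i (Steps-init S s)))

Morph-cube : ∀ {S T N N′ E E′ φ} → Morph (I₃ ⊗ (I₃ ⊗ I₃)) T 6 N (E₃ ⊠ (E₃ ⊠ E₃)) E′ φ →
  Morph ((S ⊗ I₃) ⊗ (I₃ ⊗ I₃)) (S ⊗ T) (N′ + 2 + 4) (N′ + N) ((E ⊠ E₃) ⊠ (E₃ ⊠ E₃)) (E ⊠ E′)
    (λ ((p , i) , q) → p , φ (i , q))
Morph-cube {S} {N′ = N′} φ = Morph-∘ (Morph-id ⊗ᵐ φ) (Morph-assoc {S} {I₃} {I₃ ⊗ I₃} {N′} {2} {4})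

odd-times-square : ∀ {S T} k {x E E′ N φ} → Ix S E x (3 + dbl k) →
  Morph (I₃ ⊗ I₃) T 4 N (E₃ ⊠ E₃) E′ φ →
  Chains (Tame (S ⊗ T) (total S x (3 + dbl k) + N) (E ⊠ E′))
    (row-times {S} {T} (λ F → mass (F ∘ φ) squareCells) x (3 + dbl k))
odd-times-square zero {x} {φ = φ} X Φ = conv
  (λ F → mass-cart (λ (i , q) → F (x (toℕ i) , φ q)) (fins 4) squareCells)
  (Chains-Tame-map (Ix→Morph X refl ⊗ᵐ Φ) square-table)
odd-times-square {S} (suc k) {x} {φ = φ} X Φ = conv
  (λ F → mass-cong (λ p → sym (mass-cart (λ q → F (p , φ q)) (fins 3) (fins 3))) (seg x (3 + dbl (suc k))))
  (Chains-Tame-map (Morph-square {N′ = N′} Φ) (Sum-timesʳ (seg ι 2) times-I₃ (times₃ X Ix-ι refl)))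
  where
  N′ = total S x (3 + dbl (suc k))
  odd : N′ + 2 ≡ suc (dbl (2 + k + Space.rk S (x 0) + 1))
  odd = trans (cong (_+ 2) (total-odd {S} (2 + k) (Ix.steps X))) (cong suc (dbl-+ (2 + k + Space.rk S (x 0)) 1))
  times-I₃ : ∀ {M} → One (Tame₂ (S ⊗ I₃) (N′ + 2) _) M →
    Chains (Tame ((S ⊗ I₃) ⊗ I₃) (N′ + 2 + 2) _) (λ F → M (λ p → mass (λ q → F (p , q)) (seg ι 2)))
  times-I₃ (one g) with y , j , Y , t , refl ← Tame₂→odd-Ix g odd = swapped Y Ix-ι (cong (_+ 2) t)

Chains-cast : ∀ {S N N′ E M} → N ≡ N′ → Chains (Tame S N E) M → Chains (Tame S N′ E) M
Chains-cast refl s = s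

-- From six elements on, one side is split off by `times₃`. The resulting chains again have an even
-- number of elements, at least four, so the product with the other two sides is a case of
-- `odd-times-square`, whose own table may be used.
odd-times-cube : ∀ {S T} k {x E E′ N φ} → Ix S E x (3 + dbl k) →
  Morph (I₃ ⊗ (I₃ ⊗ I₃)) T 6 N (E₃ ⊠ (E₃ ⊠ E₃)) E′ φ →
  Chains (Tame (S ⊗ T) (total S x (3 + dbl k) + N) (E ⊠ E′))
    (row-times {S} {T} (λ F → mass (F ∘ φ) cubeCells) x (3 + dbl k))
odd-times-cube zero {x} {φ = φ} X Φ = conv
  (λ F → mass-cart (λ (i , q) → F (x (toℕ i) , φ q)) (fins 4) cubeCells)
  (Chains-Tame-map (Ix→Morph X refl ⊗ᵐ Φ) cube-table)
odd-times-cube {S} (suc k) {x} {φ = φ} X Φ = conv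
  (λ F → mass-cong (λ p → sym (mass-cart (λ q → F (p , φ q)) (fins 3) squareCells)) (seg x (3 + dbl (suc k))))
  (Chains-Tame-map (Morph-cube {N′ = N′} Φ) (Sum-timesʳ squareCells times-I₃² (times₃ X Ix-ι refl)))
  where
  N′ = total S x (3 + dbl (suc k))
  odd : N′ + 2 ≡ suc (dbl (2 + k + Space.rk S (x 0) + 1))
  odd = trans (cong (_+ 2) (total-odd {S} (2 + k) (Ix.steps X))) (cong suc (dbl-+ (2 + k + Space.rk S (x 0)) 1))
  times-I₃² : ∀ {M} → One (Tame₂ (S ⊗ I₃) (N′ + 2) _) M →
    Chains (Tame ((S ⊗ I₃) ⊗ (I₃ ⊗ I₃)) (N′ + 2 + 4) _) (λ F → M (λ p → mass (λ q → F (p , q)) squareCells))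
  times-I₃² (one g) with y , j , Y , t , refl ← Tame₂→odd-Ix g odd =
    Chains-cast (cong (_+ 4) t) (odd-times-square j Y Morph-id)

odd-times-piece : ∀ {S T} k {x E E′ N} → Ix S E x (3 + dbl k) → ∀ {M} → Piece ⊤ T N E′ M →
  Chains (Tame (S ⊗ T) (total S x (3 + dbl k) + N) (E ⊠ E′)) (row-times {S} {T} M x (3 + dbl k))
odd-times-piece {S} {T} k {x} X (chain g) with y , b , Y , t , refl , _ ← Tame₂→Ix T g =
  swapped X Y (cong (total S x (3 + dbl k) +_) t)
odd-times-piece k X (square Φ) = odd-times-square k X Φ
odd-times-piece k X (cube _ Φ) = odd-times-cube k X Φ

-- Products with a chain of two elements

module _ (S : Space) where
  open Space S hiding (Carrier)

  -- Weaker than `Tame` in that a jump may lie anywhere in the chain. The long hook in the product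
  -- with a pair needs this: the jump along its row ends one step before the last element.
  record Jumping (N : ℕ) (L : Carrier S → Carrier S → Set) (c : List (Carrier S)) : Set where
    constructor jumping
    field
      {first last} : Carrier S
      run      : Run first c last
      balanced : rk first + rk last ≡ N
      jump     : ∀ {p q} → p ∈ c → q ∈ c → p ↝ q → p ≡ q ⊎ L p q

module _ {S : Space} where

  Tame⇒Jumping : ∀ {N E c} → Tame S N E c → Jumping S N E c
  Tame⇒Jumping {E = E} (tame {f} {l} run bal j) = jumping run bal λ p∈ q∈ J → weaken (j p∈ q∈ J)
    where
    weaken : ∀ {p q} → p ≡ q ⊎ ((p ≡ f × q ≡ l) × E f l) → p ≡ q ⊎ E p q
    weaken (inj₁ e) = inj₁ e
    weaken (inj₂ ((refl , refl) , e)) = inj₂ e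

  Jumping-map : ∀ {N L L′ c} → (∀ p q → L p q → L′ p q) → Jumping S N L c → Jumping S N L′ c
  Jumping-map {L = L} {L′} h (jumping run bal j) = jumping run bal λ p∈ q∈ J → weaken (j p∈ q∈ J)
    where
    weaken : ∀ {p q} → p ≡ q ⊎ L p q → p ≡ q ⊎ L′ p q
    weaken (inj₁ e) = inj₁ e
    weaken (inj₂ e) = inj₂ (h _ _ e)

  Jumping⇒Tame : ∀ {N c} → Jumping S N (None S) c → Tame S N (None S) c
  Jumping⇒Tame (jumping run bal j) = tame run bal λ p∈ q∈ J → weaken (j p∈ q∈ J)
    where
    weaken : ∀ {A C : Set} → A ⊎ ⊥ → A ⊎ C
    weaken (inj₁ e) = inj₁ e

Ix-single : ∀ S {E} (p : Carrier S) → Ix S E (λ _ → p) 0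
Ix-single S p = ix (λ _ ()) λ { .0 .0 z≤n z≤n _ → inj₁ refl }

module Thin {S : Space} {a : ℕ → Carrier S} (A : Ix S (None S) a 1) where

  Snd : ∀ {T : Space} → (Carrier T → Carrier T → Set) → Carrier (S ⊗ T) → Carrier (S ⊗ T) → Set
  Snd E p q = E (proj₂ p) (proj₂ q)

  -- The pair admits no move, so a jump of the product is a jump of `c` at a fixed element of the
  -- pair; if `E` is empty, there is none.
  thin-chain : ∀ {T N E c} → Tame T N E c →
    Chains (Jumping (S ⊗ T) (total S a 1 + N) (Snd {T} E)) (row-times {S} {T} (λ F → mass F c) a 1)
  thin-chain {T} {E = E} g with y , b , Y , refl , refl , _ ← Tame→Ix T g =
    Chains-map jumps (hooks {S} {T} 1 b (Ix.steps A) (Ix.steps Y) refl (cell {S} {T}))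
    where
    free : ∀ {p q} → Cell {S} {T} a 1 y b Anywhere p → Cell {S} {T} a 1 y b Anywhere q → Space._↝_ (S ⊗ T) p q →
      p ≡ q ⊎ Snd {T} E p q
    free (i , j , refl , i≤1 , j≤b , _) (k , l , refl , k≤1 , l≤b , _) (J , J′)
      with refl ← Ix-free S A i≤1 k≤1 J | Ix.jump Y j l j≤b l≤b J′
    ... | inj₁ refl = inj₁ refl
    ... | inj₂ ((refl , refl) , e) = inj₂ e
    jumps : ∀ {c} → SymAll (S ⊗ T) _ (Cell {S} {T} a 1 y b Anywhere) c → Jumping (S ⊗ T) _ (Snd {T} E) c
    jumps (symAll run bal all) = jumping run bal λ p∈ q∈ → free (All.lookup all p∈) (All.lookup all q∈)

  Morph-D₂ : Morph D₂ S 1 (total S a 1) (None D₂) (None S) (a ∘ toℕ)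
  Morph-D₂ = record
    { shift   = m.shift ; rank = m.rank ; mono = m.mono ; total′ = m.total′ ; ends = λ ()
    ; reflect = λ {p} {q} J → F.toℕ-injective (Ix-free S A (F.toℕ≤pred[n] p) (F.toℕ≤pred[n] q) J)
    }
    where module m = Morph (Ix→Morph A refl)

  Morph-None : ∀ {T U N N′ E E′ h} → Morph T U N N′ E E′ h → Morph T U N N′ (None T) (None U) h
  Morph-None m = record
    { shift = m.shift ; rank = m.rank ; mono = m.mono ; reflect = m.reflect ; total′ = m.total′ ; ends = λ () }
    where module m = Morph m

  thin-cube : ∀ {T N E φ} → Morph (I₃ ⊗ (I₃ ⊗ I₃)) T 6 N (E₃ ⊠ (E₃ ⊠ E₃)) E φ →
    Chains (Tame (S ⊗ T) (total S a 1 + N) (None (S ⊗ T))) (row-times {S} {T} (λ F → mass (F ∘ φ) cubeCells) a 1)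
  thin-cube {φ = φ} Φ = conv (λ F → mass-cart (λ (i , q) → F (a (toℕ i) , φ q)) (fins 2) cubeCells)
    (Chains-Tame-map (Morph-None (Morph-D₂ ⊗ᵐ Φ)) thin-cube-table)

  -- A square can now be split completely, since its centre times a pair is a two-element chain
  -- without jumps. Splitting a cube in the same way would multiply that centre by the third side
  -- and create a jump that moves a single coordinate, so cubes rely on the table.
  thin-piece : ∀ {T N E M} → Piece ⊤ T N E M →
    Chains (Jumping (S ⊗ T) (total S a 1 + N) (Snd {T} E)) (row-times {S} {T} M a 1)
  thin-piece (chain g) = thin-chain (Tame₂.isTame g)
  thin-piece {T} (square {φ} Φ) = conv
    (λ F → mass-cong (λ p → sym (mass-cart (λ q → F (p , φ q)) (fins 3) (fins 3))) (seg a 1))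
    (Sum-times (seg a 1) (λ { (one g) → thin-chain g }) (Chains-Tame-map Φ (swapped Ix-ι Ix-ι refl)))
  thin-piece {T} (cube _ Φ) = Chains-map (Jumping-map (λ _ _ ()) ∘ Tame⇒Jumping) (thin-cube Φ)

-- Exchange between the longest chain and a second one, both multiplied by a pair

Ranked : Space → Set
Ranked S = ∀ {p q} → p ↝ q → rk p ≤ rk q
  where open Space S

Ranked-⊗ : ∀ {S T} → Ranked S → Ranked T → Ranked (S ⊗ T)
Ranked-⊗ r r′ (J , J′) = +-mono-≤ (r J) (r′ J′)

-- `w` may jump from its first to its last element, and the hook of the pair and `w` would contain
-- this jump at `a 0`. The ends of `v` lie one step inside those of `w`, so the two hooks can swap
-- ends: the row of `w` at `a 0` loses its first element, and `(a 0 , w 0)` and `(a 1 , w (2 + m))`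
-- come to lie in one chain but over different elements of the pair. `avoid` excludes new jumps
-- between the ends of `w` and `v`.
module Exchange {S T : Space} (ranked : Ranked T) {a : ℕ → Carrier S} (A : Ix S (None S) a 1)
  {w v : ℕ → Carrier T} {m n N E} (W : Ix T E w (2 + m)) (V : Ix T (None T) v (2 + n))
  (tw : total T w (2 + m) ≡ N) (tv : total T v (2 + n) ≡ N)
  (below : Space._⋖_ T (w 0) (v 0)) (above : Space._⋖_ T (v (2 + n)) (w (2 + m)))
  (avoid : ∀ j → j ≤ 2 + n → ¬ Space._↝_ T (w 0) (v j) × ¬ Space._↝_ T (v j) (w (2 + m)))
  where
  open Space (S ⊗ T) hiding (Carrier)
  private
    module S = Space S
    module T = Space T
    s = Ix.steps A 0 (s≤s z≤n)

  -- The hooks starting at (a 0 , w 0) and (a 0 , v 0), with first and last elements exchanged.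
  long short : List (Carrier S × Carrier T)
  long  = (a 0 , w 0) ∷ (hook a 1 v (2 + n) ++ ((a 1 , w (2 + m)) ∷ []))
  short = hook (λ _ → a 0) 0 (w ∘ suc) (1 + m)

  rk-a : S.rk (a 1) ≡ suc (S.rk (a 0))
  rk-a = proj₂ s

  private
    data InLong : Carrier S × Carrier T → Set where
      start  : InLong (a 0 , w 0)
      end    : InLong (a 1 , w (2 + m))
      middle : ∀ i j → i ≤ 1 → j ≤ 2 + n → InLong (a i , v j)

    all : All InLong long
    all = start ∷ All.++⁺ (All-hook a v 1 (2 + n) (λ j → middle 0 j z≤n) (λ i i≤1 → middle i (2 + n) i≤1 ≤-refl))
      (end ∷ [])

    a₀≢a₁ : ¬ a 0 S.↝ a 1
    a₀≢a₁ J with () ← Ix-free S A z≤n ≤-refl J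

    a₁≢a₀ : ¬ a 1 S.↝ a 0
    a₁≢a₀ J with () ← Ix-free S A ≤-refl z≤n J

    free : ∀ {p q} → InLong p → InLong q → p ↝ q → p ≡ q
    free start start J = refl
    free start end   (J , _) = ⊥-elim (a₀≢a₁ J)
    free end   start (J , _) = ⊥-elim (a₁≢a₀ J)
    free end   end   J = refl
    free start (middle _ j _ j≤) (_ , J) = ⊥-elim (proj₁ (avoid j j≤) J)
    free (middle _ j _ j≤) end   (_ , J) = ⊥-elim (proj₂ (avoid j j≤) J)
    -- `avoid` speaks of jumps upwards only; one back to `w 0` would lower the rank.
    free (middle _ j _ j≤) start (_ , J) = ⊥-elim (<⇒≱ (begin-strict
      T.rk (w 0)         <⟨ ≤-reflexive (sym (proj₂ below)) ⟩
      T.rk (v 0)         ≤⟨ m≤n+m _ j ⟩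
      j + T.rk (v 0)     ≡⟨ Steps-rk T (Ix.steps V) j j≤ ⟨
      T.rk (v j)         ∎) (ranked J))
      where open ≤-Reasoning
    free end (middle _ j _ j≤) (_ , J) = ⊥-elim (<⇒≱ (begin-strict
      T.rk (v j)              ≡⟨ Steps-rk T (Ix.steps V) j j≤ ⟩
      j + T.rk (v 0)          ≤⟨ +-monoˡ-≤ _ j≤ ⟩
      2 + n + T.rk (v 0)      ≡⟨ Steps-rk T (Ix.steps V) (2 + n) ≤-refl ⟨
      T.rk (v (2 + n))        <⟨ ≤-reflexive (sym (proj₂ above)) ⟩
      T.rk (w (2 + m))        ∎) (ranked J))
      where open ≤-Reasoning
    free (middle i j i≤ j≤) (middle k l k≤ l≤) (J , J′)
      with refl ← Ix-free S A i≤ k≤ J | refl ← Ix-free T V j≤ l≤ J′ = refl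

    run : Run (a 0 , w 0) long (a 1 , w (2 + m))
    run = ⋖ʳ {S} {T} below ∷ Run-++ (Run-hook {S} {T} 1 (2 + n) (Ix.steps A) (Ix.steps V)) (⋖ʳ {S} {T} above) [ _ ]

  Tame-long : Tame (S ⊗ T) (total S a 1 + N) (None (S ⊗ T)) long
  Tame-long = tame run (total-⊗ {S} {T} a w 1 (2 + m) (cong (total S a 1 +_) tw))
    λ p∈ q∈ J → inj₁ (free (All.lookup all p∈) (All.lookup all q∈) J)

  private
    Tame-row-free : ∀ p {y b} → Ix T (None T) y b → S.rk p + S.rk p + total T y b ≡ total S a 1 + N →
      Tame (S ⊗ T) (total S a 1 + N) (None (S ⊗ T)) (hook (λ _ → p) 0 y b)
    Tame-row-free p {y} {b} Y e = Tame-free {S} {T} (Ix-single S p) Y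
      (SymAll-hook {S} {T} 0 b (λ _ ()) (Ix.steps Y) e (cell {S} {T}))

  Tame-short : Tame (S ⊗ T) (total S a 1 + N) (None (S ⊗ T)) short
  Tame-short = Tame-row-free (a 0) (Ix-tail T W) (begin
    S.rk (a 0) + S.rk (a 0) + total T (w ∘ suc) (1 + m)
      ≡⟨ cong (S.rk (a 0) + S.rk (a 0) +_) (trans (total-tail T (Ix.steps W)) (cong suc tw)) ⟩
    S.rk (a 0) + S.rk (a 0) + suc N                          ≡⟨ shift-suc (S.rk (a 0)) N ⟩
    S.rk (a 0) + suc (S.rk (a 0)) + N                        ≡⟨ cong (λ r → S.rk (a 0) + r + N) rk-a ⟨
    total S a 1 + N                                          ∎)
    where
    open ≡-Reasoning
    shift-suc : ∀ r n → r + r + suc n ≡ r + suc r + n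
    shift-suc = solve-∀

  -- Serves the rows at `a 1` of `w` and `v`, each without its last element, which belongs to a
  -- hook. That loss of one rank balances the gain from `a 1` over `a 0`.
  Tame-upper : ∀ {y b} → Ix T (None T) y b → suc (total T y b) ≡ N →
    Tame (S ⊗ T) (total S a 1 + N) (None (S ⊗ T)) (hook (λ _ → a 1) 0 y b)
  Tame-upper {y} {b} Y refl = Tame-row-free (a 1) Y (begin
    S.rk (a 1) + S.rk (a 1) + total T y b                    ≡⟨ cong (λ r → r + S.rk (a 1) + total T y b) rk-a ⟩
    suc (S.rk (a 0)) + S.rk (a 1) + total T y b
      ≡⟨ shift-suc (S.rk (a 0)) (S.rk (a 1)) (total T y b) ⟩
    total S a 1 + suc (total T y b)                          ∎)
    where
    open ≡-Reasoning
    shift-suc : ∀ r q n → suc r + q + n ≡ r + q + suc n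
    shift-suc = solve-∀

  exchanged : Chains (Tame (S ⊗ T) (total S a 1 + N) (None (S ⊗ T)))
    (row-times {S} {T} (λ F → mass F (seg w (2 + m)) + mass F (seg v (2 + n))) a 1)
  exchanged = conv masses (atom (one Tame-long) ⊕ (atom (one Tame-short) ⊕
    (atom (one (Tame-upper (Ix-init T W) (trans (sym (total-init T (Ix.steps W))) tw))) ⊕
     atom (one (Tame-upper (Ix-init T V) (trans (sym (total-init T (Ix.steps V))) tv))))))
    where
    masses : ∀ F → mass F long + (mass F short + (mass F (hook (λ _ → a 1) 0 w (1 + m)) + mass F (hook (λ _ → a 1) 0 v (1 + n))))
      ≡ row-times {S} {T} (λ G → mass G (seg w (2 + m)) + mass G (seg v (2 + n))) a 1 F
    masses F = begin
      F₀ (w 0) + mass F (hook a 1 v (2 + n) ++ ((a 1 , w (2 + m)) ∷ [])) +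
        (mass F short + (mass F (hook (λ _ → a 1) 0 w (1 + m)) + mass F (hook (λ _ → a 1) 0 v (1 + n))))
        ≡⟨ cong₂ (λ p q → F₀ (w 0) + p + q) (trans (mass-++ F (hook a 1 v (2 + n)) _)
             (cong (_+ (F₁ (w (2 + m)) + 0)) (mass-hook-suc a v F 0 (2 + n))))
             (cong₂ _+_ (mass-seg F (a 0 ,_) (w ∘ suc) (1 + m))
               (cong₂ _+_ (mass-seg F (a 1 ,_) w (1 + m)) (mass-seg F (a 1 ,_) v (1 + n)))) ⟩
      F₀ (w 0) + (mass F₀ (seg v (2 + n)) + (F₁ (v (2 + n)) + 0) + (F₁ (w (2 + m)) + 0)) +
        (mass F₀ (seg (w ∘ suc) (1 + m)) + (mass F₁ (seg w (1 + m)) + mass F₁ (seg v (1 + n))))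
        ≡⟨ rearrange (F₀ (w 0)) (mass F₀ (seg v (2 + n))) (F₁ (v (2 + n))) (F₁ (w (2 + m)))
             (mass F₀ (seg (w ∘ suc) (1 + m))) (mass F₁ (seg w (1 + m))) (mass F₁ (seg v (1 + n))) ⟩
      (F₀ (w 0) + mass F₀ (seg (w ∘ suc) (1 + m)) + mass F₀ (seg v (2 + n))) +
        ((mass F₁ (seg w (1 + m)) + F₁ (w (2 + m)) + (mass F₁ (seg v (1 + n)) + F₁ (v (2 + n)))) + 0)
        ≡⟨ cong₂ (λ p q → (mass F₀ (seg w (2 + m)) + mass F₀ (seg v (2 + n))) + ((p + q) + 0))
             (mass-seg-last F₁ w (1 + m)) (mass-seg-last F₁ v (1 + n)) ⟨
      row-times {S} {T} (λ G → mass G (seg w (2 + m)) + mass G (seg v (2 + n))) a 1 F ∎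
      where
      open ≡-Reasoning
      F₀ F₁ : Carrier T → ℕ
      F₀ q = F (a 0 , q)
      F₁ q = F (a 1 , q)
      rearrange : ∀ a b c d e f g →
        a + (b + (c + 0) + (d + 0)) + (e + (f + g)) ≡ (a + e + b) + ((f + d + (g + c)) + 0)
      rearrange = solve-∀

-- Supplies the partner for the exchange. With `g` and `h` the chains `Z₁` and `Z₂` of C × D, the
-- longest chain `w` is `Z₁` of B × `g` and its partner `v` is `Z₁` of B × `h`. The other chains
-- come from `Z₂` or from remaining grids and have no jump. One factor, here C, must have at least
-- five elements: with three, the column of `v` would run through the corner `(c 0 , d δ)` of C × D.
module Crossed {S T U V : Space} (rankedT : Ranked T) (rankedU : Ranked U) (rankedV : Ranked V)
  {a : ℕ → Carrier S} {b : ℕ → Carrier T} {c : ℕ → Carrier U} {d : ℕ → Carrier V} {E E′ E″} (i j k : ℕ)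
  (A : Ix S (None S) a 1) (B : Ix T E b (2 + dbl i)) (C : Ix U E′ c (4 + dbl j)) (D : Ix V E″ d (2 + dbl k))
  where
  private
    module T = Space T
    module U = Space U
    module V = Space V
    module UV = Space (U ⊗ V)
    module R = Space (T ⊗ (U ⊗ V))
    β = 2 + dbl i
    γ = 4 + dbl j
    δ = 2 + dbl k
    N₂ = total U c γ + total V d δ
    N₃ = total T b β + N₂
    open Thin {S} A

  -- Being a predicate on masses of B × C × D, it can be the `P` of `Sum`: the parts are assembled
  -- there, and the factor A is multiplied in at the end.
  record Atom (M : Mass (Carrier (T ⊗ (U ⊗ V)))) : Set where
    constructor ⟨_⟩
    field
      chains : Chains (Tame (S ⊗ (T ⊗ (U ⊗ V))) (total S a 1 + N₃) (None (S ⊗ (T ⊗ (U ⊗ V)))))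
        (row-times {S} {T ⊗ (U ⊗ V)} M a 1)

  free-chain : ∀ {l} → Tame (T ⊗ (U ⊗ V)) N₃ (None (T ⊗ (U ⊗ V))) l → Atom (λ F → mass F l)
  free-chain g = ⟨ Chains-map Jumping⇒Tame (thin-chain g) ⟩

  free-piece : ∀ {M} → Piece ⊤ (T ⊗ (U ⊗ V)) N₃ (None (T ⊗ (U ⊗ V))) M → Atom M
  free-piece p = ⟨ Chains-map Jumping⇒Tame (thin-piece p) ⟩

  -- A jump from the bottom corner or to the top corner of C × D has a corner at its other end too,
  -- and `Z₂` lacks both `d 0` and `c γ`, which leaves one corner.
  corner : ∀ {p} → p ∈ Z₂ c (2 + dbl j) d (dbl k) →
    (c 0 , d 0) UV.↝ p ⊎ p UV.↝ (c γ , d δ) → p ≡ (c 0 , d δ)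
  corner p∈ = at (All.lookup all p∈)
    where
    Inner : Carrier U × Carrier V → Set
    Inner p = ∃[ s ] ∃[ u ] p ≡ (c s , d (suc u)) × s ≤ 3 + dbl j × u ≤ 1 + dbl k
    all : All Inner (Z₂ c (2 + dbl j) d (dbl k))
    all = All-hook c (d ∘ suc) (3 + dbl j) (1 + dbl k) (λ u u≤ → 0 , u , refl , z≤n , u≤)
      (λ s s≤ → s , 1 + dbl k , refl , s≤ , ≤-refl)
    at : ∀ {p} → Inner p → (c 0 , d 0) UV.↝ p ⊎ p UV.↝ (c γ , d δ) → p ≡ (c 0 , d δ)
    at (s , u , refl , s≤ , u≤) (inj₁ (J , J′))
      with Ix.jump C 0 s z≤n (m≤n⇒m≤1+n s≤) J | Ix.jump D 0 (suc u) z≤n (s≤s u≤) J′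
    ... | inj₁ refl | inj₂ ((_ , refl) , _) = refl
    ... | inj₂ ((_ , refl) , _) | _ = ⊥-elim (1+n≰n s≤)
    at (s , u , refl , s≤ , u≤) (inj₂ (J , J′))
      with Ix.jump C s γ (m≤n⇒m≤1+n s≤) ≤-refl J | Ix.jump D (suc u) δ (s≤s u≤) ≤-refl J′
    ... | inj₂ ((refl , _) , _) | inj₁ refl = refl
    ... | inj₁ refl | _ = ⊥-elim (1+n≰n s≤)

  module _ {g lg h lh} (G : Ix (U ⊗ V) (E′ ⊠ E″) g (2 + lg)) (H : Ix (U ⊗ V) (None (U ⊗ V)) h (2 + lh))
    (tg : total (U ⊗ V) g (2 + lg) ≡ N₂) (th : total (U ⊗ V) h (2 + lh) ≡ N₂)
    (g≡ : seg g (2 + lg) ≡ Z₁ c (2 + dbl j) d (dbl k)) (h≡ : seg h (2 + lh) ≡ Z₂ c (2 + dbl j) d (dbl k))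
    (h₀ : h 0 ≡ (c 0 , d 1)) (h₁ : h (2 + lh) ≡ (c (3 + dbl j) , d δ))
    where

    -- The length of `h` was hidden when it was indexed; it is recovered from the ranks of its ends.
    lh≡ : lh ≡ 2 + dbl j + dbl k
    lh≡ = +-cancelʳ-≡ (2 + UV.rk (c 0 , d 1)) lh (2 + dbl j + dbl k) (begin
      lh + (2 + UV.rk (c 0 , d 1))
        ≡⟨ trans (sym (+-assoc lh 2 _)) (cong (_+ UV.rk (c 0 , d 1)) (+-comm lh 2)) ⟩
      2 + lh + UV.rk (c 0 , d 1)                   ≡⟨ cong (λ p → 2 + lh + UV.rk p) h₀ ⟨
      2 + lh + UV.rk (h 0)                         ≡⟨ Steps-rk (U ⊗ V) (Ix.steps H) (2 + lh) ≤-refl ⟨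
      UV.rk (h (2 + lh))                           ≡⟨ cong UV.rk h₁ ⟩
      U.rk (c (3 + dbl j)) + V.rk (d δ)
        ≡⟨ cong₂ _+_ (Steps-rk U (Ix.steps C) (3 + dbl j) (n≤1+n _)) (Steps-rk V (Ix.steps D) δ ≤-refl) ⟩
      3 + dbl j + U.rk (c 0) + (2 + dbl k + V.rk (d 0)) ≡⟨ rearrange (dbl j) (U.rk (c 0)) (dbl k) (V.rk (d 0)) ⟩
      2 + dbl j + dbl k + (2 + (U.rk (c 0) + suc (V.rk (d 0))))
        ≡⟨ cong (λ r → 2 + dbl j + dbl k + (2 + (U.rk (c 0) + r))) (proj₂ (Ix.steps D 0 (s≤s z≤n))) ⟨
      2 + dbl j + dbl k + (2 + UV.rk (c 0 , d 1))  ∎)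
      where
      open ≡-Reasoning
      rearrange : ∀ j u k v → 3 + j + u + (2 + k + v) ≡ 2 + j + k + (2 + (u + suc v))
      rearrange = solve-∀

    -- As γ ≥ 4, this index is neither 0 nor one of the last two, so Z₁ of b and h passes it only in the row of b 1.
    corner-index : ∀ t → t ≤ 2 + lh → (c 0 , d 0) UV.↝ h t ⊎ h t UV.↝ (c γ , d δ) → t ≡ 1 + dbl k
    corner-index t t≤ J = +-cancelʳ-≡ (suc r) t (1 + dbl k) (begin
      t + suc r
        ≡⟨ cong (t +_) (trans (cong UV.rk h₀) (trans (cong (U.rk (c 0) +_) (proj₂ (Ix.steps D 0 (s≤s z≤n)))) (+-suc _ _))) ⟨
      t + UV.rk (h 0)                  ≡⟨ Steps-rk (U ⊗ V) (Ix.steps H) t t≤ ⟨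
      UV.rk (h t)                      ≡⟨ cong UV.rk (corner (subst (h t ∈_) h≡ (∈-seg⁺ h (2 + lh) t t≤)) J) ⟩
      U.rk (c 0) + V.rk (d δ)          ≡⟨ cong (U.rk (c 0) +_) (Steps-rk V (Ix.steps D) δ ≤-refl) ⟩
      U.rk (c 0) + (δ + V.rk (d 0))    ≡⟨ rearrange (U.rk (c 0)) (dbl k) (V.rk (d 0)) ⟩
      1 + dbl k + suc r                ∎)
      where
      open ≡-Reasoning
      r = U.rk (c 0) + V.rk (d 0)
      rearrange : ∀ u k v → u + (2 + k + v) ≡ 1 + k + suc (u + v)
      rearrange = solve-∀

    Avoids : Carrier (T ⊗ (U ⊗ V)) → Set
    Avoids p = ¬ (b 0 , (c 0 , d 0)) R.↝ p × ¬ p R.↝ (b β , (c γ , d δ))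

    avoids-row : ∀ i t → t ≤ 2 + lh → ¬ t ≡ 1 + dbl k → Avoids (b i , h t)
    avoids-row i t t≤ ≢ = (λ (_ , J) → ≢ (corner-index t t≤ (inj₁ J))) , (λ (_ , J) → ≢ (corner-index t t≤ (inj₂ J)))

    -- `b 1` is neither end of B, so the first coordinate alone forbids a jump, even where `h`
    -- passes the corner.
    avoids-first : ∀ t → Avoids (b 1 , h t)
    avoids-first t = (λ (J , _) → up (Ix.jump B 0 1 z≤n (s≤s z≤n) J)) , (λ (J , _) → down (Ix.jump B 1 β (s≤s z≤n) ≤-refl J))
      where
      up : ∀ {P : Set} → 0 ≡ 1 ⊎ ((0 ≡ 0 × 1 ≡ β) × P) → ⊥
      up (inj₂ ((_ , ()) , _))
      down : ∀ {P : Set} → 1 ≡ β ⊎ ((1 ≡ 0 × β ≡ β) × P) → ⊥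
      down (inj₂ ((() , _) , _))

    avoids : All Avoids (Z₁ b (dbl i) h lh)
    avoids = avoids-row 0 0 z≤n (λ ()) ∷ All.++⁺
      (All-hook (b ∘ suc) h (1 + dbl i) (1 + lh) (λ t _ → avoids-first t)
        (λ s _ → avoids-row (suc s) (1 + lh) (n≤1+n _) (≢k 2 ∘ suc-injective)))
      (avoids-row β (2 + lh) ≤-refl (≢k 3 ∘ suc-injective) ∷ [])
      where
      -- Used with `e` equal to 2 and 3: the indices `1 + lh` and `2 + lh` differ from `1 + dbl k`,
      -- after cancelling a successor.
      ≢k : ∀ e → ¬ (e ∸ 2) + lh ≡ dbl k
      ≢k e eq = <⇒≢ (≤-trans (s≤s (≤-trans (m≤n+m (dbl k) (1 + dbl j)) (≤-reflexive refl)))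
        (≤-trans (≤-reflexive (sym lh≡)) (m≤n+m lh (e ∸ 2)))) (sym eq)

    module _ {w m v n} (W : Ix (T ⊗ (U ⊗ V)) (E ⊠ (E′ ⊠ E″)) w (2 + m))
      (V′ : Ix (T ⊗ (U ⊗ V)) (None (T ⊗ (U ⊗ V))) v (2 + n))
      (tw : total (T ⊗ (U ⊗ V)) w (2 + m) ≡ N₃) (tv : total (T ⊗ (U ⊗ V)) v (2 + n) ≡ N₃)
      (w≡ : seg w (2 + m) ≡ Z₁ b (dbl i) g lg) (v≡ : seg v (2 + n) ≡ Z₁ b (dbl i) h lh)
      (w₀ : w 0 ≡ (b 0 , (c 0 , d 0))) (w₁ : w (2 + m) ≡ (b β , (c γ , d δ)))
      (v₀ : v 0 ≡ (b 0 , (c 0 , d 1))) (v₁ : v (2 + n) ≡ (b β , (c (3 + dbl j) , d δ)))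
      where

      exchange : Atom (λ F → mass F (seg w (2 + m)) + mass F (seg v (2 + n)))
      exchange = ⟨ Exchange.exchanged {S} {T ⊗ (U ⊗ V)} (Ranked-⊗ {T} {U ⊗ V} rankedT (Ranked-⊗ {U} {V} rankedU rankedV)) A W V′ tw tv
        (subst₂ R._⋖_ (sym w₀) (sym v₀) (⋖ʳ {T} {U ⊗ V} (⋖ʳ {U} {V} (Ix.steps D 0 (s≤s z≤n)))))
        (subst₂ R._⋖_ (sym v₁) (sym w₁) (⋖ʳ {T} {U ⊗ V} (⋖ˡ {U} {V} (Ix.steps C (3 + dbl j) ≤-refl))))
        (λ t t≤ → subst₂ (λ p q → ¬ p R.↝ v t × ¬ v t R.↝ q) (sym w₀) (sym w₁)
          (All.lookup avoids (subst (v t ∈_) v≡ (∈-seg⁺ v (2 + n) t t≤)))) ⟩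

      assembled : Atom (row-times {T} {U ⊗ V} (grid c γ d δ) b β)
      assembled = ⟨ Sum-times (seg a 1) Atom.chains (conv masses (atom exchange ⊕
        ((atom (free-chain (Tame₂.isTame (Tame-Z₂ {T} {U ⊗ V} B G eG))) ⊕
          Sum-map (λ { (one q) → free-chain q })
            (hooks-free {T} {U ⊗ V} (dbl i) lg
              (rest-Ixˡ {T} {U ⊗ V} B G eG) (rest-Ixʳ {T} {U ⊗ V} B G eG) (rest-total {T} {U ⊗ V} B G eG))) ⊕
         ((atom (free-chain (Tame₂.isTame (Tame-Z₂ {T} {U ⊗ V} B H eH))) ⊕
           Sum-map (λ { (one q) → free-chain q })
             (hooks-free {T} {U ⊗ V} (dbl i) lh
               (rest-Ixˡ {T} {U ⊗ V} B H eH) (rest-Ixʳ {T} {U ⊗ V} B H eH) (rest-total {T} {U ⊗ V} B H eH))) ⊕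
          -- The rest of C × D carries `None`; whatever B contributes, the product relation is then
          -- empty as well.
          Sum-map free-piece (Pieces-map (Morph-relax proj₂)
            (Sum-times (seg b β)
              (times-piece (suc i) (2 + j + U.rk (c 0) + (1 + k + V.rk (d 0))) B (λ ()) even)
              (peel (even-Shape (suc j) k (s≤s z≤n))
                (rest-Ixˡ {U} {V} C D refl) (rest-Ixʳ {U} {V} C D refl) (rest-total {U} {V} C D refl)))))))) ⟩
        where
        eG : total T b β + total (U ⊗ V) g (2 + lg) ≡ N₃
        eG = cong (total T b β +_) tg
        eH : total T b β + total (U ⊗ V) h (2 + lh) ≡ N₃
        eH = cong (total T b β +_) th
        even : N₂ ≡ dbl (2 + j + U.rk (c 0) + (1 + k + V.rk (d 0)))
        even = trans (cong₂ _+_ (total-even {U} (2 + j) (Ix.steps C)) (total-even {V} (1 + k) (Ix.steps D)))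
          (dbl-+ (2 + j + U.rk (c 0)) (1 + k + V.rk (d 0)))
        masses : ∀ F → mass F (seg w (2 + m)) + mass F (seg v (2 + n)) +
          ((mass F (Z₂ b (dbl i) g lg) + grid (b ∘ suc ∘ suc) (dbl i) g lg F) +
           ((mass F (Z₂ b (dbl i) h lh) + grid (b ∘ suc ∘ suc) (dbl i) h lh F) +
            row-times {T} {U ⊗ V} (grid (c ∘ suc ∘ suc) (2 + dbl j) d (dbl k)) b β F))
          ≡ row-times {T} {U ⊗ V} (grid c γ d δ) b β F
        masses F = begin
          _
            ≡⟨ cong₂ (λ l l′ → mass F l + mass F l′ + ((z + r) + ((z′ + r′) + q))) w≡ v≡ ⟩
          x + x′ + ((z + r) + ((z′ + r′) + q))
            ≡⟨ rearrange x x′ (z + r) (z′ + r′) q ⟩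
          (x + (z + r)) + ((x′ + (z′ + r′)) + q)
            ≡⟨ cong₂ (λ p p′ → p + (p′ + q)) (mass-Z b g F (dbl i) lg) (mass-Z b h F (dbl i) lh) ⟩
          grid b β g (2 + lg) F + (grid b β h (2 + lh) F + q)
            ≡⟨ cong (grid b β g (2 + lg) F +_) (mass-+ (λ p → mass (λ s → F (p , s)) (seg h (2 + lh))) rest (seg b β)) ⟨
          grid b β g (2 + lg) F + mass (λ p → mass (λ s → F (p , s)) (seg h (2 + lh)) + rest p) (seg b β)
            ≡⟨ mass-+ (λ p → mass (λ s → F (p , s)) (seg g (2 + lg))) (λ p → mass (λ s → F (p , s)) (seg h (2 + lh)) + rest p) (seg b β) ⟨
          mass (λ p → mass (λ s → F (p , s)) (seg g (2 + lg)) + (mass (λ s → F (p , s)) (seg h (2 + lh)) + rest p)) (seg b β)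
            ≡⟨ mass-cong (λ p → trans
                 (cong₂ (λ l l′ → mass (λ s → F (p , s)) l + (mass (λ s → F (p , s)) l′ + rest p)) g≡ h≡)
                 (mass-Z c d (λ s → F (p , s)) (2 + dbl j) (dbl k))) (seg b β) ⟩
          row-times {T} {U ⊗ V} (grid c γ d δ) b β F ∎
          where
          open ≡-Reasoning
          rest : Carrier T → ℕ
          rest p = grid (c ∘ suc ∘ suc) (2 + dbl j) d (dbl k) (λ s → F (p , s))
          x = mass F (Z₁ b (dbl i) g lg)
          x′ = mass F (Z₁ b (dbl i) h lh)
          z = mass F (Z₂ b (dbl i) g lg)
          z′ = mass F (Z₂ b (dbl i) h lh)
          r = grid (b ∘ suc ∘ suc) (dbl i) g lg F
          r′ = grid (b ∘ suc ∘ suc) (dbl i) h lh F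
          q = row-times {T} {U ⊗ V} (grid (c ∘ suc ∘ suc) (2 + dbl j) d (dbl k)) b β F
          rearrange : ∀ x x′ y y′ q → x + x′ + (y + (y′ + q)) ≡ (x + y) + ((x′ + y′) + q)
          rearrange = solve-∀

  crossed : Atom (row-times {T} {U ⊗ V} (grid c γ d δ) b β)
  crossed
    with g , lg , G , tg , g≡ , g₀ , g₁ ← Tame₂→Ix _ (Tame-Z₁ {U} {V} C D refl)
       | h , lh , H , th , h≡ , h₀ , h₁ ← Tame₂→Ix _ (Tame-Z₂ {U} {V} C D refl)
    with w , m , W , tw , w≡ , w₀ , w₁ ← Tame₂→Ix _ (Tame-Z₁ {T} {U ⊗ V} B G (cong (total T b β +_) tg))
       | v , n , V′ , tv , v≡ , v₀ , v₁ ← Tame₂→Ix (T ⊗ (U ⊗ V)) {E = None (T ⊗ (U ⊗ V))}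
           (Tame₂-relax proj₂ (Tame-Z₁ {T} {U ⊗ V} B H (cong (total T b β +_) th))) =
    assembled G H tg th g≡ h≡ h₀ h₁ W V′ tw tv w≡ v≡
      (trans w₀ (cong (b 0 ,_) g₀)) (trans w₁ (cong (b β ,_) g₁))
      (trans v₀ (cong (b 0 ,_) h₀)) (trans v₁ (cong (b β ,_) h₁))

-- Decomposition of cuboids by the sizes of their sides

Morph-swap : ∀ {S T N M E D} → Morph (S ⊗ T) (T ⊗ S) (N + M) (M + N) (E ⊠ D) (D ⊠ E) (λ (p , q) → q , p)
Morph-swap {S} {T} {N} {M} = record
  { shift   = 0
  ; rank    = λ (p , q) → +-comm (Space.rk T q) (Space.rk S p)
  ; mono    = λ (l , l′) → l′ , l
  ; reflect = λ (J , J′) → J′ , J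
  ; total′  = +-comm N M
  ; ends    = λ (e , e′) _ → e′ , e
  }

Morph-exchange : ∀ {S T U N M L E D C} →
  Morph (S ⊗ (T ⊗ U)) (T ⊗ (S ⊗ U)) (N + (M + L)) (M + (N + L)) (E ⊠ (D ⊠ C)) (D ⊠ (E ⊠ C))
    (λ (p , q , r) → q , p , r)
Morph-exchange {S} {T} {U} {N} {M} {L} = record
  { shift   = 0
  ; rank    = λ (p , q , r) → x∙yz≈y∙xz (Space.rk T q) (Space.rk S p) (Space.rk U r)
  ; mono    = λ (l , l′ , l″) → l′ , l , l″
  ; reflect = λ (J , J′ , J″) → J′ , J , J″
  ; total′  = x∙yz≈y∙xz N M L
  ; ends    = λ (e , e′ , e″) _ → e′ , e , e″
  }

-- The last two factors are decomposed before `x` is multiplied in, unless both are points: a point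
-- is not a piece, so it then acts as a one-element second factor of `pieces₂`.
pieces₃ : ∀ {S T U} i j k {x y z E D C} → 0 < i + (j + k) →
  Ix S E x (dbl i) → Ix T D y (dbl j) → Ix U C z (dbl k) →
  (i ≡ 0 → E (x 0) (x 0)) → (j ≡ 0 → D (y 0) (y 0)) → (k ≡ 0 → C (z 0) (z 0)) →
  Pieces ⊤ (S ⊗ (T ⊗ U)) (total S x (dbl i) + (total T y (dbl j) + total U z (dbl k))) (E ⊠ (D ⊠ C))
    (row-times {S} {T ⊗ U} (grid y (dbl j) z (dbl k)) x (dbl i))
pieces₃ {S} {T} {U} (suc i) zero zero {x} {y} {z} pos X Y Z e d c = conv
  (λ F → mass-cong (λ p → sym (+-identityʳ (F (p , y 0 , z 0) + 0))) (seg x (dbl (suc i))))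
  (pieces₂ {⊤} {S} {T ⊗ U} (suc i) 0 (s≤s z≤n) X (Ix-single (T ⊗ U) (y 0 , z 0)) (λ ()) (λ _ → d refl , c refl)
    (cong (total S x (dbl (suc i)) +_) (total-⊗ {T} {U} y z 0 0 refl)))
pieces₃ {S} {T} {U} i j@(suc j′) k {x} {y} {z} pos X Y Z e d c =
  Sum-times (seg x (dbl i)) (times-piece i h X e even) (pieces₂ j k (s≤s z≤n) Y Z d c refl)
  where
  h = j + Space.rk T (y 0) + (k + Space.rk U (z 0))
  even : total T y (dbl j) + total U z (dbl k) ≡ dbl h
  even = trans (cong₂ _+_ (total-even {T} j (Ix.steps Y)) (total-even {U} k (Ix.steps Z))) (dbl-+ (j + Space.rk T (y 0)) _)
pieces₃ {S} {T} {U} i zero k@(suc k′) {x} {y} {z} pos X Y Z e d c =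
  Sum-times (seg x (dbl i)) (times-piece i h X e even) (pieces₂ 0 k (s≤s z≤n) Y Z d c refl)
  where
  h = Space.rk T (y 0) + (k + Space.rk U (z 0))
  even : total T y 0 + total U z (dbl k) ≡ dbl h
  even = trans (cong₂ _+_ (total-even {T} 0 (Ix.steps Y)) (total-even {U} k (Ix.steps Z))) (dbl-+ (Space.rk T (y 0)) _)

module Cuboid {S T U V : Space} {x : ℕ → Carrier S} {b : ℕ → Carrier T} {c : ℕ → Carrier U} {d : ℕ → Carrier V}
  {E : Carrier S → Carrier S → Set} {D C B} (i j k : ℕ)
  (Y : Ix T D b (dbl i)) (Z : Ix U C c (dbl j)) (W : Ix V B d (dbl k))
  (dᵉ : i ≡ 0 → D (b 0) (b 0)) (cᵉ : j ≡ 0 → C (c 0) (c 0)) (bᵉ : k ≡ 0 → B (d 0) (d 0)) where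

  private
    R = T ⊗ (U ⊗ V)
    N = total T b (dbl i) + (total U c (dbl j) + total V d (dbl k))

  Trivial : Set
  Trivial = i ≡ 0 ⊎ j ≡ 0 ⊎ k ≡ 0

  Link : Carrier (S ⊗ R) → Carrier (S ⊗ R) → Set
  Link (p , r) (q , s) = (D ⊠ (C ⊠ B)) r s × (E p q ⊎ Trivial)

  all-cells : Mass (Carrier R)
  all-cells = row-times {T} {U ⊗ V} (grid c (dbl j) d (dbl k)) b (dbl i)

  Result : ℕ → Set
  Result a = Chains (Jumping (S ⊗ R) (total S x a + N) Link) (row-times {S} {R} all-cells x a)

  pad : ∀ n → n ≡ n + 0 + 0
  pad = solve-∀

  odd-cuboid : ∀ h → Ix S E x (3 + dbl h) → Result (3 + dbl h)
  odd-cuboid h X = Chains-map (Jumping-map link ∘ Tame⇒Jumping) (from-pieces i j k refl refl refl)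
    where
    a = 3 + dbl h
    link : ∀ p q → (E ⊠ (D ⊠ (C ⊠ B))) p q → Link p q
    link p q (e , d) = d , inj₁ e
    by-pieces : 0 < i + (j + k) → Chains (Tame (S ⊗ R) (total S x a + N) (E ⊠ (D ⊠ (C ⊠ B)))) (row-times {S} {R} all-cells x a)
    by-pieces pos = Sum-times (seg x a) (odd-times-piece h X) (pieces₃ i j k pos Y Z W dᵉ cᵉ bᵉ)
    from-pieces : ∀ i′ j′ k′ → i ≡ i′ → j ≡ j′ → k ≡ k′ →
      Chains (Tame (S ⊗ R) (total S x a + N) (E ⊠ (D ⊠ (C ⊠ B)))) (row-times {S} {R} all-cells x a)
    from-pieces (suc _) _       _       refl refl refl = by-pieces (s≤s z≤n)
    from-pieces zero    (suc _) _       refl refl refl = by-pieces (s≤s z≤n)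
    from-pieces zero    zero    (suc _) refl refl refl = by-pieces (s≤s z≤n)
    -- The cuboid is a copy of the chain `x`; its only possible jump is that of `x`, and the three
    -- points contribute their trivial ends.
    from-pieces zero    zero    zero    refl refl refl = conv
      (λ F → trans (mass-hook-col x (λ _ → b 0 , c 0 , d 0) F (2 + dbl h))
        (mass-cong (λ p → pad (F (p , b 0 , c 0 , d 0) + 0)) (seg x a)))
      (atom (one (Tame-column {S} {R} X (Ix-single R (b 0 , c 0 , d 0)) refl (dᵉ refl , cᵉ refl , bᵉ refl)
        (cong (total S x a +_) (trans (total-⊗ {T} {U ⊗ V} b (λ _ → c 0 , d 0) 0 0 refl)
          (cong (total T b 0 +_) (total-⊗ {U} {V} c d 0 0 refl)))))))

  module _ (X : Ix S (None S) x 1) where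
    open Thin {S} X

    trivial-cuboid : Trivial → 0 < i + (j + k) → Result 1
    trivial-cuboid t pos = Chains-map (Jumping-map λ _ _ d → d , inj₂ t)
      (Sum-times (seg x 1) thin-piece (pieces₃ i j k pos Y Z W dᵉ cᵉ bᵉ))

    single-cuboid : i ≡ 0 → j ≡ 0 → k ≡ 0 → Result 1
    single-cuboid refl refl refl = Chains-map (Jumping-map λ _ _ ()) (conv
      (λ F → mass-cong (λ p → pad (F (p , b 0 , c 0 , d 0) + 0)) (seg x 1))
      (thin-chain (tame {E = None R} Space.[ (b 0 , c 0 , d 0) ] (trans (total-⊗ {T} {U ⊗ V} b (λ _ → c 0 , d 0) 0 0 refl)
          (cong (total T b 0 +_) (total-⊗ {U} {V} c d 0 0 refl))) λ { (here refl) (here refl) _ → inj₁ refl })))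


module ThickCuboid {S T U V : Space} (rankedT : Ranked T) (rankedU : Ranked U) (rankedV : Ranked V)
  {x : ℕ → Carrier S} {b : ℕ → Carrier T} {c : ℕ → Carrier U} {d : ℕ → Carrier V}
  (X : Ix S (None S) x 1) where

  private
    R = T ⊗ (U ⊗ V)

  open Thin {S} X

  Free-chains : ℕ → ℕ → ℕ → Set
  Free-chains i j k = Chains (Tame (S ⊗ R) (total S x 1 + (total T b i + (total U c j + total V d k))) (None (S ⊗ R)))
    (row-times {S} {R} (row-times {T} {U ⊗ V} (grid c j d k) b i) x 1)

  -- `Crossed` asks for five elements in its second odd factor. A permutation of the factors brings
  -- a suitable one there; if all three have three elements, the cuboid is a pair times a cube.
  thick : ∀ i j k {D C B} → Ix T D b (dbl (suc i)) → Ix U C c (dbl (suc j)) → Ix V B d (dbl (suc k)) →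
    Free-chains (dbl (suc i)) (dbl (suc j)) (dbl (suc k))
  thick i (suc j) k Y Z W =
    Crossed.Atom.chains (Crossed.crossed {S} {T} {U} {V} rankedT rankedU rankedV i j k X Y Z W)
  thick (suc i) zero k Y Z W = conv (λ F → mass-cong (λ p → mass-swap-grid p F) (seg x 1))
    (Chains-Tame-map (Morph-None (Morph-id {S} {total S x 1} {None S} ⊗ᵐ
        Morph-exchange {U} {T} {V} {total U c 2} {total T b (dbl (2 + i))} {total V d (dbl (suc k))} {None U} {None T} {None V}))
      (Crossed.Atom.chains (Crossed.crossed {S} {U} {T} {V} rankedU rankedT rankedV 0 i k X Z Y W)))
    where
    mass-swap-grid : ∀ p F →
      mass (λ r → mass (λ q → mass (λ s → F (p , q , r , s)) (seg d (dbl (suc k)))) (seg b (dbl (2 + i)))) (seg c 2) ≡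
      mass (λ q → mass (λ r → mass (λ s → F (p , q , r , s)) (seg d (dbl (suc k)))) (seg c 2)) (seg b (dbl (2 + i)))
    mass-swap-grid p F = mass-swap (λ r q → mass (λ s → F (p , q , r , s)) (seg d (dbl (suc k)))) (seg c 2) (seg b (dbl (2 + i)))
  thick zero zero (suc k) Y Z W = conv
    (λ F → mass-cong (λ p → mass-cong (λ q → mass-swap (λ s r → F (p , q , r , s)) (seg d (dbl (2 + k))) (seg c 2)) (seg b 2)) (seg x 1))
    (Chains-Tame-map (Morph-None (Morph-id {S} {total S x 1} {None S} ⊗ᵐ (Morph-id {T} {total T b 2} {None T} ⊗ᵐ
        Morph-swap {V} {U} {total V d (dbl (2 + k))} {total U c 2} {None V} {None U})))
      (Crossed.Atom.chains (Crossed.crossed {S} {T} {V} {U} rankedT rankedV rankedU 0 k 0 X Y W Z)))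
  thick zero zero zero Y Z W = conv
    (λ F → mass-cong (λ p → trans (mass-cart (λ (q , r) → G F p q r) (fins 3) squareCells)
      (mass-cong (λ q → mass-cart (G F p q) (fins 3) (fins 3)) (fins 3))) (seg x 1))
    (thin-cube (Ix→Morph Y refl ⊗ᵐ (Ix→Morph Z refl ⊗ᵐ Ix→Morph W refl)))
    where
    G : (Carrier (S ⊗ R) → ℕ) → Carrier S → Fin 3 → Fin 3 × Fin 3 → ℕ
    G F p q (r , s) = F (p , b (toℕ q) , c (toℕ r) , d (toℕ s))

-- Chains of subsets

Cube : ℕ → Space
Cube n = record
  { Carrier = Subset n
  ; rk      = ∣_∣
  ; _⊑_     = _⊆_
  ; ⊑-refl  = ⊆-refl
  ; ⊑-trans = ⊆-trans
  ; _↝_     = λ p q → p ≡ q ⊎ (p ≡ ∅ × q ≡ full)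
  }

Cube-ranked : ∀ {n} → Ranked (Cube n)
Cube-ranked (inj₁ refl) = ≤-refl
Cube-ranked {n} (inj₂ (refl , _)) = ≤-trans (≤-reflexive (∣⊥∣≡0 n)) z≤n

-- Phrased by cardinalities, since these are what contradicts m ≥ 3 when the two sets coincide or
-- differ in rank by one.
Poles : ∀ {n} → Subset n → Subset n → Set
Poles {n} p q = ∣ p ∣ ≡ 0 × ∣ q ∣ ≡ n

ranked-Run : ∀ {n} (p : Subset n) A j → (∀ t → ∣ lookup (p ∷ A) t ∣ ≡ j + toℕ t) → Linked _⊆_ (p ∷ A) →
  ∃[ l ] Space.Run (Cube _) p (p ∷ A) l × ∣ l ∣ ≡ length A + j
ranked-Run p []      j rk [-] = p , Space.[ p ] , trans (rk F.zero) (+-identityʳ j)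
ranked-Run p (q ∷ A) j rk (p⊆q ∷ lk)
  with l , r , e ← ranked-Run q A (suc j) (λ t → trans (rk (F.suc t)) (+-suc j (toℕ t))) lk =
  l , (p⊆q , trans (rk (F.suc F.zero)) (trans (+-comm j 1) (cong suc (sym (trans (rk F.zero) (+-identityʳ j)))))) Space.∷ r ,
  trans e (+-suc (length A) j)

SymChain→Run : ∀ {n A} → IsSymChain n A →
  ∃[ f ] ∃[ l ] Space.Run (Cube n) f A l × ∣ f ∣ + ∣ l ∣ ≡ n
SymChain→Run {n} {[]} (j , _ , () , _)
SymChain→Run {n} {p ∷ A} (j , 2j≤n , len , rk , lk)
  with l , r , e ← ranked-Run p A j rk lk = p , l , r , (begin
    ∣ p ∣ + ∣ l ∣                ≡⟨ cong₂ _+_ (trans (rk F.zero) (+-identityʳ j)) e ⟩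
    j + (length A + j)           ≡⟨ cong (λ k → j + (k + j)) (suc-injective len) ⟩
    j + (n ∸ 2 * j + j)          ≡⟨ rearrange j (n ∸ 2 * j) ⟩
    n ∸ 2 * j + 2 * j            ≡⟨ m∸n+n≡m 2j≤n ⟩
    n                            ∎)
  where
  open ≡-Reasoning
  rearrange : ∀ j k → j + (k + j) ≡ k + 2 * j
  rearrange = solve-∀

Run→SymChain : ∀ {n f A l} → Space.Run (Cube n) f A l → ∣ f ∣ + ∣ l ∣ ≡ n → IsSymChain n A
Run→SymChain {n} {f} {A} {l} r e = ∣ f ∣ , 2r≤n , len , ranks r , linked r
  where
  open Space (Cube n) using (Run; _∷_; [_])
  linked : ∀ {f A l} → Run f A l → Linked _⊆_ A
  linked [ _ ] = [-]
  linked ((p⊆q , _) ∷ [ _ ]) = p⊆q ∷ [-]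
  linked ((p⊆q , _) ∷ r@(_ ∷ _)) = p⊆q ∷ linked r
  ranks : ∀ {f A l} → Run f A l → ∀ t → ∣ lookup A t ∣ ≡ ∣ f ∣ + toℕ t
  ranks [ _ ] F.zero = sym (+-identityʳ _)
  ranks (_ ∷ _) F.zero = sym (+-identityʳ _)
  ranks ((_ , e) ∷ r) (F.suc t) = trans (ranks r t) (trans (cong (_+ toℕ t) e) (sym (+-suc _ (toℕ t))))
  size : ∀ {f A l} → Run f A l → suc ∣ l ∣ ≡ length A + ∣ f ∣
  size [ _ ] = refl
  size {f} {_ ∷ A} ((_ , e) ∷ r) = trans (size r) (trans (cong (length A +_) e) (+-suc (length A) _))
  double : ∀ r → 2 * r ≡ r + r
  double = solve-∀
  f≤l : ∣ f ∣ ≤ ∣ l ∣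
  f≤l = ≤-pred (≤-trans (+-monoˡ-≤ ∣ f ∣ (nonempty r)) (≤-reflexive (sym (size r))))
    where
    nonempty : ∀ {f A l} → Run f A l → 1 ≤ length A
    nonempty [ _ ]   = s≤s z≤n
    nonempty (_ ∷ _) = s≤s z≤n
  2r≤n : 2 * ∣ f ∣ ≤ n
  2r≤n = ≤-trans (≤-reflexive (double ∣ f ∣)) (≤-trans (+-monoʳ-≤ ∣ f ∣ f≤l) (≤-reflexive e))
  len : length A ≡ suc (n ∸ 2 * ∣ f ∣)
  len = +-cancelʳ-≡ (2 * ∣ f ∣) (length A) _ (begin
    length A + 2 * ∣ f ∣
      ≡⟨ trans (cong (length A +_) (double ∣ f ∣)) (sym (+-assoc (length A) _ _)) ⟩
    length A + ∣ f ∣ + ∣ f ∣           ≡⟨ cong (_+ ∣ f ∣) (size r) ⟨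
    suc (∣ l ∣ + ∣ f ∣)                ≡⟨ cong suc (trans (+-comm ∣ l ∣ ∣ f ∣) e) ⟩
    suc n                              ≡⟨ cong suc (m∸n+n≡m 2r≤n) ⟨
    suc (n ∸ 2 * ∣ f ∣) + 2 * ∣ f ∣    ∎)
    where open ≡-Reasoning

-- Ranks determine positions, so ∅ and the full set can only be the ends of the chain. Of the two
-- facts recorded for a jump, B, C and D use the first, and a long A uses `Poles`.
SymChain→Ix : ∀ {n A} → IsSymChain n A →
  ∃[ x ] ∃[ a ] Ix (Cube n) (λ p q → (p ≡ x 0 × q ≡ x a) × Poles p q) x a × total (Cube n) x a ≡ n × seg x a ≡ A
SymChain→Ix {n} s with f , l , r , e ← SymChain→Run s
  with x , a , st , refl , refl , refl ← Run-Ix (Cube n) r = x , a , ix st jump , e , refl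
  where
  rank : ∀ i → i ≤ a → ∣ x i ∣ ≡ i + ∣ x 0 ∣
  rank i i≤a = Steps-rk (Cube n) st i i≤a
  jump : ∀ i j → i ≤ a → j ≤ a → x i ≡ x j ⊎ (x i ≡ ∅ × x j ≡ full) →
    i ≡ j ⊎ ((i ≡ 0 × j ≡ a) × (x 0 ≡ x 0 × x a ≡ x a) × Poles (x 0) (x a))
  jump i j i≤a j≤a (inj₁ eq) = inj₁ (+-cancelʳ-≡ ∣ x 0 ∣ i j
    (trans (sym (rank i i≤a)) (trans (cong ∣_∣ eq) (rank j j≤a))))
  jump i j i≤a j≤a (inj₂ (xi≡ , xj≡)) = inj₂ ((i≡0 , j≡a) , (refl , refl) , r₀≡0 , xa≡n)
    where
    i+r₀≡0 : i + ∣ x 0 ∣ ≡ 0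
    i+r₀≡0 = trans (sym (rank i i≤a)) (trans (cong ∣_∣ xi≡) (∣⊥∣≡0 n))
    i≡0 : i ≡ 0
    i≡0 = m+n≡0⇒m≡0 i i+r₀≡0
    r₀≡0 : ∣ x 0 ∣ ≡ 0
    r₀≡0 = m+n≡0⇒n≡0 i i+r₀≡0
    xa≡n : ∣ x a ∣ ≡ n
    xa≡n = trans (cong (_+ ∣ x a ∣) (sym r₀≡0)) e
    j≡a : j ≡ a
    j≡a = +-cancelʳ-≡ ∣ x 0 ∣ j a (trans (sym (rank j j≤a)) (trans (trans (cong ∣_∣ xj≡) (∣⊤∣≡n n))
      (trans (sym xa≡n) (rank a ≤-refl))))

Ix-relax : ∀ {S E E′ x a} → (∀ {p q} → E p q → E′ p q) → Ix S E x a → Ix S E′ x a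
Ix-relax {E = E} {E′} {x} {a} f (ix s j) = ix s λ i k i≤ k≤ J → relax (j i k i≤ k≤ J)
  where
  relax : ∀ {A B : Set} → A ⊎ (B × E (x 0) (x a)) → A ⊎ (B × E′ (x 0) (x a))
  relax (inj₁ e)       = inj₁ e
  relax (inj₂ (b , e)) = inj₂ (b , f e)

half*2 : ∀ h → h * 2 ≡ dbl h
half*2 zero    = refl
half*2 (suc h) = cong (suc ∘ suc) (half*2 h)

even→dbl : ∀ n → n % 2 ≡ 0 → ∃[ h ] n ≡ dbl h
even→dbl n e = n / 2 , trans (m≡m%n+[m/n]*n n 2) (trans (cong (_+ n / 2 * 2) e) (half*2 (n / 2)))

odd→dbl : ∀ n → n % 2 ≡ 1 → ∃[ h ] n ≡ suc (dbl h)
odd→dbl n e = n / 2 , trans (m≡m%n+[m/n]*n n 2) (trans (cong (_+ n / 2 * 2) e) (cong suc (half*2 (n / 2))))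

-- Cuboids of symmetric chains of subsets

module Boxes (m n p q : ℕ) where

  Box : Space
  Box = Cube m ⊗ (Cube n ⊗ (Cube p ⊗ Cube q))

  box : Chain m → Chain n → Chain p → Chain q → Mass (Carrier Box)
  box A B C D F = mass (λ a → mass (λ b → mass (λ c → mass (λ d → F (a , b , c , d)) D) C) B) A

  -- Along a jump, only the coordinates belonging to one-element chains can stay fixed.
  record Rigid (B : Chain n) (C : Chain p) (D : Chain q) (z z′ : Carrier Box) : Set where
    constructor rigid
    private
      a = proj₁ z ; a′ = proj₁ z′
      b = proj₁ (proj₂ z) ; b′ = proj₁ (proj₂ z′)
      c = proj₁ (proj₂ (proj₂ z)) ; c′ = proj₁ (proj₂ (proj₂ z′))
      d = proj₂ (proj₂ (proj₂ z)) ; d′ = proj₂ (proj₂ (proj₂ z′))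
    field
      fixed₂ : b ≡ b′ → B ≡ b ∷ []
      fixed₃ : c ≡ c′ → C ≡ c ∷ []
      fixed₄ : d ≡ d′ → D ≡ d ∷ []
      fixed₁ : a ≡ a′ → B ≡ b ∷ [] ⊎ C ≡ c ∷ [] ⊎ D ≡ d ∷ []

  segment-point : ∀ {k x a} → Steps (Cube k) x a → x 0 ≡ x a → seg x a ≡ x 0 ∷ []
  segment-point {k} {x} {a} s e = go a (+-cancelʳ-≡ ∣ x 0 ∣ 0 a (trans (cong ∣_∣ e) (Steps-rk (Cube k) s a ≤-refl)))
    where
    go : ∀ a → 0 ≡ a → seg x a ≡ x 0 ∷ []
    go .0 refl = refl

  cuboid : 3 ≤ m → m % 2 ≡ 1 → n % 2 ≡ 0 → p % 2 ≡ 0 → q % 2 ≡ 0 →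
    ∀ {A B C D} → IsSymChain m A → IsSymChain n B → IsSymChain p C → IsSymChain q D →
    Chains (Jumping Box (m + (n + (p + q))) (Rigid B C D)) (box A B C D)
  cuboid 3≤m odd even₂ even₃ even₄ sA sB sC sD
    with x , a , X , tx , refl ← SymChain→Ix sA | b , β , Y , ty , refl ← SymChain→Ix sB
       | c , γ , Z , tz , refl ← SymChain→Ix sC | d , δ , W , tw , refl ← SymChain→Ix sD
    with h , m≡ ← odd→dbl m odd | h₂ , n≡ ← even→dbl n even₂ | h₃ , p≡ ← even→dbl p even₃ | h₄ , q≡ ← even→dbl q even₄
    with r , a≡ ← odd-Ix {Cube m} {h = h} (Ix.steps X) (trans tx m≡)
       | i , refl ← even-Ix {Cube n} {h = h₂} (Ix.steps Y) (trans ty n≡)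
       | j , refl ← even-Ix {Cube p} {h = h₃} (Ix.steps Z) (trans tz p≡)
       | k , refl ← even-Ix {Cube q} {h = h₄} (Ix.steps W) (trans tw q≡) =
    subst (λ N → Chains (Jumping Box N (Rigid (seg b (dbl i)) (seg c (dbl j)) (seg d (dbl k))))
                   (box (seg x a) (seg b (dbl i)) (seg c (dbl j)) (seg d (dbl k))))
      (cong₂ _+_ tx (cong₂ _+_ ty (cong₂ _+_ tz tw))) (by-length r a≡)
    where
    total-box = total (Cube m) x a + (total (Cube n) b (dbl i) + (total (Cube p) c (dbl j) + total (Cube q) d (dbl k)))
    B = seg b (dbl i)
    C = seg c (dbl j)
    D = seg d (dbl k)

    Y′ : Ix (Cube n) (λ p q → p ≡ b 0 × q ≡ b (dbl i)) b (dbl i)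
    Y′ = Ix-relax proj₁ Y
    Z′ : Ix (Cube p) (λ p q → p ≡ c 0 × q ≡ c (dbl j)) c (dbl j)
    Z′ = Ix-relax proj₁ Z
    W′ : Ix (Cube q) (λ p q → p ≡ d 0 × q ≡ d (dbl k)) d (dbl k)
    W′ = Ix-relax proj₁ W

    single-ends : ∀ {X : Set} i (y : ℕ → X) → i ≡ 0 → y 0 ≡ y 0 × y 0 ≡ y (dbl i)
    single-ends .0 y refl = refl , refl

    open Cuboid {Cube m} {Cube n} {Cube p} {Cube q} {x} {b} {c} {d} {E = Poles} i j k
      Y′ Z′ W′ (single-ends i b) (single-ends j c) (single-ends k d)

    not-poles : ∀ {p} → ¬ Poles {m} p p
    not-poles (e , e′) with () ← subst (3 ≤_) (trans (sym e′) e) 3≤m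

    Link⇒Rigid : ∀ z z′ → Link z z′ → Rigid B C D z z′
    Link⇒Rigid z z′ (((refl , refl) , (refl , refl) , (refl , refl)) , e) = rigid
      (segment-point (Ix.steps Y)) (segment-point (Ix.steps Z)) (segment-point (Ix.steps W)) (fixed e)
      where
      fixed : ∀ {p p′} → Poles p p′ ⊎ Trivial → p ≡ p′ → B ≡ b 0 ∷ [] ⊎ C ≡ c 0 ∷ [] ⊎ D ≡ d 0 ∷ []
      fixed {r} (inj₁ e) refl = ⊥-elim (not-poles {r} e)
      fixed (inj₂ (inj₁ refl)) _ = inj₁ refl
      fixed (inj₂ (inj₂ (inj₁ refl))) _ = inj₂ (inj₁ refl)
      fixed (inj₂ (inj₂ (inj₂ refl))) _ = inj₂ (inj₂ refl)

    thin : a ≡ 1 → ∀ i′ j′ k′ → i ≡ i′ → j ≡ j′ → k ≡ k′ →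
      Chains (Jumping Box total-box (Rigid B C D)) (box (seg x a) B C D)
    thin refl = by-size
      where
      -- Cardinalities 0 and m one step apart would force m = 1.
      not-poles₁ : ∀ {p q} → (p ≡ x 0 × q ≡ x 1) × Poles p q → ⊥
      not-poles₁ ((refl , refl) , e , e′)
        with s≤s () ← ≤-trans 3≤m (≤-reflexive (trans (sym e′) (trans (Steps-rk (Cube m) (Ix.steps X) 1 ≤-refl) (cong suc e))))
      X′ : Ix (Cube m) (None (Cube m)) x 1
      X′ = Ix-relax not-poles₁ X
      by-size : ∀ i′ j′ k′ → i ≡ i′ → j ≡ j′ → k ≡ k′ →
        Chains (Jumping Box total-box (Rigid B C D)) (box (seg x 1) B C D)
      by-size zero zero zero i≡ j≡ k≡ = Chains-map (Jumping-map Link⇒Rigid) (single-cuboid X′ i≡ j≡ k≡)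
      by-size zero (suc _) _ refl refl refl =
        Chains-map (Jumping-map Link⇒Rigid) (trivial-cuboid X′ (inj₁ refl) (s≤s z≤n))
      by-size zero zero (suc _) refl refl refl =
        Chains-map (Jumping-map Link⇒Rigid) (trivial-cuboid X′ (inj₁ refl) (s≤s z≤n))
      by-size (suc _) zero _ refl refl refl =
        Chains-map (Jumping-map Link⇒Rigid) (trivial-cuboid X′ (inj₂ (inj₁ refl)) (s≤s z≤n))
      by-size (suc _) (suc _) zero refl refl refl =
        Chains-map (Jumping-map Link⇒Rigid) (trivial-cuboid X′ (inj₂ (inj₂ refl)) (s≤s z≤n))
      by-size (suc i′) (suc j′) (suc k′) refl refl refl = Chains-map (Jumping-map (λ _ _ ()) ∘ Tame⇒Jumping)
        (ThickCuboid.thick {Cube m} {Cube n} {Cube p} {Cube q} Cube-ranked Cube-ranked Cube-ranked X′ i′ j′ k′ Y Z W)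

    by-length : ∀ r → a ≡ suc (dbl r) → Chains (Jumping Box total-box (Rigid B C D)) (box (seg x a) B C D)
    by-length zero    e    = thin e i j k refl refl refl
    by-length (suc r) refl = Chains-map (Jumping-map Link⇒Rigid) (odd-cuboid r (Ix-relax proj₂ X))

-- Almost orthogonality and counting

1≤-length : {X : Set} {l : List X} {x : X} → x ∈ l → 1 ≤ length l
1≤-length (here _)  = s≤s z≤n
1≤-length (there _) = s≤s z≤n

2≤-length : {X : Set} {l : List X} {x y : X} → x ∈ l → y ∈ l → x ≢ y → 2 ≤ length l
2≤-length (here refl) (here refl) x≢y = ⊥-elim (x≢y refl)
2≤-length (here _)    (there y∈)  _   = s≤s (1≤-length y∈)
2≤-length (there x∈)  (here _)    _   = s≤s (1≤-length x∈)
2≤-length (there x∈)  (there y∈)  x≢y = m≤n⇒m≤1+n (2≤-length x∈ y∈ x≢y)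

3≤-length : {X : Set} {l : List X} {x y z : X} → x ∈ l → y ∈ l → z ∈ l →
  x ≢ y → x ≢ z → y ≢ z → 3 ≤ length l
3≤-length (here refl) (here refl) _           p _ _ = ⊥-elim (p refl)
3≤-length (here refl) (there _)   (here refl) _ p _ = ⊥-elim (p refl)
3≤-length (here _)    (there y∈)  (there z∈)  _ _ p = s≤s (2≤-length y∈ z∈ p)
3≤-length (there _)   (here refl) (here refl) _ _ p = ⊥-elim (p refl)
3≤-length (there x∈)  (here _)    (there z∈)  _ p _ = s≤s (2≤-length x∈ z∈ p)
3≤-length (there x∈)  (there y∈)  (here _)    p _ _ = s≤s (2≤-length x∈ y∈ p)
3≤-length (there x∈)  (there y∈)  (there z∈)  p q r = m≤n⇒m≤1+n (3≤-length x∈ y∈ z∈ p q r)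

AllPairs-map-∈ : {X : Set} {R Q : X → X → Set} {l : List X} →
  (∀ {x y} → x ∈ l → y ∈ l → R x y → Q x y) → AllPairs R l → AllPairs Q l
AllPairs-map-∈ f []       = []
AllPairs-map-∈ f (r ∷ rs) =
  All.tabulate (λ y∈ → f (here refl) (there y∈) (All.lookup r y∈)) ∷
  AllPairs-map-∈ (λ x∈ y∈ → f (there x∈) (there y∈)) rs

Run⇒AllPairs : ∀ {n f c l} → Space.Run (Cube n) f c l → AllPairs (λ p q → p ⊆ q × ∣ p ∣ < ∣ q ∣) c
Run⇒AllPairs {n} = go
  where
  open Space (Cube n) using (Run; [_]; _∷_)
  Below Under : Subset n → Subset n → Set
  Below p q = p ⊆ q × ∣ p ∣ < ∣ q ∣
  Under p q = p ⊆ q × ∣ p ∣ ≤ ∣ q ∣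
  step : ∀ {p q r} → p ⊆ q × ∣ q ∣ ≡ suc ∣ p ∣ → Under q r → Below p r
  step (s , e) (t , le) = ⊆-trans s t , ≤-trans (≤-reflexive (sym e)) le
  relax : ∀ {p q} → Below p q → Under p q
  relax (s , lt) = s , <⇒≤ lt
  above : ∀ {f c l} → Run f c l → All (Under f) c
  above [ _ ]   = (⊆-refl , ≤-refl) ∷ []
  above (s ∷ r) = (⊆-refl , ≤-refl) ∷ All.map (λ u → relax (step s u)) (above r)
  go : ∀ {f c l} → Run f c l → AllPairs Below c
  go [ _ ]   = [] ∷ []
  go (s ∷ r) = All.map (step s) (above r) ∷ go r

∅≢full : ∀ {n} → 1 ≤ n → ∅ {n} ≢ full
∅≢full {n} 1≤n e = 1+n≰n {0} (≤-trans 1≤n (≤-reflexive (trans (sym (∣⊤∣≡n n)) (trans (cong ∣_∣ (sym e)) (∣⊥∣≡0 n)))))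

full-both? : ∀ {n} (A B : Chain n) → Dec (FullBoth A B)
full-both? A B = ((∅ ∈? A) ×-dec (full ∈? A)) ×-dec ((∅ ∈? B) ×-dec (full ∈? B))

module _ {n : ℕ} {F G : List (Chain n)} (1≤n : 1 ≤ n) (ao : AlmostOrthogonal F G) {A B : Chain n} (A∈ : A ∈ F) (B∈ : B ∈ G) where

  common⁺ : ∀ {p} → p ∈ A → p ∈ B → p ∈ filter (_∈? B) A
  common⁺ = ∈-filter⁺ (_∈? B)

  no-third : FullBoth A B → ∀ {p} → p ∈ A → p ∈ B → p ≢ ∅ → p ≢ full → ⊥
  no-third fb@((∅A , fA) , (∅B , fB)) pA pB p≢∅ p≢f = 1+n≰n (≤-trans
    (3≤-length (common⁺ pA pB) (common⁺ ∅A ∅B) (common⁺ fA fB) p≢∅ p≢f (∅≢full 1≤n))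
    (≤-reflexive (proj₁ (ao A B A∈ B∈) fb)))

  -- Two distinct common elements occur only in the exceptional case, where ∅ and the full set
  -- already exhaust the permitted two; inclusion decides which is which.
  common-pair : ∀ {p q} → p ∈ A → p ∈ B → q ∈ A → q ∈ B → p ⊆ q → p ≡ q ⊎ (p ≡ ∅ × q ≡ full)
  common-pair {p} {q} pA pB qA qB p⊆q with p ≟ₛ q | full-both? A B
  ... | yes e  | _     = inj₁ e
  ... | no p≢q | no nf =
    ⊥-elim (1+n≰n (≤-trans (2≤-length (common⁺ pA pB) (common⁺ qA qB) p≢q) (proj₂ (ao A B A∈ B∈) nf)))
  ... | no p≢q | yes fb with p ≟ₛ ∅ | q ≟ₛ full
  ...   | yes p≡   | yes q≡ = inj₂ (p≡ , q≡)
  ...   | yes refl | no q≢  = ⊥-elim (no-third fb qA qB (p≢q ∘ sym) q≢)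
  ...   | no p≢    | _      = ⊥-elim (no-third fb pA pB p≢ λ { refl → p≢q (⊆-antisym p⊆q ⊆⊤) })

-- Listed in increasing order, any earlier common element is ∅ and any later one is full. The middle
-- one of three would be both.
almost-orthogonal : ∀ {n} {X Y : Chain n} → 1 ≤ n → AllPairs (λ p q → p ⊆ q × ∣ p ∣ < ∣ q ∣) X →
  (∀ {p q} → p ∈ X → p ∈ Y → q ∈ X → q ∈ Y → p ⊆ q → p ≢ q → p ≡ ∅ × q ≡ full) →
  (FullBoth X Y → inter X Y ≡ 2) × (¬ FullBoth X Y → inter X Y ≤ 1)
almost-orthogonal {n} {X} {Y} 1≤n order common = (λ fb → ≤-antisym (≤2 _ poles) (≥2 fb)) , λ nf → ≤1 nf _ (λ z∈ → z∈) poles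
  where
  Common : List (Subset n)
  Common = filter (_∈? Y) X
  poles : AllPairs (λ p q → p ≡ ∅ × q ≡ full) Common
  poles = AllPairs-map-∈ (λ x∈ y∈ (s , lt) → pole (∈-filter⁻ (_∈? Y) x∈) (∈-filter⁻ (_∈? Y) y∈) s lt)
    (AllPairs.filter⁺ (_∈? Y) order)
    where
    pole : ∀ {p q} → p ∈ X × p ∈ Y → q ∈ X × q ∈ Y → p ⊆ q → ∣ p ∣ < ∣ q ∣ → p ≡ ∅ × q ≡ full
    pole (a , b) (c , d) s lt = common a b c d s λ { refl → 1+n≰n lt }
  ≤2 : ∀ l → AllPairs (λ p q → p ≡ ∅ × q ≡ full) l → length l ≤ 2
  ≤2 []                _ = z≤n
  ≤2 (_ ∷ [])          _ = s≤s z≤n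
  ≤2 (_ ∷ _ ∷ [])      _ = s≤s (s≤s z≤n)
  ≤2 (_ ∷ _ ∷ _ ∷ _) (((_ , e) ∷ _) ∷ ((e′ , _) ∷ _) ∷ _) = ⊥-elim (∅≢full 1≤n (trans (sym e′) e))
  ≥2 : FullBoth X Y → 2 ≤ length Common
  ≥2 ((a , b) , (c , d)) = 2≤-length (∈-filter⁺ (_∈? Y) a c) (∈-filter⁺ (_∈? Y) b d) (∅≢full 1≤n)
  ≤1 : ¬ FullBoth X Y → ∀ l → (∀ {z} → z ∈ l → z ∈ Common) → AllPairs (λ p q → p ≡ ∅ × q ≡ full) l → length l ≤ 1
  ≤1 nf []           _ _ = z≤n
  ≤1 nf (_ ∷ [])     _ _ = s≤s z≤n
  ≤1 nf (p ∷ q ∷ l) sub (((refl , refl) ∷ _) ∷ _)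
    with a , c ← ∈-filter⁻ (_∈? Y) {xs = X} (sub (here refl)) | b , d ← ∈-filter⁻ (_∈? Y) {xs = X} (sub (there (here refl))) =
    ⊥-elim (nf ((a , b) , (c , d)))

∣++∣ : ∀ {m n} (p : Subset m) (q : Subset n) → ∣ p Vec.++ q ∣ ≡ ∣ p ∣ + ∣ q ∣
∣++∣ []            q = refl
∣++∣ (inside ∷ p)  q = cong suc (∣++∣ p q)
∣++∣ (outside ∷ p) q = ∣++∣ p q

++-⊆ : ∀ {m n} {p p′ : Subset m} {q q′ : Subset n} → p ⊆ p′ → q ⊆ q′ → p Vec.++ q ⊆ p′ Vec.++ q′
++-⊆ {p = []} {[]} _ s = s
++-⊆ {p = outside ∷ p} {_ ∷ p′} r s = out⊆ (++-⊆ (drop-∷-⊆ r) s)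
++-⊆ {p = inside ∷ p} {x ∷ p′} r s with Vec.here ← r Vec.here = s⊆s (++-⊆ (drop-∷-⊆ r) s)

++-⊆⁻ : ∀ {m n} (p p′ : Subset m) {q q′ : Subset n} → p Vec.++ q ⊆ p′ Vec.++ q′ → p ⊆ p′ × q ⊆ q′
++-⊆⁻ []            []       s = ⊆-refl , s
++-⊆⁻ (outside ∷ p) (_ ∷ p′) s with r , t ← ++-⊆⁻ p p′ (drop-∷-⊆ s) = out⊆ r , t
++-⊆⁻ (inside ∷ p)  (_ ∷ p′) s with Vec.here ← s Vec.here | r , t ← ++-⊆⁻ p p′ (drop-∷-⊆ s) = s⊆s r , t

replicate-++ : ∀ {X : Set} m n (x : X) → Vec.replicate m x Vec.++ Vec.replicate n x ≡ Vec.replicate (m + n) x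
replicate-++ zero    n x = refl
replicate-++ (suc m) n x = cong (x ∷_) (replicate-++ m n x)

δ : ∀ {n} → Subset n → Subset n → ℕ
δ x y = if does (x ≟ₛ y) then 1 else 0

δ-refl : ∀ {n} (x : Subset n) → δ x x ≡ 1
δ-refl x with x ≟ₛ x
... | yes _ = refl
... | no ≢  = ⊥-elim (≢ refl)

count≡mass : ∀ {n} (x : Subset n) l → count x l ≡ mass (δ x) l
count≡mass x []      = refl
count≡mass x (y ∷ l) with x ≟ₛ y
... | yes _ = cong suc (count≡mass x l)
... | no _  = count≡mass x l

∈-mass : ∀ {n} (x : Subset n) l → mass (δ x) l ≢ 0 → x ∈ l
∈-mass x []      ≢0 = ⊥-elim (≢0 refl)
∈-mass x (y ∷ l) ≢0 with x ≟ₛ y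
... | yes e = here e
... | no _  = there (∈-mass x l ≢0)

≤-mass : ∀ {X : Set} (F : X → ℕ) {x l} → x ∈ l → F x ≤ mass F l
≤-mass F (here refl)      = m≤m+n _ _
≤-mass F (there {y} {_} x∈) = ≤-trans (≤-mass F x∈) (m≤n+m _ (F y))

δ-++ : ∀ {m n} (p p′ : Subset m) (q q′ : Subset n) → δ (p Vec.++ q) (p′ Vec.++ q′) ≡ δ p p′ * δ q q′
δ-++ p p′ q q′ with p ≟ₛ p′ | q ≟ₛ q′ | (p Vec.++ q) ≟ₛ (p′ Vec.++ q′)
... | yes refl | yes refl | yes _ = refl
... | yes refl | yes refl | no ≢  = ⊥-elim (≢ refl)
... | yes _    | no ≢     | yes e = ⊥-elim (≢ (Vec.++-injectiveʳ p p′ e))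
... | yes _    | no _     | no _  = refl
... | no ≢     | _        | yes e = ⊥-elim (≢ (Vec.++-injectiveˡ p p′ e))
... | no _     | _        | no _  = refl

mass-*ˡ : ∀ {X : Set} k (f : X → ℕ) l → mass (λ x → k * f x) l ≡ k * mass f l
mass-*ˡ k f []      = sym (*-zeroʳ k)
mass-*ˡ k f (x ∷ l) = trans (cong (k * f x +_) (mass-*ˡ k f l)) (sym (*-distribˡ-+ k (f x) _))

mass-*ʳ : ∀ {X : Set} (f : X → ℕ) k l → mass (λ x → f x * k) l ≡ mass f l * k
mass-*ʳ f k []      = refl
mass-*ʳ f k (x ∷ l) = trans (cong (f x * k +_) (mass-*ʳ f k l)) (sym (*-distribʳ-+ k (f x) _))

mass-product : ∀ {X Y : Set} (f : X → ℕ) (g : Y → ℕ) l l′ →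
  mass (λ x → mass (λ y → f x * g y) l′) l ≡ mass f l * mass g l′
mass-product f g l l′ = trans (mass-cong (λ x → mass-*ˡ (f x) g l′) l) (mass-*ʳ f (mass g l′) l)

mass-concat : ∀ {X : Set} (F : X → ℕ) L → mass F (concat L) ≡ mass (mass F) L
mass-concat F []      = refl
mass-concat F (l ∷ L) = trans (mass-++ F l (concat L)) (cong (mass F l +_) (mass-concat F L))

mass-product₄ : ∀ {X Y Z W : Set} (f : X → ℕ) (g : Y → ℕ) (h : Z → ℕ) (k : W → ℕ) A B C D →
  mass (λ a → mass (λ b → mass (λ c → mass (λ d → f a * (g b * (h c * k d))) D) C) B) A ≡
  mass f A * (mass g B * (mass h C * mass k D))
mass-product₄ f g h k A B C D = begin
  mass (λ a → mass (λ b → mass (λ c → mass (λ d → f a * (g b * (h c * k d))) D) C) B) A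
    ≡⟨ mass-cong (λ a → mass-cong (λ b → trans (mass-cong (λ c → trans (mass-*ˡ (f a) _ D)
         (cong (f a *_) (mass-*ˡ (g b) _ D))) C) (trans (mass-*ˡ (f a) _ C) (cong (f a *_) (mass-*ˡ (g b) _ C)))) B) A ⟩
  mass (λ a → mass (λ b → f a * (g b * mass (λ c → mass (λ d → h c * k d) D) C)) B) A
    ≡⟨ mass-product f (λ b → g b * mass (λ c → mass (λ d → h c * k d) D) C) A B ⟩
  mass f A * mass (λ b → g b * mass (λ c → mass (λ d → h c * k d) D) C) B
    ≡⟨ cong (mass f A *_) (trans (mass-*ʳ g _ B) (cong (mass g B *_) (mass-product h k C D))) ⟩
  mass f A * (mass g B * (mass h C * mass k D)) ∎
  where open ≡-Reasoning

-- Chains of the product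

module Product (m n p q : ℕ) where
  open Boxes m n p q

  N : ℕ
  N = m + (n + (p + q))

  join : Carrier Box → Subset N
  join (a , b , c , d) = a Vec.++ (b Vec.++ (c Vec.++ d))

  rk-join : ∀ z → ∣ join z ∣ ≡ Space.rk Box z
  rk-join (a , b , c , d) = trans (∣++∣ a _) (cong (∣ a ∣ +_) (trans (∣++∣ b _) (cong (∣ b ∣ +_) (∣++∣ c d))))

  join-mono : ∀ {z z′} → Space._⊑_ Box z z′ → join z ⊆ join z′
  join-mono (r , s , t , u) = ++-⊆ r (++-⊆ s (++-⊆ t u))

  join-mono⁻ : ∀ z z′ → join z ⊆ join z′ → Space._⊑_ Box z z′
  join-mono⁻ (a , b , c , _) (a′ , b′ , c′ , _) s
    with r , s ← ++-⊆⁻ a a′ s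
    with t , s ← ++-⊆⁻ b b′ s
    with u , s ← ++-⊆⁻ c c′ s = r , t , u , s

  join-injective : ∀ z z′ → join z ≡ join z′ → z ≡ z′
  join-injective (a , b , c , d) (a′ , b′ , c′ , d′) e
    with refl , e ← Vec.++-injective a a′ e
    with refl , e ← Vec.++-injective b b′ e
    with refl , refl ← Vec.++-injective c c′ e = refl

  join-constant : ∀ x → join (Vec.replicate m x , Vec.replicate n x , Vec.replicate p x , Vec.replicate q x) ≡ Vec.replicate N x
  join-constant x = trans
    (cong (Vec.replicate m x Vec.++_) (trans (cong (Vec.replicate n x Vec.++_) (replicate-++ p q x)) (replicate-++ n (p + q) x)))
    (replicate-++ m (n + (p + q)) x)

  Inside : Chain m → Chain n → Chain p → Chain q → Carrier Box → Set
  Inside A B C D (a , b , c , d) = a ∈ A × b ∈ B × c ∈ C × d ∈ D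

  -- Written as a product over the coordinates so that its sum over a box, and over all boxes,
  -- factorises by `mass-product₄`.
  indicator : Carrier Box → Carrier Box → ℕ
  indicator (a , b , c , d) (a′ , b′ , c′ , d′) = δ a a′ * (δ b b′ * (δ c c′ * δ d d′))

  indicator-refl : ∀ z → indicator z z ≡ 1
  indicator-refl (a , b , c , d) =
    cong₂ _*_ (δ-refl a) (cong₂ _*_ (δ-refl b) (cong₂ _*_ (δ-refl c) (δ-refl d)))

  -- Membership is recovered from weights: the indicator of `z` has a positive sum over `l`, hence
  -- over the box, where it is a product of four multiplicities, none of which can vanish.
  covered : ∀ {A B C D l} → (∀ F → mass F l ≡ box A B C D F) → ∀ {z} → z ∈ l → Inside A B C D z
  covered {A} {B} {C} {D} {l} e {z@(a , b , c , d)} z∈ =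
    ∈-mass a A (λ α≡ → ≢0 (cong (_* _) α≡)) ,
    ∈-mass b B (λ β≡ → ≢0 (trans (cong (mass (δ a) A *_) (cong (_* _) β≡)) (*-zeroʳ (mass (δ a) A)))) ,
    ∈-mass c C (λ γ≡ → ≢0 (trans (cong (λ k → mass (δ a) A * (mass (δ b) B * (k * mass (δ d) D))) γ≡)
      (trans (cong (mass (δ a) A *_) (*-zeroʳ (mass (δ b) B))) (*-zeroʳ (mass (δ a) A))))) ,
    ∈-mass d D (λ ε≡ → ≢0 (trans (cong (λ k → mass (δ a) A * (mass (δ b) B * (mass (δ c) C * k))) ε≡)
      (trans (cong (λ k → mass (δ a) A * (mass (δ b) B * k)) (*-zeroʳ (mass (δ c) C)))
        (trans (cong (mass (δ a) A *_) (*-zeroʳ (mass (δ b) B))) (*-zeroʳ (mass (δ a) A))))))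
    where
    ≢0 : mass (δ a) A * (mass (δ b) B * (mass (δ c) C * mass (δ d) D)) ≢ 0
    ≢0 eq = 1+n≰n (≤-trans (≤-reflexive (sym (indicator-refl z))) (≤-trans (≤-mass (indicator z) z∈)
      (≤-reflexive (trans (e (indicator z)) (trans (mass-product₄ (δ a) (δ b) (δ c) (δ d) A B C D) eq)))))

  module _ (F : List (Chain m)) (G : List (Chain n)) (H : List (Chain p)) (K : List (Chain q)) where

    record Fine (l : List (Carrier Box)) : Set where
      field
        {A} : Chain m
        {B} : Chain n
        {C} : Chain p
        {D} : Chain q
        A∈ : A ∈ F
        B∈ : B ∈ G
        C∈ : C ∈ H
        D∈ : D ∈ K
        jumps  : Jumping Box N (Rigid B C D) l
        within : ∀ {z} → z ∈ l → Inside A B C D z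

    boxes : Mass (Carrier Box)
    boxes Φ = mass (λ A → mass (λ B → mass (λ C → mass (λ D → box A B C D Φ) K) H) G) F

    family : 3 ≤ m → m % 2 ≡ 1 → n % 2 ≡ 0 → p % 2 ≡ 0 → q % 2 ≡ 0 →
      IsSCD m F → IsSCD n G → IsSCD p H → IsSCD q K → Chains Fine boxes
    family 3≤m odd even₂ even₃ even₄ sF sG sH sK =
      Sum-loop F λ {A} A∈ → Sum-loop G λ {B} B∈ → Sum-loop H λ {C} C∈ → Sum-loop K λ {D} D∈ → cuboids A∈ B∈ C∈ D∈
      where
      cuboids : ∀ {A B C D} → A ∈ F → B ∈ G → C ∈ H → D ∈ K → Chains Fine (box A B C D)
      cuboids A∈ B∈ C∈ D∈
        with S , js , e ← extract (cuboid 3≤m odd even₂ even₃ even₄ (proj₁ sF _ A∈) (proj₁ sG _ B∈) (proj₁ sH _ C∈) (proj₁ sK _ D∈)) =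
        conv e (Sum-list (All.tabulate λ {l} l∈ → record
          { A∈ = A∈ ; B∈ = B∈ ; C∈ = C∈ ; D∈ = D∈ ; jumps = All.lookup js l∈
          ; within = λ z∈ → covered e (∈-concat⁺′ z∈ l∈) }))

    boxes-indicator : IsSCD m F → IsSCD n G → IsSCD p H → IsSCD q K → ∀ z → boxes (indicator z) ≡ 1
    boxes-indicator (_ , sF) (_ , sG) (_ , sH) (_ , sK) (a , b , c , d) = begin
      boxes (indicator (a , b , c , d))
        ≡⟨ mass-cong (λ A → mass-cong (λ B → mass-cong (λ C → mass-cong (λ D →
             mass-product₄ (δ a) (δ b) (δ c) (δ d) A B C D) K) H) G) F ⟩
      mass (λ A → mass (λ B → mass (λ C → mass (λ D →
        mass (δ a) A * (mass (δ b) B * (mass (δ c) C * mass (δ d) D))) K) H) G) F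
        ≡⟨ mass-product₄ (mass (δ a)) (mass (δ b)) (mass (δ c)) (mass (δ d)) F G H K ⟩
      mass (mass (δ a)) F * (mass (mass (δ b)) G * (mass (mass (δ c)) H * mass (mass (δ d)) K))
        ≡⟨ cong₂ _*_ (once F sF a) (cong₂ _*_ (once G sG b) (cong₂ _*_ (once H sH c) (once K sK d))) ⟩
      1 ∎
      where
      open ≡-Reasoning
      once : ∀ {n} (L : List (Chain n)) → (∀ x → count x (concat L) ≡ 1) → ∀ x → mass (mass (δ x)) L ≡ 1
      once L s x = trans (sym (mass-concat (δ x) L)) (trans (sym (count≡mass x (concat L))) (s x))

    Fine⇒SymChain : ∀ {l} → Fine l → IsSymChain N (map join l)
    Fine⇒SymChain f = Run→SymChain (Run-image {Box} {Cube N} 0 rk-join join-mono run)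
      (trans (cong₂ _+_ (rk-join first) (rk-join last)) balanced)
      where open Jumping (Fine.jumps f)

    Fine⇒InCuboid : ∀ {l} (f : Fine l) → InCuboid (map join l) (Fine.A f) (Fine.B f) (Fine.C f) (Fine.D f)
    Fine⇒InCuboid f x x∈ with z@(a , b , c , d) , z∈ , refl ← ∈-map⁻ join x∈
      with a∈ , b∈ , c∈ , d∈ ← Fine.within f z∈ = a , b , c , d , refl , a∈ , b∈ , c∈ , d∈

  mass⇒SCD : ∀ {S} {M : Mass (Carrier Box)} → (∀ Φ → mass Φ (concat S) ≡ M Φ) →
    (∀ z → M (indicator z) ≡ 1) → ∀ x → count x (concat (map (map join) S)) ≡ 1
  mass⇒SCD {S} {M} e once x with a , x , refl ← Vec.splitAt m x with b , x , refl ← Vec.splitAt n x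
    with c , d , refl ← Vec.splitAt p x = begin
    count (join z) (concat (map (map join) S))      ≡⟨ count≡mass (join z) (concat (map (map join) S)) ⟩
    mass (δ (join z)) (concat (map (map join) S))   ≡⟨ cong (mass (δ (join z))) (concat-map S) ⟩
    mass (δ (join z)) (map join (concat S))         ≡⟨ mass-map (δ (join z)) join (concat S) ⟩
    mass (δ (join z) ∘ join) (concat S)             ≡⟨ mass-cong δ-join (concat S) ⟩
    mass (indicator z) (concat S)                   ≡⟨ e (indicator z) ⟩
    M (indicator z)                                 ≡⟨ once z ⟩
    1                                               ∎
    where
    open ≡-Reasoning
    z : Carrier Box
    z = a , b , c , d
    δ-join : ∀ z′ → δ (join z) (join z′) ≡ indicator z z′
    δ-join (a′ , b′ , c′ , d′) = trans (δ-++ a a′ _ _) (cong (δ a a′ *_)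
      (trans (δ-++ b b′ _ _) (cong (δ b b′ *_) (δ-++ c c′ d d′))))

  GoodPair : ∀ {k} → List (Chain k) → List (Chain k) → Set
  GoodPair F F′ = ∀ A B → A ∈ F → B ∈ F′ → length A ≡ 1 → length B ≡ 1 → A ≢ B

  module _ (1≤m : 1 ≤ m) (1≤n : 1 ≤ n) (1≤p : 1 ≤ p) (1≤q : 1 ≤ q) {F F′ G G′ H H′ K K′}
    (aoF : AlmostOrthogonal F F′) (aoG : AlmostOrthogonal G G′) (aoH : AlmostOrthogonal H H′) (aoK : AlmostOrthogonal K K′)
    (goodG : GoodPair G G′) (goodH : GoodPair H H′) (goodK : GoodPair K K′)
    {l l′} (f : Fine F G H K l) (f′ : Fine F′ G′ H′ K′ l′) where

    private
      module f = Fine f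
      module f′ = Fine f′

    not-common : ∀ {k} {L L′ : List (Chain k)} → GoodPair L L′ → ∀ {A B x} → A ∈ L → B ∈ L′ →
      A ≡ x ∷ [] → B ≡ x ∷ [] → ⊥
    not-common g A∈ B∈ refl refl = g _ _ A∈ B∈ refl refl refl

    -- A coordinate in B, C or D that stayed fixed would make the same one-element chain occur in
    -- both families, against goodness. So all three move, none of B, C, D is a single point, and
    -- the coordinate in A has to move as well.
    common-corner : ∀ {z z′} → z ∈ l → z ∈ l′ → z′ ∈ l → z′ ∈ l′ → Space._⊑_ Box z z′ → z ≢ z′ →
      z ≡ (∅ , ∅ , ∅ , ∅) × z′ ≡ (full , full , full , full)
    common-corner {a , b , c , d} {a′ , b′ , c′ , d′} z∈ z∈′ z′∈ z′∈′ (sa , sb , sc , sd) z≢z′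
      with a∈ , b∈ , c∈ , d∈ ← f.within z∈ | a∈₂ , b∈₂ , c∈₂ , d∈₂ ← f′.within z∈′
         | a′∈ , b′∈ , c′∈ , d′∈ ← f.within z′∈ | a′∈₂ , b′∈₂ , c′∈₂ , d′∈₂ ← f′.within z′∈′
      with ja ← common-pair 1≤m aoF f.A∈ f′.A∈ a∈ a∈₂ a′∈ a′∈₂ sa
         | jb ← common-pair 1≤n aoG f.B∈ f′.B∈ b∈ b∈₂ b′∈ b′∈₂ sb
         | jc ← common-pair 1≤p aoH f.C∈ f′.C∈ c∈ c∈₂ c′∈ c′∈₂ sc
         | jd ← common-pair 1≤q aoK f.D∈ f′.D∈ d∈ d∈₂ d′∈ d′∈₂ sd
      with Jumping.jump f.jumps z∈ z′∈ (ja , jb , jc , jd) | Jumping.jump f′.jumps z∈′ z′∈′ (ja , jb , jc , jd)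
    ... | inj₁ e | _ = ⊥-elim (z≢z′ e)
    ... | inj₂ _ | inj₁ e = ⊥-elim (z≢z′ e)
    ... | inj₂ r | inj₂ r′ = corner (moved ja a≢) (moved jb b≢) (moved jc c≢) (moved jd d≢)
      where
      b≢ : b ≢ b′
      b≢ e = not-common goodG f.B∈ f′.B∈ (Rigid.fixed₂ r e) (Rigid.fixed₂ r′ e)
      c≢ : c ≢ c′
      c≢ e = not-common goodH f.C∈ f′.C∈ (Rigid.fixed₃ r e) (Rigid.fixed₃ r′ e)
      d≢ : d ≢ d′
      d≢ e = not-common goodK f.D∈ f′.D∈ (Rigid.fixed₄ r e) (Rigid.fixed₄ r′ e)
      only : ∀ {k} {A : Chain k} {x y} → A ≡ x ∷ [] → y ∈ A → x ≢ y → ⊥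
      only refl (here refl) ≢ = ≢ refl
      a≢ : a ≢ a′
      a≢ e with Rigid.fixed₁ r e
      ... | inj₁ single        = only single b′∈ b≢
      ... | inj₂ (inj₁ single) = only single c′∈ c≢
      ... | inj₂ (inj₂ single) = only single d′∈ d≢
      moved : ∀ {k} {x y : Subset k} → x ≡ y ⊎ (x ≡ ∅ × y ≡ full) → x ≢ y → x ≡ ∅ × y ≡ full
      moved (inj₁ e) ≢ = ⊥-elim (≢ e)
      moved (inj₂ e) _ = e
      corner : a ≡ ∅ × a′ ≡ full → b ≡ ∅ × b′ ≡ full → c ≡ ∅ × c′ ≡ full → d ≡ ∅ × d′ ≡ full →
        (a , b , c , d) ≡ (∅ , ∅ , ∅ , ∅) × (a′ , b′ , c′ , d′) ≡ (full , full , full , full)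
      corner (refl , refl) (refl , refl) (refl , refl) (refl , refl) = refl , refl

    orthogonal-pair : (FullBoth (map join l) (map join l′) → inter (map join l) (map join l′) ≡ 2) ×
      (¬ FullBoth (map join l) (map join l′) → inter (map join l) (map join l′) ≤ 1)
    orthogonal-pair = almost-orthogonal (≤-trans 1≤m (m≤m+n m _))
      (Run⇒AllPairs (Run-image {Box} {Cube N} 0 rk-join join-mono (Jumping.run f.jumps))) common
      where
      common : ∀ {x y} → x ∈ map join l → x ∈ map join l′ → y ∈ map join l → y ∈ map join l′ → x ⊆ y → x ≢ y →
        x ≡ ∅ × y ≡ full
      common x∈ x∈′ y∈ y∈′ x⊆y x≢y
        with z , z∈ , refl ← ∈-map⁻ join x∈ | z₂ , z∈′ , e ← ∈-map⁻ join x∈′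
           | w , w∈ , refl ← ∈-map⁻ join y∈ | w₂ , w∈′ , e′ ← ∈-map⁻ join y∈′
        with refl ← join-injective z z₂ e | refl ← join-injective w w₂ e′
        with refl , refl ← common-corner z∈ z∈′ w∈ w∈′ (join-mono⁻ z w x⊆y) (x≢y ∘ cong join) =
        join-constant outside , join-constant inside

theorem9p1 : (m n p q k : ℕ) → 3 ≤ m → m % 2 ≡ 1 → 2 ≤ n → n % 2 ≡ 0
    → 2 ≤ p → p % 2 ≡ 0 → 2 ≤ q → q % 2 ≡ 0 → 3 ≤ k
    → (F : Fin k → List (Chain m)) (G : Fin k → List (Chain n))
    → (H : Fin k → List (Chain p)) (K : Fin k → List (Chain q))
    → (∀ i → IsSCD m (F i)) → (∀ i → IsSCD n (G i))
    → (∀ i → IsSCD p (H i)) → (∀ i → IsSCD q (K i))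
    → PairwiseAO F → PairwiseAO G → PairwiseAO H → PairwiseAO K
    → Good G → Good H → Good K
    → Σ (Fin k → List (Chain (m + (n + (p + q))))) λ D →
    (∀ i → IsSCD (m + (n + (p + q))) (D i))
    × PairwiseAO D
    × (∀ i X → X ∈ D i → Σ (Chain m) λ A → Σ (Chain n) λ B → Σ (Chain p) λ C → Σ (Chain q) λ E →
    A ∈ F i × B ∈ G i × C ∈ H i × E ∈ K i × InCuboid X A B C E)
theorem9p1 m n p q k 3≤m odd 2≤n even₂ 2≤p even₃ 2≤q even₄ _ F G H K sF sG sH sK aoF aoG aoH aoK goodG goodH goodK =
  (λ i → map (map join) (S i)) , scd , orthogonal , contained
  where
  open Product m n p q
  decomposition : ∀ i → _
  decomposition i = extract (family (F i) (G i) (H i) (K i) 3≤m odd even₂ even₃ even₄ (sF i) (sG i) (sH i) (sK i))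
  S : Fin k → _
  S i = proj₁ (decomposition i)
  fine : ∀ i {X} → X ∈ map (map join) (S i) → ∃[ l ] Fine (F i) (G i) (H i) (K i) l × X ≡ map join l
  fine i X∈ with l , l∈ , e ← ∈-map⁻ (map join) X∈ = l , All.lookup (proj₁ (proj₂ (decomposition i))) l∈ , e
  scd : ∀ i → IsSCD N (map (map join) (S i))
  scd i = symmetric ,
    mass⇒SCD {S i} (proj₂ (proj₂ (decomposition i))) (boxes-indicator (F i) (G i) (H i) (K i) (sF i) (sG i) (sH i) (sK i))
    where
    symmetric : ∀ X → X ∈ map (map join) (S i) → IsSymChain N X
    symmetric X X∈ with l , f , refl ← fine i X∈ = Fine⇒SymChain _ _ _ _ f
  orthogonal : PairwiseAO (λ i → map (map join) (S i))
  orthogonal i j i≢j X Y X∈ Y∈ with l , f , refl ← fine i X∈ | l′ , f′ , refl ← fine j Y∈ =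
    orthogonal-pair (≤-trans (s≤s z≤n) 3≤m) (<⇒≤ 2≤n) (<⇒≤ 2≤p) (<⇒≤ 2≤q)
      (aoF i j i≢j) (aoG i j i≢j) (aoH i j i≢j) (aoK i j i≢j) (goodG i j i≢j) (goodH i j i≢j) (goodK i j i≢j) f f′
  contained : ∀ i X → X ∈ map (map join) (S i) → _
  contained i X X∈ with l , f , refl ← fine i X∈ =
    Fine.A f , Fine.B f , Fine.C f , Fine.D f , Fine.A∈ f , Fine.B∈ f , Fine.C∈ f , Fine.D∈ f , Fine⇒InCuboid _ _ _ _ f
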